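{- For every $n\ge1$, the number $\#AD_n$ of domino tilings of the Aztec diamond $AD_n$ is $$\#AD_n=\det\begin{bmatrix} S_n & I_n\\ -I_n & S_n^T\end{bmatrix},$$ where $S_n$ is the $n\times n$ upper triangular matrix with the $i$-th large Schröder number on its $i$-th superdiagonal, i.e. $(S_n)_{pq}=s_{q-p}$ for $q\ge p$ and $0$ otherwise.
   Context: The Aztec diamond $AD_n$ is the union of the $2n(n+1)$ unit squares in the plane whose vertices are integral points $(x,y)$ with $|x|+|y|\le n+1$. A domino tiling is a tiling by $1\times2$ and $2\times1$ rectangles made of two unit squares. The $m$-th large Schröder number $s_m$ ($m\ge0$) is the number of lattice paths from $(0,0)$ to $(m,m)$ using steps $(0,1)$, $(1,0)$, $(1,1)$ that do not pass above the line $y=x$; $s_0,\dots,s_5=1,2,6,22,90,394$. The $0$-th superdiagonal is the main diagonal. -}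

module Defs where

open import Algebra.Properties.Semiring.Sum using (sum)
open import Data.Bool.Base using (if_then_else_)
open import Data.Fin.Base using (Fin; zero; suc; toℕ)
import Data.Fin.Properties as Fin
open import Data.Integer.Base using (ℤ; +_; -_; _+_; _*_; _-_; _^_; ∣_∣; 0ℤ; 1ℤ; -1ℤ)
import Data.Integer.Properties as ℤ
open import Data.List.Base
  using (List; []; _∷_; _++_; map; filter; length; foldl; inits; upTo; concatMap;
         cartesianProduct; cartesianProductWith)
open import Data.List.Membership.DecPropositional using () renaming (_∈?_ to mem?)
open import Data.List.Membership.Propositional using (_∈_)
open import Data.List.Relation.Unary.All using (All; all?)
open import Data.Nat.Base as ℕ using (ℕ; zero; suc; _≤_; _∸_)
import Data.Nat.Properties as ℕ
open import Data.Product.Base using (_×_; _,_; proj₁; proj₂)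
open import Data.Product.Properties using (≡-dec)
import Data.Vec.Functional as Vector
open import Relation.Binary.Definitions using (DecidableEquality)
open import Relation.Binary.PropositionalEquality.Core using (_≡_)
open import Relation.Nullary.Decidable.Core using (Dec; does; _×-dec_)

------------------------------------------------------------------------
-- Domino tilings of the Aztec diamond

Point : Set
Point = ℤ × ℤ

-- The unit square [x , x+1] × [y , y+1] is represented by its lower-left
-- vertex (x , y).
Square : Set
Square = Point

vertices : Square → List Point
vertices (x , y) =
  (x , y) ∷ (x + 1ℤ , y) ∷ (x , y + 1ℤ) ∷ (x + 1ℤ , y + 1ℤ) ∷ []

InAD : ℕ → Square → Set
InAD n q = All (λ (x , y) → ∣ x ∣ ℕ.+ ∣ y ∣ ≤ suc n) (vertices q)

inAD? : ∀ n q → Dec (InAD n q)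
inAD? n q = all? (λ (x , y) → ∣ x ∣ ℕ.+ ∣ y ∣ ℕ.≤? suc n) (vertices q)

-- Coordinates -(n+1), …, n; every square of the diamond has its lower-left
-- vertex in range n × range n.
range : ℕ → List ℤ
range n = map (λ i → + i - + suc n) (upTo (2 ℕ.* suc n))

squaresAD : ℕ → List Square
squaresAD n = filter (inAD? n) (cartesianProduct (range n) (range n))

-- A domino is named by its left, respectively lower, square.
data Domino : Set where
  horizontal vertical : Square → Domino

squares : Domino → List Square
squares (horizontal (x , y)) = (x , y) ∷ (x + 1ℤ , y) ∷ []
squares (vertical   (x , y)) = (x , y) ∷ (x , y + 1ℤ) ∷ []

dominoesAD : ℕ → List Domino
dominoesAD n =
  filter (λ d → all? (inAD? n) (squares d))
         (map horizontal (squaresAD n) ++ map vertical (squaresAD n))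

_≟□_ : DecidableEquality Square
_≟□_ = ≡-dec ℤ._≟_ ℤ._≟_

_∈□?_ : (q : Square) (qs : List Square) → Dec (q ∈ qs)
_∈□?_ = mem? _≟□_

covering : Square → List Domino → List Domino
covering q = filter (λ d → q ∈□? squares d)

-- For a set t of dominoes contained in the diamond: every square of the
-- diamond lies in exactly one domino of t.
IsTiling : ℕ → List Domino → Set
IsTiling n t = All (λ q → length (covering q t) ≡ 1) (squaresAD n)

isTiling? : ∀ n t → Dec (IsTiling n t)
isTiling? n t = all? (λ q → length (covering q t) ℕ.≟ 1) (squaresAD n)

sublists : {A : Set} → List A → List (List A)
sublists []       = [] ∷ []
sublists (x ∷ xs) = map (x ∷_) (sublists xs) ++ sublists xs

-- dominoesAD n has no repeated entries, so its sublists correspond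
-- one-to-one to the sets of dominoes contained in the diamond.
tilingsAD : ℕ → List (List Domino)
tilingsAD n = filter (isTiling? n) (sublists (dominoesAD n))

#AD : ℕ → ℕ
#AD n = length (tilingsAD n)

------------------------------------------------------------------------
-- Large Schröder numbers

data Step : Set where
  north east diagonal : Step

move : ℕ × ℕ → Step → ℕ × ℕ
move (x , y) north    = x , suc y
move (x , y) east     = suc x , y
move (x , y) diagonal = suc x , suc y

endpoint : List Step → ℕ × ℕ
endpoint = foldl move (0 , 0)

-- The endpoints of the prefixes are the lattice points visited by the path.
NotAboveDiagonal : List Step → Set
NotAboveDiagonal w = All (λ u → proj₂ (endpoint u) ≤ proj₁ (endpoint u)) (inits w)

IsSchröderPath : ℕ → List Step → Set
IsSchröderPath m w = endpoint w ≡ (m , m) × NotAboveDiagonal w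

isSchröderPath? : ∀ m w → Dec (IsSchröderPath m w)
isSchröderPath? m w =
  ≡-dec ℕ._≟_ ℕ._≟_ (endpoint w) (m , m)
    ×-dec all? (λ u → proj₂ (endpoint u) ℕ.≤? proj₁ (endpoint u)) (inits w)

words : ℕ → List (List Step)
words zero    = [] ∷ []
words (suc k) = cartesianProductWith _∷_ (north ∷ east ∷ diagonal ∷ []) (words k)

-- Every step increases x + y, so a path to (m , m) has at most 2m steps.
schröderPaths : ℕ → List (List Step)
schröderPaths m = filter (isSchröderPath? m) (concatMap words (upTo (suc (2 ℕ.* m))))

schröder : ℕ → ℕ
schröder m = length (schröderPaths m)

------------------------------------------------------------------------
-- Integer matrices

Matrix : ℕ → ℕ → Set
Matrix m n = Fin m → Fin n → ℤ

-- Cofactor expansion along the first row.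
det : ∀ {n} → Matrix n n → ℤ
det {zero}  M = 1ℤ
det {suc n} M = sum ℤ.+-*-semiring λ j →
  -1ℤ ^ toℕ j * M zero j * det (λ i → Vector.removeAt (M (suc i)) j)

_ᵀ : ∀ {m n} → Matrix m n → Matrix n m
(M ᵀ) i j = M j i

-ᴹ_ : ∀ {m n} → Matrix m n → Matrix m n
(-ᴹ M) i j = - M i j

I : ∀ n → Matrix n n
I n i j = if does (i Fin.≟ j) then 1ℤ else 0ℤ

block : ∀ {m n p q} → Matrix m p → Matrix m q → Matrix n p → Matrix n q →
        Matrix (m ℕ.+ n) (p ℕ.+ q)
block A B C D = (λ i → A i Vector.++ B i) Vector.++ (λ i → C i Vector.++ D i)

S : ∀ n → Matrix n n
S n p q = if does (p Fin.≤? q) then + schröder (toℕ q ∸ toℕ p) else 0ℤ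

{-# OPTIONS --safe #-}

-- Both sides are equal to 2^(n(n+1)/2).
--
-- Cut the diamond along the diagonals x + y = const.  Two consecutive diagonals
-- form a zigzag path, so tilings are counted by alternately applying two
-- transfer operators to subsets of a diagonal.  Exchanging the two operators
-- costs a factor 2 and shortens the diagonals by one; doing so n times in the
-- product for AD_n leaves 2^n times the product for AD_(n-1).
--
-- For the determinant let s be the Schröder series and λ = x (1 + s).  From
-- s = 1 + x s + x s² one gets s = 1 + λ s and λ² = (1 + x) λ - 2 x.  Hence there are
-- polynomials γ_t and E_t of degree t, solutions of
-- X_(t+2) = (1 + x) X_(t+1) - 2 x X_t, with γ_t + s E_t = (1 + s) λ^t.  Together
-- with δ_t = E_t - 2 λ^t + λ^(t+1), which satisfies s δ_t = -γ_t, the γ_t are the rows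
-- of a unitriangular matrix that turns the block matrix into a lower triangular
-- one with diagonal 2^n, …, 4, 2, 1, …, 1.
module Submission where

open import Defs
open import Data.Bool.Base using (Bool; true; false; not; if_then_else_)
open import Data.Bool.Properties using (not-involutive)
open import Data.Empty using (⊥-elim)
open import Data.Fin.Base as Fin using (Fin; zero; suc; toℕ; inject₁; punchIn; _↑ˡ_; _↑ʳ_)
open import Data.Fin.Properties using (toℕ-inject₁; toℕ-↑ˡ; toℕ-↑ʳ; toℕ<n; join-splitAt)
open import Data.Integer.Base as ℤ using (ℤ; 0ℤ; 1ℤ; -1ℤ; +_; -[1+_]; ∣_∣)
import Data.Integer.Properties as ℤ
import Data.Integer.Tactic.RingSolver as ℤ-Solver
open import Data.List.Base
  using (List; []; _∷_; _++_; map; filter; length; foldl; inits; upTo; applyUpTo; concatMap;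
         cartesianProduct; cartesianProductWith)
open import Data.List.Membership.DecPropositional using () renaming (_∈?_ to mem?)
open import Data.List.Membership.Propositional using (_∈_; _∉_)
open import Data.List.Membership.Propositional.Properties
  using (∈-++⁺ˡ; ∈-++⁺ʳ; ∈-++⁻; ∈-map⁺; ∈-map⁻; ∈-filter⁺; ∈-filter⁻; ∈-upTo⁺; ∈-upTo⁻;
         ∈-cartesianProduct⁺; ∈-cartesianProductWith⁺; ∈-cartesianProductWith⁻)
open import Data.List.Membership.Propositional.Properties.WithK using (unique∧set⇒bag)
open import Data.List.Properties
  using (filter-++; filter-none; filter-accept; filter-reject; length-++; map-injective)
open import Data.List.Relation.Binary.BagAndSetEquality using (∼bag⇒↭)
open import Data.List.Relation.Binary.Permutation.Propositional as ↭ using (_↭_)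
open import Data.List.Relation.Unary.All as All using (All; []; _∷_; all?)
import Data.List.Relation.Unary.All.Properties as All
open import Data.List.Relation.Unary.AllPairs using ([]; _∷_)
open import Data.List.Relation.Unary.Any using (here; there)
open import Data.List.Relation.Unary.Unique.Propositional using (Unique)
import Data.List.Relation.Unary.Unique.Propositional.Properties as Unique
open import Data.Nat.Base as ℕ using (ℕ; zero; suc; _≤_; _<_; z≤n; s≤s)
import Data.Nat.Properties as ℕ
import Data.Nat.Tactic.RingSolver as ℕ-Solver
open import Data.Product.Base using (∃; _×_; _,_; proj₁; proj₂)
open import Data.Product.Properties using (≡-dec)
open import Data.Sum.Base using (_⊎_; inj₁; inj₂)
open import Data.Unit.Base using (⊤; tt)
open import Data.Vec.Base as Vec using (Vec; []; _∷_; replicate)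
import Data.Vec.Functional as Vector
open import Data.Vec.Functional.Properties using (lookup-++ˡ; lookup-++ʳ)
open import Data.Vec.Properties using (map-replicate)
open import Algebra.Properties.CommutativeSemigroup ℕ.+-commutativeSemigroup
  using () renaming (interchange to +-interchange)
open import Algebra.Properties.Semiring.Sum ℤ.+-*-semiring
  using (sum; sum-cong-≗; ∑-distrib-+; ∑-comm; *-distribˡ-sum; *-distribʳ-sum; sum-replicate-zero)
open import Function.Base using (_∘_; id)
open import Function.Bundles using (mk⇔)
open import Relation.Binary.Definitions using (DecidableEquality)
open import Relation.Binary.PropositionalEquality
open import Relation.Nullary.Decidable using (yes; no; does; map′; _×-dec_)
open import Relation.Nullary.Negation using (¬_)
open import Relation.Unary using (Decidable)

-- Power series

-- Multiplication by `S` convolves a row with `s` when the row is read from the diagonal to the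
-- right, multiplication by its transpose when the row is read from the right end. A row of the
-- elimination matrix must work in both readings, so reversed polynomials are needed. With t the
-- distance of the row from the last one, γ_t and δ_t are the readings from the end, which clears
-- the upper right block. Read from the diagonal, the γ-part is the reverse of γ_t, and its product
-- with `s` is E_t + (s - 1) λ^t. Since λ^t starts with 2^t x^t, the second term is invisible up to
-- index t; since E_t is palindromic, it cancels against its copy in δ_t. What remains is 2 λ^t:
-- zero above the diagonal, 2^(t+1) on it.
--
-- The exchange of the transfer operators holds only up to complementing the rows at both ends. From
-- c covered cells out of N, passing through a row of N + 1 cells leads to c + 1 covered cells,
-- passing through a row of N - 1 cells to c - 1; complementing before and after turns the latter
-- into c + 1.

Series : Set
Series = ℕ → ℤ

infixl 7 _⊛_
infixl 6 _⊕_

_⊕_ : Series → Series → Series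
(a ⊕ b) n = a n ℤ.+ b n

_·_ : ℤ → Series → Series
(c · a) n = c ℤ.* a n

one : Series
one zero    = 1ℤ
one (suc n) = 0ℤ

x·_ : Series → Series
(x· a) zero    = 0ℤ
(x· a) (suc n) = a n

-- The Cauchy product, with the constant term of the left factor split off. The rows of a Toeplitz
-- product unfold by the same recursion.
_⊛_ : Series → Series → Series
(a ⊛ b) zero    = a 0 ℤ.* b 0
(a ⊛ b) (suc n) = a 0 ℤ.* b (suc n) ℤ.+ (a ∘ suc ⊛ b) n

x·-cong : ∀ {a b} → a ≗ b → x· a ≗ x· b
x·-cong a≗b zero    = refl
x·-cong a≗b (suc n) = a≗b n

⊛-cong : ∀ {a b c d} → a ≗ b → c ≗ d → a ⊛ c ≗ b ⊛ d
⊛-cong a≗b c≗d zero    = cong₂ ℤ._*_ (a≗b 0) (c≗d 0)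
⊛-cong a≗b c≗d (suc n) =
  cong₂ ℤ._+_ (cong₂ ℤ._*_ (a≗b 0) (c≗d (suc n))) (⊛-cong (a≗b ∘ suc) c≗d n)

⊛-distribˡ : ∀ a b c → a ⊛ (b ⊕ c) ≗ a ⊛ b ⊕ a ⊛ c
⊛-distribˡ a b c zero    = ℤ.*-distribˡ-+ (a 0) (b 0) (c 0)
⊛-distribˡ a b c (suc n) = trans (cong (λ z → a 0 ℤ.* (b (suc n) ℤ.+ c (suc n)) ℤ.+ z) (⊛-distribˡ (a ∘ suc) b c n))
  (lem (a 0) (b (suc n)) (c (suc n)) _ _)
  where
  lem : ∀ a b c d e → a ℤ.* (b ℤ.+ c) ℤ.+ (d ℤ.+ e) ≡ (a ℤ.* b ℤ.+ d) ℤ.+ (a ℤ.* c ℤ.+ e)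
  lem = ℤ-Solver.solve-∀

⊛-distribʳ : ∀ c a b → (a ⊕ b) ⊛ c ≗ a ⊛ c ⊕ b ⊛ c
⊛-distribʳ c a b zero    = ℤ.*-distribʳ-+ (c 0) (a 0) (b 0)
⊛-distribʳ c a b (suc n) = trans (cong (λ z → (a 0 ℤ.+ b 0) ℤ.* c (suc n) ℤ.+ z) (⊛-distribʳ c (a ∘ suc) (b ∘ suc) n))
  (lem (a 0) (b 0) (c (suc n)) _ _)
  where
  lem : ∀ a b c d e → (a ℤ.+ b) ℤ.* c ℤ.+ (d ℤ.+ e) ≡ (a ℤ.* c ℤ.+ d) ℤ.+ (b ℤ.* c ℤ.+ e)
  lem = ℤ-Solver.solve-∀

⊛-·ʳ : ∀ k a b → a ⊛ (k · b) ≗ k · (a ⊛ b)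
⊛-·ʳ k a b zero    = lem (a 0) k (b 0)
  where
  lem : ∀ a k b → a ℤ.* (k ℤ.* b) ≡ k ℤ.* (a ℤ.* b)
  lem = ℤ-Solver.solve-∀
⊛-·ʳ k a b (suc n) = trans (cong (λ z → a 0 ℤ.* (k ℤ.* b (suc n)) ℤ.+ z) (⊛-·ʳ k (a ∘ suc) b n)) (lem (a 0) k (b (suc n)) _)
  where
  lem : ∀ a k b d → a ℤ.* (k ℤ.* b) ℤ.+ k ℤ.* d ≡ k ℤ.* (a ℤ.* b ℤ.+ d)
  lem = ℤ-Solver.solve-∀

⊛-·ˡ : ∀ k a b → (k · a) ⊛ b ≗ k · (a ⊛ b)
⊛-·ˡ k a b zero    = ℤ.*-assoc k (a 0) (b 0)
⊛-·ˡ k a b (suc n) = trans (cong (λ z → k ℤ.* a 0 ℤ.* b (suc n) ℤ.+ z) (⊛-·ˡ k (a ∘ suc) b n)) (lem (a 0) k (b (suc n)) _)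
  where
  lem : ∀ a k b d → k ℤ.* a ℤ.* b ℤ.+ k ℤ.* d ≡ k ℤ.* (a ℤ.* b ℤ.+ d)
  lem = ℤ-Solver.solve-∀

⊛-x·ˡ : ∀ a b → (x· a) ⊛ b ≗ x· (a ⊛ b)
⊛-x·ˡ a b zero    = refl
⊛-x·ˡ a b (suc n) = ℤ.+-identityˡ _

⊛-x·ʳ : ∀ a b → a ⊛ (x· b) ≗ x· (a ⊛ b)
⊛-x·ʳ a b zero    = ℤ.*-zeroʳ (a 0)
⊛-x·ʳ a b (suc zero) = trans (cong (λ z → a 0 ℤ.* b 0 ℤ.+ z) (ℤ.*-zeroʳ (a 1))) (ℤ.+-identityʳ _)
⊛-x·ʳ a b (suc (suc n)) = cong (λ z → a 0 ℤ.* b (suc n) ℤ.+ z) (⊛-x·ʳ (a ∘ suc) b (suc n))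

⊛-assoc : ∀ a b c → (a ⊛ b) ⊛ c ≗ a ⊛ (b ⊛ c)
⊛-assoc a b c zero    = ℤ.*-assoc (a 0) (b 0) (c 0)
⊛-assoc a b c (suc n) = begin
  a 0 ℤ.* b 0 ℤ.* c (suc n) ℤ.+ (((a 0 · (b ∘ suc)) ⊕ (a ∘ suc ⊛ b)) ⊛ c) n
    ≡⟨ cong (λ z → a 0 ℤ.* b 0 ℤ.* c (suc n) ℤ.+ z)
         (trans (⊛-distribʳ c (a 0 · (b ∘ suc)) (a ∘ suc ⊛ b) n)
           (cong₂ ℤ._+_ (⊛-·ˡ (a 0) (b ∘ suc) c n) (⊛-assoc (a ∘ suc) b c n))) ⟩
  a 0 ℤ.* b 0 ℤ.* c (suc n) ℤ.+ (a 0 ℤ.* (b ∘ suc ⊛ c) n ℤ.+ (a ∘ suc ⊛ (b ⊛ c)) n)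
    ≡⟨ lem (a 0) (b 0) (c (suc n)) _ _ ⟩
  a 0 ℤ.* (b 0 ℤ.* c (suc n) ℤ.+ (b ∘ suc ⊛ c) n) ℤ.+ (a ∘ suc ⊛ (b ⊛ c)) n ∎
  where
  open ≡-Reasoning
  lem : ∀ a b c d e → a ℤ.* b ℤ.* c ℤ.+ (a ℤ.* d ℤ.+ e) ≡ a ℤ.* (b ℤ.* c ℤ.+ d) ℤ.+ e
  lem = ℤ-Solver.solve-∀

⊛-identityʳ : ∀ a → a ⊛ one ≗ a
⊛-identityʳ a zero    = ℤ.*-identityʳ (a 0)
⊛-identityʳ a (suc n) = trans (cong₂ ℤ._+_ (ℤ.*-zeroʳ (a 0)) (⊛-identityʳ (a ∘ suc) n)) (ℤ.+-identityˡ _)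

⊛-identityˡ : ∀ a → one ⊛ a ≗ a
⊛-identityˡ a zero    = ℤ.*-identityˡ (a 0)
⊛-identityˡ a (suc n) = trans (cong₂ ℤ._+_ (ℤ.*-identityˡ (a (suc n))) (zeros n)) (ℤ.+-identityʳ _)
  where
  zeros : ∀ n → ((λ _ → 0ℤ) ⊛ a) n ≡ 0ℤ
  zeros zero    = refl
  zeros (suc n) = trans (ℤ.+-identityˡ _) (zeros n)

⊛-vanish : ∀ a b n → (∀ {m} → m ℕ.≤ n → b m ≡ 0ℤ) → (a ⊛ b) n ≡ 0ℤ
⊛-vanish a b zero    b≡0 = trans (cong (a 0 ℤ.*_) (b≡0 ℕ.≤-refl)) (ℤ.*-zeroʳ (a 0))
⊛-vanish a b (suc n) b≡0 = trans
  (cong₂ ℤ._+_ (trans (cong (a 0 ℤ.*_) (b≡0 ℕ.≤-refl)) (ℤ.*-zeroʳ (a 0)))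
               (⊛-vanish (a ∘ suc) b n (λ m≤n → b≡0 (ℕ.m≤n⇒m≤1+n m≤n))))
  (ℤ.+-identityˡ 0ℤ)

⊛-leading : ∀ a b n → (∀ {m} → m ℕ.< n → b m ≡ 0ℤ) → (a ⊛ b) n ≡ a 0 ℤ.* b n
⊛-leading a b zero    b≡0 = refl
⊛-leading a b (suc n) b≡0 = trans
  (cong (λ z → a 0 ℤ.* b (suc n) ℤ.+ z) (⊛-vanish (a ∘ suc) b n (λ m≤n → b≡0 (ℕ.s≤s m≤n))))
  (ℤ.+-identityʳ _)

-- A linear recurrence for families of series

step : Series → Series → Series
step a b = b ⊕ x· b ⊕ -1ℤ · (x· (a ⊕ a))

record Recurrent (X : ℕ → Series) : Set where
  constructor recurrent
  field recurrence : ∀ t → X (2 ℕ.+ t) ≗ step (X t) (X (1 ℕ.+ t))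
open Recurrent

step-cong : ∀ {a b c d} → a ≗ b → c ≗ d → step a c ≗ step b d
step-cong a≗b c≗d n = cong₂ (λ u v → u ℤ.+ -1ℤ ℤ.* v)
  (cong₂ ℤ._+_ (c≗d n) (x·-cong c≗d n)) (x·-cong (λ m → cong₂ ℤ._+_ (a≗b m) (a≗b m)) n)

-- Together with the closure lemmas below (sums, scalars, multiplication by a fixed series) this
-- reduces an identity between two families to the cases t = 0 and t = 1.
recurrent-unique : ∀ {X Y} → Recurrent X → Recurrent Y → X 0 ≗ Y 0 → X 1 ≗ Y 1 → ∀ t → X t ≗ Y t
recurrent-unique X-rec Y-rec X₀ X₁ zero          = X₀
recurrent-unique X-rec Y-rec X₀ X₁ (suc zero)    = X₁
recurrent-unique X-rec Y-rec X₀ X₁ (suc (suc t)) n = begin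
  _ ≡⟨ recurrence X-rec t n ⟩
  _ ≡⟨ step-cong (recurrent-unique X-rec Y-rec X₀ X₁ t) (recurrent-unique X-rec Y-rec X₀ X₁ (suc t)) n ⟩
  _ ≡⟨ recurrence Y-rec t n ⟨
  _ ∎
  where open ≡-Reasoning

recurrent-⊕ : ∀ {X Y} → Recurrent X → Recurrent Y → Recurrent (λ t → X t ⊕ Y t)
recurrent-⊕ {X} {Y} X-rec Y-rec .recurrence t n =
  trans (cong₂ ℤ._+_ (recurrence X-rec t n) (recurrence Y-rec t n)) (lem n)
  where
  lem : ∀ n → (step (X t) (X (suc t)) ⊕ step (Y t) (Y (suc t))) n
            ≡ step (X t ⊕ Y t) (X (suc t) ⊕ Y (suc t)) n
  lem zero    = lem₀ (X (suc t) 0) (Y (suc t) 0)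
    where
    lem₀ : ∀ a b → (a ℤ.+ 0ℤ ℤ.+ -1ℤ ℤ.* 0ℤ) ℤ.+ (b ℤ.+ 0ℤ ℤ.+ -1ℤ ℤ.* 0ℤ) ≡ a ℤ.+ b ℤ.+ 0ℤ ℤ.+ -1ℤ ℤ.* 0ℤ
    lem₀ = ℤ-Solver.solve-∀
  lem (suc n) = lem₁ (X (suc t) (suc n)) (X (suc t) n) (X t n) (Y (suc t) (suc n)) (Y (suc t) n) (Y t n)
    where
    lem₁ : ∀ a b c d e f →
      (a ℤ.+ b ℤ.+ -1ℤ ℤ.* (c ℤ.+ c)) ℤ.+ (d ℤ.+ e ℤ.+ -1ℤ ℤ.* (f ℤ.+ f))
      ≡ a ℤ.+ d ℤ.+ (b ℤ.+ e) ℤ.+ -1ℤ ℤ.* (c ℤ.+ f ℤ.+ (c ℤ.+ f))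
    lem₁ = ℤ-Solver.solve-∀

recurrent-· : ∀ k {X} → Recurrent X → Recurrent (λ t → k · X t)
recurrent-· k {X} X-rec .recurrence t n = trans (cong (k ℤ.*_) (recurrence X-rec t n)) (lem n)
  where
  lem : ∀ n → k ℤ.* step (X t) (X (suc t)) n ≡ step (k · X t) (k · X (suc t)) n
  lem zero    = lem₀ k (X (suc t) 0)
    where
    lem₀ : ∀ k a → k ℤ.* (a ℤ.+ 0ℤ ℤ.+ -1ℤ ℤ.* 0ℤ) ≡ k ℤ.* a ℤ.+ 0ℤ ℤ.+ -1ℤ ℤ.* 0ℤ
    lem₀ = ℤ-Solver.solve-∀
  lem (suc n) = lem₁ k (X (suc t) (suc n)) (X (suc t) n) (X t n)
    where
    lem₁ : ∀ k a b c → k ℤ.* (a ℤ.+ b ℤ.+ -1ℤ ℤ.* (c ℤ.+ c))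
         ≡ k ℤ.* a ℤ.+ k ℤ.* b ℤ.+ -1ℤ ℤ.* (k ℤ.* c ℤ.+ k ℤ.* c)
    lem₁ = ℤ-Solver.solve-∀

recurrent-⊛ˡ : ∀ a {X} → Recurrent X → Recurrent (λ t → a ⊛ X t)
recurrent-⊛ˡ a {X} X-rec .recurrence t n = begin
  (a ⊛ X (2 ℕ.+ t)) n
    ≡⟨ ⊛-cong (λ _ → refl) (recurrence X-rec t) n ⟩
  (a ⊛ step (X t) (X (1 ℕ.+ t))) n
    ≡⟨ ⊛-distribˡ a (X (1 ℕ.+ t) ⊕ x· X (1 ℕ.+ t)) (-1ℤ · (x· (X t ⊕ X t))) n ⟩
  (a ⊛ (X (1 ℕ.+ t) ⊕ x· X (1 ℕ.+ t)) ⊕ a ⊛ (-1ℤ · (x· (X t ⊕ X t)))) n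
    ≡⟨ cong₂ ℤ._+_
         (trans (⊛-distribˡ a (X (1 ℕ.+ t)) (x· X (1 ℕ.+ t)) n)
                (cong (λ z → (a ⊛ X (1 ℕ.+ t)) n ℤ.+ z) (⊛-x·ʳ a (X (1 ℕ.+ t)) n)))
         (trans (⊛-·ʳ -1ℤ a (x· (X t ⊕ X t)) n)
           (cong (-1ℤ ℤ.*_) (trans (⊛-x·ʳ a (X t ⊕ X t) n) (x·-cong (⊛-distribˡ a (X t) (X t)) n)))) ⟩
  step (a ⊛ X t) (a ⊛ X (1 ℕ.+ t)) n ∎
  where open ≡-Reasoning

recurrent-⊛ʳ : ∀ a {X} → Recurrent X → Recurrent (λ t → X t ⊛ a)
recurrent-⊛ʳ a {X} X-rec .recurrence t n = begin
  (X (2 ℕ.+ t) ⊛ a) n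
    ≡⟨ ⊛-cong (recurrence X-rec t) (λ _ → refl) n ⟩
  (step (X t) (X (1 ℕ.+ t)) ⊛ a) n
    ≡⟨ ⊛-distribʳ a (X (1 ℕ.+ t) ⊕ x· X (1 ℕ.+ t)) (-1ℤ · (x· (X t ⊕ X t))) n ⟩
  ((X (1 ℕ.+ t) ⊕ x· X (1 ℕ.+ t)) ⊛ a ⊕ (-1ℤ · (x· (X t ⊕ X t))) ⊛ a) n
    ≡⟨ cong₂ ℤ._+_
         (trans (⊛-distribʳ a (X (1 ℕ.+ t)) (x· X (1 ℕ.+ t)) n)
                (cong (λ z → (X (1 ℕ.+ t) ⊛ a) n ℤ.+ z) (⊛-x·ˡ (X (1 ℕ.+ t)) a n)))
         (trans (⊛-·ˡ -1ℤ (x· (X t ⊕ X t)) a n)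
           (cong (-1ℤ ℤ.*_) (trans (⊛-x·ˡ (X t ⊕ X t) a n) (x·-cong (⊛-distribʳ a (X t) (X t)) n)))) ⟩
  step (X t ⊛ a) (X (1 ℕ.+ t) ⊛ a) n ∎
  where open ≡-Reasoning

solution : Series → Series → ℕ → Series
solution a b zero          = a
solution a b (suc zero)    = b
solution a b (suc (suc t)) = step (solution a b t) (solution a b (suc t))

solution-recurrent : ∀ a b → Recurrent (solution a b)
solution-recurrent a b .recurrence t n = refl

triangle : ℕ → ℕ
triangle zero    = 0
triangle (suc n) = suc n ℕ.+ triangle n

2^_ : ℕ → ℤ
2^ t = + (2 ℕ.^ t)

2^-suc : ∀ t → 2^ suc t ≡ + 2 ℤ.* 2^ t
2^-suc t = ℤ.pos-* 2 (2 ℕ.^ t)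

solution-degree : ∀ {a b} → (∀ {k} → 0 ℕ.< k → a k ≡ 0ℤ) → (∀ {k} → 1 ℕ.< k → b k ≡ 0ℤ) →
  ∀ t {k} → t ℕ.< k → solution a b t k ≡ 0ℤ
solution-degree a≡0 b≡0 zero          t<k = a≡0 t<k
solution-degree a≡0 b≡0 (suc zero)    t<k = b≡0 t<k
solution-degree a≡0 b≡0 (suc (suc t)) {suc k} (ℕ.s≤s t<k) = cong₂ (λ u v → u ℤ.+ -1ℤ ℤ.* (v ℤ.+ v))
  (cong₂ ℤ._+_ (solution-degree a≡0 b≡0 (suc t) (ℕ.m≤n⇒m≤1+n t<k)) (solution-degree a≡0 b≡0 (suc t) t<k))
  (solution-degree a≡0 b≡0 t (ℕ.<-trans ℕ.≤-refl t<k))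

module _ {b c : Series} (b≡0 : ∀ {k} → 1 ℕ.< k → b k ≡ 0ℤ) (c≡0 : ∀ {k} → 1 ℕ.< k → c k ≡ 0ℤ)
         (b₀≡c₁ : b 0 ≡ c 1) (b₁≡c₀ : b 1 ≡ c 0) where

  private
    X = solution one b
    Y = solution one c

    one≡0 : ∀ {k} → 0 ℕ.< k → one k ≡ 0ℤ
    one≡0 (ℕ.s≤s _) = refl

  -- The recurrence is invariant under X_t(x) ↦ x^t X_t(1/x).
  solution-reverse : ∀ t i k → i ℕ.+ k ≡ t → X t i ≡ Y t k
  solution-reverse zero zero zero eq = refl
  solution-reverse (suc zero) zero (suc zero) eq = b₀≡c₁
  solution-reverse (suc zero) (suc zero) zero eq = b₁≡c₀
  -- The constant term meets the top coefficient. There two terms of the recurrence for `Y` lie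
  -- beyond the degree and vanish.
  solution-reverse (suc (suc t)) zero (suc k) eq
    with refl ← ℕ.suc-injective eq = begin
    X (suc t) 0 ℤ.+ 0ℤ ℤ.+ -1ℤ ℤ.* 0ℤ
      ≡⟨ cong (λ z → z ℤ.+ 0ℤ ℤ.+ -1ℤ ℤ.* 0ℤ) (solution-reverse (suc t) 0 (suc t) refl) ⟩
    Y (suc t) (suc t) ℤ.+ 0ℤ ℤ.+ -1ℤ ℤ.* 0ℤ
      ≡⟨ cong (λ z → z ℤ.+ -1ℤ ℤ.* 0ℤ) (ℤ.+-comm (Y (suc t) (suc t)) 0ℤ) ⟩
    0ℤ ℤ.+ Y (suc t) (suc t) ℤ.+ -1ℤ ℤ.* (0ℤ ℤ.+ 0ℤ)
      ≡⟨ cong₂ (λ u v → u ℤ.+ Y (suc t) (suc t) ℤ.+ -1ℤ ℤ.* (v ℤ.+ v))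
           (solution-degree one≡0 c≡0 (suc t) ℕ.≤-refl) (solution-degree one≡0 c≡0 t ℕ.≤-refl) ⟨
    Y (2 ℕ.+ t) (2 ℕ.+ t) ∎
    where open ≡-Reasoning
  solution-reverse (suc (suc t)) (suc i) zero eq
    with refl ← trans (sym (ℕ.+-identityʳ i)) (ℕ.suc-injective eq) = begin
    X (suc t) (2 ℕ.+ t) ℤ.+ X (suc t) (suc t) ℤ.+ -1ℤ ℤ.* (X t (suc t) ℤ.+ X t (suc t))
      ≡⟨ cong₂ (λ u v → u ℤ.+ X (suc t) (suc t) ℤ.+ -1ℤ ℤ.* (v ℤ.+ v))
           (solution-degree one≡0 b≡0 (suc t) ℕ.≤-refl) (solution-degree one≡0 b≡0 t ℕ.≤-refl) ⟩
    0ℤ ℤ.+ X (suc t) (suc t) ℤ.+ -1ℤ ℤ.* 0ℤ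
      ≡⟨ cong (λ z → z ℤ.+ -1ℤ ℤ.* 0ℤ) (ℤ.+-comm 0ℤ (X (suc t) (suc t))) ⟩
    X (suc t) (suc t) ℤ.+ 0ℤ ℤ.+ -1ℤ ℤ.* 0ℤ
      ≡⟨ cong (λ z → z ℤ.+ 0ℤ ℤ.+ -1ℤ ℤ.* 0ℤ) (solution-reverse (suc t) (suc t) 0 (ℕ.+-identityʳ (suc t))) ⟩
    Y (2 ℕ.+ t) 0 ∎
    where open ≡-Reasoning
  -- Reversal exchanges the terms X_(t+1) and x X_(t+1) of the recurrence and fixes 2 x X_t.
  solution-reverse (suc (suc t)) (suc i) (suc k) eq = cong₂ (λ u v → u ℤ.+ -1ℤ ℤ.* (v ℤ.+ v))
    (trans (cong₂ ℤ._+_ (solution-reverse (suc t) (suc i) k (trans (sym (ℕ.+-suc i k)) eq₁))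
                        (solution-reverse (suc t) i (suc k) eq₁))
           (ℤ.+-comm (Y (suc t) k) (Y (suc t) (suc k))))
    (solution-reverse t i k (ℕ.suc-injective (trans (sym (ℕ.+-suc i k)) eq₁)))
    where
    eq₁ : i ℕ.+ suc k ≡ suc t
    eq₁ = ℕ.suc-injective eq

-- The initial values come from γ_t + s E_t = (1 + s) λ^t. At t = 0 the right side is 1 + s; at t =
-- 1 the equation s = 1 + x s + x s² turns x (1 + s)² into (x - 1) + (1 + x) s. `γʳ t` is `γ t` with
-- the coefficients 0, ..., t in reverse order.
γ E γʳ : ℕ → Series
γ  = solution one (x· one ⊕ -1ℤ · one)
γʳ = solution one (one ⊕ -1ℤ · (x· one))
E  = solution one (one ⊕ x· one)

γʳ-reverse : ∀ t i k → i ℕ.+ k ≡ t → γʳ t i ≡ γ t k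
γʳ-reverse = solution-reverse {γʳ 1} {γ 1}
  (λ { (ℕ.s≤s (ℕ.s≤s _)) → refl }) (λ { (ℕ.s≤s (ℕ.s≤s _)) → refl }) refl refl

-- 1 and 1 + x are their own reverses, so every E_t is palindromic.
E-reverse : ∀ t i k → i ℕ.+ k ≡ t → E t i ≡ E t k
E-reverse = solution-reverse {E 1} {E 1}
  (λ { (ℕ.s≤s (ℕ.s≤s _)) → refl }) (λ { (ℕ.s≤s (ℕ.s≤s _)) → refl }) refl refl

γ-degree : ∀ t {k} → t ℕ.< k → γ t k ≡ 0ℤ
γ-degree = solution-degree {one} {γ 1} (λ { (ℕ.s≤s _) → refl }) (λ { (ℕ.s≤s (ℕ.s≤s _)) → refl })

-- These coefficients form the diagonal of the upper left block of the elimination matrix, hence the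
-- value 1.
γʳ-zero : ∀ t → γʳ t 0 ≡ 1ℤ
γʳ-zero zero          = refl
γʳ-zero (suc zero)    = refl
γʳ-zero (suc (suc t)) = trans (lem _) (γʳ-zero (suc t))
  where
  lem : ∀ a → a ℤ.+ 0ℤ ℤ.+ -1ℤ ℤ.* 0ℤ ≡ a
  lem = ℤ-Solver.solve-∀

-- Powers of λ and the elimination identities

module Elimination (s : Series) (s-zero : s 0 ≡ 1ℤ) (s-suc : ∀ n → s (suc n) ≡ s n ℤ.+ (s ⊛ s) n) where

  -- `P t` is λ^t for λ = x (1 + s).
  P : ℕ → Series
  P zero    = one
  P (suc t) = x· ((one ⊕ s) ⊛ P t)

  δ : ℕ → Series
  δ t = E t ⊕ -1ℤ · (P t ⊕ P t) ⊕ P (suc t)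

  P-vanish : ∀ t {n} → n ℕ.< t → P t n ≡ 0ℤ
  P-vanish (suc t) {zero}  n<t         = refl
  P-vanish (suc t) {suc n} (ℕ.s≤s n<t) =
    ⊛-vanish (one ⊕ s) (P t) n (λ m≤n → P-vanish t (ℕ.≤-<-trans m≤n n<t))

  P-leading : ∀ t → P t t ≡ 2^ t
  P-leading zero    = refl
  P-leading (suc t) = begin
    ((one ⊕ s) ⊛ P t) t    ≡⟨ ⊛-leading (one ⊕ s) (P t) t (P-vanish t) ⟩
    (1ℤ ℤ.+ s 0) ℤ.* P t t ≡⟨ cong₂ (λ a b → (1ℤ ℤ.+ a) ℤ.* b) s-zero (P-leading t) ⟩
    + 2 ℤ.* 2^ t         ≡⟨ 2^-suc t ⟨
    2^ suc t               ∎
    where open ≡-Reasoning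

  [1+s]⊛ : ∀ a n → ((one ⊕ s) ⊛ a) n ≡ a n ℤ.+ (s ⊛ a) n
  [1+s]⊛ a n = trans (⊛-distribʳ a one s n) (cong (ℤ._+ (s ⊛ a) n) (⊛-identityˡ a n))

  -- This is s λ = s - 1 multiplied by λ^t; `s-suc` says that s (1 + s) is `s` shifted down by one
  -- index.
  s⊛P-suc : ∀ t → s ⊛ P (suc t) ≗ s ⊛ P t ⊕ -1ℤ · P t
  s⊛P-suc t zero    = trans (lem (s 0) (P t 0))
    (cong (λ z → s 0 ℤ.* P t 0 ℤ.+ (-1ℤ ℤ.* z ℤ.* P t 0)) s-zero)
    where
    lem : ∀ a p → a ℤ.* 0ℤ ≡ a ℤ.* p ℤ.+ -1ℤ ℤ.* a ℤ.* p
    lem = ℤ-Solver.solve-∀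
  s⊛P-suc t (suc n) = begin
    (s ⊛ P (suc t)) (suc n)         ≡⟨ ⊛-x·ʳ s ((one ⊕ s) ⊛ P t) (suc n) ⟩
    (s ⊛ ((one ⊕ s) ⊛ P t)) n       ≡⟨ ⊛-assoc s (one ⊕ s) (P t) n ⟨
    (s ⊛ (one ⊕ s) ⊛ P t) n         ≡⟨ ⊛-cong s⊛[1+s] (λ _ → refl) n ⟩
    (s ∘ suc ⊛ P t) n               ≡⟨ lem (P t (suc n)) _ ⟩
    1ℤ ℤ.* P t (suc n) ℤ.+ (s ∘ suc ⊛ P t) n ℤ.+ -1ℤ ℤ.* P t (suc n)
      ≡⟨ cong (λ z → z ℤ.* P t (suc n) ℤ.+ (s ∘ suc ⊛ P t) n ℤ.+ -1ℤ ℤ.* P t (suc n)) s-zero ⟨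
    (s ⊛ P t ⊕ -1ℤ · P t) (suc n) ∎
    where
    open ≡-Reasoning
    s⊛[1+s] : s ⊛ (one ⊕ s) ≗ s ∘ suc
    s⊛[1+s] n = trans (⊛-distribˡ s one s n)
      (trans (cong (ℤ._+ (s ⊛ s) n) (⊛-identityʳ s n)) (sym (s-suc n)))
    lem : ∀ p q → q ≡ 1ℤ ℤ.* p ℤ.+ q ℤ.+ -1ℤ ℤ.* p
    lem = ℤ-Solver.solve-∀

  -- λ times λ^(t+1) is x λ^(t+1) + x s λ^(t+1). Replacing s λ by s - 1, and then x s λ^t by λ^(t+1)
  -- - x λ^t, gives the recurrence.
  P-recurrent : Recurrent P
  P-recurrent .Recurrent.recurrence t zero    = refl
  P-recurrent .Recurrent.recurrence t (suc n) = begin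
    ((one ⊕ s) ⊛ P (suc t)) n
      ≡⟨ [1+s]⊛ (P (suc t)) n ⟩
    P (suc t) n ℤ.+ (s ⊛ P (suc t)) n
      ≡⟨ cong (λ z → P (suc t) n ℤ.+ z) (s⊛P-suc t n) ⟩
    P (suc t) n ℤ.+ ((s ⊛ P t) n ℤ.+ -1ℤ ℤ.* P t n)
      ≡⟨ lem (P (suc t) n) ((s ⊛ P t) n) (P t n) ⟩
    (P t n ℤ.+ (s ⊛ P t) n) ℤ.+ P (suc t) n ℤ.+ -1ℤ ℤ.* (P t n ℤ.+ P t n)
      ≡⟨ cong (λ z → z ℤ.+ P (suc t) n ℤ.+ -1ℤ ℤ.* (P t n ℤ.+ P t n)) ([1+s]⊛ (P t) n) ⟨
    step (P t) (P (suc t)) (suc n) ∎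
    where
    open ≡-Reasoning
    lem : ∀ a b c → a ℤ.+ (b ℤ.+ -1ℤ ℤ.* c) ≡ c ℤ.+ b ℤ.+ a ℤ.+ -1ℤ ℤ.* (c ℤ.+ c)
    lem = ℤ-Solver.solve-∀

  P₁ : P 1 ≗ x· (one ⊕ s)
  P₁ = x·-cong (⊛-identityʳ (one ⊕ s))

  s⊛P₁ : s ⊛ P 1 ≗ s ⊕ -1ℤ · one
  s⊛P₁ n = trans (s⊛P-suc 0 n) (cong (ℤ._+ -1ℤ ℤ.* one n) (⊛-identityʳ s n))

  γ⊕s⊛E : ∀ t → γ t ⊕ s ⊛ E t ≗ P t ⊕ s ⊛ P t
  γ⊕s⊛E = recurrent-unique
    (recurrent-⊕ (solution-recurrent _ _) (recurrent-⊛ˡ s (solution-recurrent _ _)))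
    (recurrent-⊕ P-recurrent (recurrent-⊛ˡ s P-recurrent))
    (λ _ → refl) base
    where
    base : γ 1 ⊕ s ⊛ E 1 ≗ P 1 ⊕ s ⊛ P 1
    base n = trans
      (cong (λ z → γ 1 n ℤ.+ z) (trans (⊛-distribˡ s one (x· one) n)
        (cong₂ ℤ._+_ (⊛-identityʳ s n) (trans (⊛-x·ʳ s one n) (x·-cong (⊛-identityʳ s) n)))))
      (trans (lem n) (sym (cong₂ ℤ._+_ (P₁ n) (s⊛P₁ n))))
      where
      lem : ∀ n → γ 1 n ℤ.+ (s n ℤ.+ (x· s) n) ≡ (x· (one ⊕ s)) n ℤ.+ (s n ℤ.+ -1ℤ ℤ.* one n)
      lem zero    = lem₀ (s 0)
        where
        lem₀ : ∀ a → 0ℤ ℤ.+ -1ℤ ℤ.* 1ℤ ℤ.+ (a ℤ.+ 0ℤ) ≡ 0ℤ ℤ.+ (a ℤ.+ -1ℤ ℤ.* 1ℤ)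
        lem₀ = ℤ-Solver.solve-∀
      lem (suc n) = lem₁ (one n) (s (suc n)) (s n)
        where
        lem₁ : ∀ a b c → a ℤ.+ -1ℤ ℤ.* 0ℤ ℤ.+ (b ℤ.+ c) ≡ a ℤ.+ c ℤ.+ (b ℤ.+ -1ℤ ℤ.* 0ℤ)
        lem₁ = ℤ-Solver.solve-∀

  -- The right side is arranged for truncation: (s - 1) λ^t has order above t, so up to index t the
  -- product agrees with the palindrome E_t.
  γʳ⊛s : ∀ t → γʳ t ⊛ s ≗ E t ⊕ (s ⊛ P t ⊕ -1ℤ · P t)
  γʳ⊛s = recurrent-unique
    (recurrent-⊛ʳ s (solution-recurrent _ _))
    (recurrent-⊕ (solution-recurrent _ _)
      (recurrent-⊕ (recurrent-⊛ˡ s P-recurrent) (recurrent-· -1ℤ P-recurrent)))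
    base₀ base₁
    where
    base₀ : γʳ 0 ⊛ s ≗ E 0 ⊕ (s ⊛ P 0 ⊕ -1ℤ · P 0)
    base₀ n = trans (⊛-identityˡ s n)
      (trans (lem (s n) (one n)) (cong (λ z → one n ℤ.+ (z ℤ.+ -1ℤ ℤ.* one n)) (sym (⊛-identityʳ s n))))
      where
      lem : ∀ a b → a ≡ b ℤ.+ (a ℤ.+ -1ℤ ℤ.* b)
      lem = ℤ-Solver.solve-∀
    base₁ : γʳ 1 ⊛ s ≗ E 1 ⊕ (s ⊛ P 1 ⊕ -1ℤ · P 1)
    base₁ n = trans (⊛-distribʳ s one (-1ℤ · (x· one)) n) (trans
      (cong₂ ℤ._+_ (⊛-identityˡ s n) (trans (⊛-·ˡ -1ℤ (x· one) s n)
        (cong (-1ℤ ℤ.*_) (trans (⊛-x·ˡ one s n) (x·-cong (⊛-identityˡ s) n)))))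
      (trans (lem n) (cong (λ z → E 1 n ℤ.+ z) (sym (cong₂ (λ a b → a ℤ.+ -1ℤ ℤ.* b) (s⊛P₁ n) (P₁ n))))))
      where
      lem : ∀ n → s n ℤ.+ -1ℤ ℤ.* (x· s) n
          ≡ E 1 n ℤ.+ (s n ℤ.+ -1ℤ ℤ.* one n ℤ.+ -1ℤ ℤ.* (x· (one ⊕ s)) n)
      lem zero    = lem₀ (s 0)
        where
        lem₀ : ∀ a → a ℤ.+ -1ℤ ℤ.* 0ℤ ≡ 1ℤ ℤ.+ 0ℤ ℤ.+ (a ℤ.+ -1ℤ ℤ.* 1ℤ ℤ.+ -1ℤ ℤ.* 0ℤ)
        lem₀ = ℤ-Solver.solve-∀
      lem (suc n) = lem₁ (one n) (s (suc n)) (s n)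
        where
        lem₁ : ∀ a b c → b ℤ.+ -1ℤ ℤ.* c ≡ 0ℤ ℤ.+ a ℤ.+ (b ℤ.+ -1ℤ ℤ.* 0ℤ ℤ.+ -1ℤ ℤ.* (a ℤ.+ c))
        lem₁ = ℤ-Solver.solve-∀

  -- Because s λ = s - 1, multiplication by s turns -2 λ^t + λ^(t+1) into -(1 + s) λ^t; `γ⊕s⊛E` then
  -- leaves -γ_t.
  s⊛δ : ∀ t → s ⊛ δ t ≗ -1ℤ · γ t
  s⊛δ t n = begin
    (s ⊛ δ t) n
      ≡⟨ trans (⊛-distribˡ s (E t ⊕ -1ℤ · (P t ⊕ P t)) (P (suc t)) n)
           (cong₂ ℤ._+_
             (trans (⊛-distribˡ s (E t) (-1ℤ · (P t ⊕ P t)) n)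
               (cong (λ z → (s ⊛ E t) n ℤ.+ z)
                 (trans (⊛-·ʳ -1ℤ s (P t ⊕ P t) n) (cong (-1ℤ ℤ.*_) (⊛-distribˡ s (P t) (P t) n)))))
             (s⊛P-suc t n)) ⟩
    (s ⊛ E t) n ℤ.+ -1ℤ ℤ.* ((s ⊛ P t) n ℤ.+ (s ⊛ P t) n) ℤ.+ ((s ⊛ P t) n ℤ.+ -1ℤ ℤ.* P t n)
      ≡⟨ lem (γ t n) ((s ⊛ E t) n) (P t n) ((s ⊛ P t) n) ⟩
    (γ t n ℤ.+ (s ⊛ E t) n) ℤ.+ -1ℤ ℤ.* (P t n ℤ.+ (s ⊛ P t) n) ℤ.+ -1ℤ ℤ.* γ t n
      ≡⟨ cong (λ z → z ℤ.+ -1ℤ ℤ.* (P t n ℤ.+ (s ⊛ P t) n) ℤ.+ -1ℤ ℤ.* γ t n) (γ⊕s⊛E t n) ⟩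
    (P t n ℤ.+ (s ⊛ P t) n) ℤ.+ -1ℤ ℤ.* (P t n ℤ.+ (s ⊛ P t) n) ℤ.+ -1ℤ ℤ.* γ t n
      ≡⟨ lem′ (P t n ℤ.+ (s ⊛ P t) n) _ ⟩
    -1ℤ ℤ.* γ t n ∎
    where
    open ≡-Reasoning
    lem : ∀ g e p q → e ℤ.+ -1ℤ ℤ.* (q ℤ.+ q) ℤ.+ (q ℤ.+ -1ℤ ℤ.* p)
        ≡ (g ℤ.+ e) ℤ.+ -1ℤ ℤ.* (p ℤ.+ q) ℤ.+ -1ℤ ℤ.* g
    lem = ℤ-Solver.solve-∀
    lem′ : ∀ a b → a ℤ.+ -1ℤ ℤ.* a ℤ.+ b ≡ b
    lem′ = ℤ-Solver.solve-∀

  -- Index i is counted from the diagonal, k from the right end. By symmetry E_t has the same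
  -- coefficient at both; (s - 1) λ^t vanishes at i and λ^(t+1) at k, so only the term 2 λ^t of δ_t
  -- is left.
  γʳ⊛s-δ : ∀ t i k → i ℕ.+ k ≡ t →
    (γʳ t ⊛ s) i ℤ.+ -1ℤ ℤ.* δ t k ≡ + 2 ℤ.* P t k
  γʳ⊛s-δ t i k i+k≡t = begin
    (γʳ t ⊛ s) i ℤ.+ -1ℤ ℤ.* δ t k
      ≡⟨ cong (ℤ._+ -1ℤ ℤ.* δ t k) (γʳ⊛s t i) ⟩
    E t i ℤ.+ ((s ⊛ P t) i ℤ.+ -1ℤ ℤ.* P t i) ℤ.+ -1ℤ ℤ.* δ t k
      ≡⟨ cong₂ (λ a b → a ℤ.+ (b ℤ.+ -1ℤ ℤ.* P t i) ℤ.+ -1ℤ ℤ.* δ t k) (E-reverse t i k i+k≡t)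
           (⊛-leading s (P t) i λ m<i → P-vanish t (ℕ.<-≤-trans m<i i≤t)) ⟩
    E t k ℤ.+ (s 0 ℤ.* P t i ℤ.+ -1ℤ ℤ.* P t i) ℤ.+ -1ℤ ℤ.* δ t k
      ≡⟨ cong₂ (λ a b → E t k ℤ.+ (a ℤ.* P t i ℤ.+ -1ℤ ℤ.* P t i)
                        ℤ.+ -1ℤ ℤ.* (E t k ℤ.+ -1ℤ ℤ.* (P t k ℤ.+ P t k) ℤ.+ b))
           s-zero (P-vanish (suc t) (ℕ.s≤s k≤t)) ⟩
    E t k ℤ.+ (1ℤ ℤ.* P t i ℤ.+ -1ℤ ℤ.* P t i)
      ℤ.+ -1ℤ ℤ.* (E t k ℤ.+ -1ℤ ℤ.* (P t k ℤ.+ P t k) ℤ.+ 0ℤ)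
      ≡⟨ lem (E t k) (P t i) (P t k) ⟩
    + 2 ℤ.* P t k ∎
    where
    open ≡-Reasoning
    i≤t = subst (i ℕ.≤_) i+k≡t (ℕ.m≤m+n i k)
    k≤t = subst (k ℕ.≤_) i+k≡t (ℕ.m≤n+m k i)
    lem : ∀ e p q → e ℤ.+ (1ℤ ℤ.* p ℤ.+ -1ℤ ℤ.* p) ℤ.+ -1ℤ ℤ.* (e ℤ.+ -1ℤ ℤ.* (q ℤ.+ q) ℤ.+ 0ℤ)
        ≡ + 2 ℤ.* q
    lem = ℤ-Solver.solve-∀

-- Schröder numbers

count : {A : Set} {P : A → Set} → Decidable P → List A → ℕ
count P? xs = length (filter P? xs)

count-++ : {A : Set} {P : A → Set} (P? : Decidable P) (xs ys : List A) →
           count P? (xs ++ ys) ≡ count P? xs ℕ.+ count P? ys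
count-++ P? xs ys = trans (cong length (filter-++ P? xs ys)) (length-++ (filter P? xs))

count-none : {A : Set} {P : A → Set} (P? : Decidable P) → (∀ x → ¬ P x) → ∀ xs → count P? xs ≡ 0
count-none P? ¬P xs = cong length (filter-none P? (All.universal ¬P xs))

count-map : {A B : Set} {P : B → Set} {R : A → Set} (P? : Decidable P) (R? : Decidable R) (f : A → B) →
            (∀ x → P (f x) → R x) → (∀ x → R x → P (f x)) → ∀ xs → count P? (map f xs) ≡ count R? xs
count-map P? R? f P⇒R R⇒P []       = refl
count-map P? R? f P⇒R R⇒P (x ∷ xs) with P? (f x) | R? x
... | yes p | yes R = cong suc (count-map P? R? f P⇒R R⇒P xs)
... | no ¬p | no ¬R = count-map P? R? f P⇒R R⇒P xs
... | yes p | no ¬R = ⊥-elim (¬R (P⇒R x p))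
... | no ¬p | yes R = ⊥-elim (¬p (R⇒P x R))

sumBelow : ℕ → (ℕ → ℕ) → ℕ
sumBelow zero    g = 0
sumBelow (suc n) g = g 0 ℕ.+ sumBelow n (g ∘ suc)

sumBelow-+ : ∀ n g h → sumBelow n (λ i → g i ℕ.+ h i) ≡ sumBelow n g ℕ.+ sumBelow n h
sumBelow-+ zero    g h = refl
sumBelow-+ (suc n) g h = trans (cong (g 0 ℕ.+ h 0 ℕ.+_) (sumBelow-+ n (g ∘ suc) (h ∘ suc)))
  (lem (g 0) (h 0) _ _)
  where
  lem : ∀ a b c d → a ℕ.+ b ℕ.+ (c ℕ.+ d) ≡ a ℕ.+ c ℕ.+ (b ℕ.+ d)
  lem = ℕ-Solver.solve-∀

sumBelow-cong : ∀ n {g h} → g ≗ h → sumBelow n g ≡ sumBelow n h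
sumBelow-cong zero    g≗h = refl
sumBelow-cong (suc n) g≗h = cong₂ ℕ._+_ (g≗h 0) (sumBelow-cong n (g≗h ∘ suc))

sumBelow-zero : ∀ n {g} → (∀ i → g i ≡ 0) → sumBelow n g ≡ 0
sumBelow-zero zero    g≡0 = refl
sumBelow-zero (suc n) g≡0 = cong₂ ℕ._+_ (g≡0 0) (sumBelow-zero n (g≡0 ∘ suc))

count-concatMap : {A : Set} {P : A → Set} (P? : Decidable P) (ws : ℕ → List A) (f : ℕ → ℕ) (n : ℕ) →
  count P? (concatMap ws (applyUpTo f n)) ≡ sumBelow n (count P? ∘ ws ∘ f)
count-concatMap P? ws f zero    = refl
count-concatMap P? ws f (suc n) = trans
  (count-++ P? (ws (f 0)) _)
  (cong (count P? (ws (f 0)) ℕ.+_) (count-concatMap P? ws (f ∘ suc) n))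

module _ (m : ℕ) where

  Below : ℕ × ℕ → Set
  Below (x , y) = y ≤ x

  -- At (0 , 0) this is `IsSchröderPath m` by definition; a free starting point lets the first step
  -- be removed.
  PathFrom : ℕ × ℕ → List Step → Set
  PathFrom p w = foldl move p w ≡ (m , m) × All (λ u → Below (foldl move p u)) (inits w)

  pathFrom? : ∀ p → Decidable (PathFrom p)
  pathFrom? p w = ≡-dec ℕ._≟_ ℕ._≟_ (foldl move p w) (m , m)
    ×-dec all? (λ u → proj₂ (foldl move p u) ℕ.≤? proj₁ (foldl move p u)) (inits w)

  PathFrom-below : ∀ p w → PathFrom p w → Below p
  PathFrom-below p []      (_ , below ∷ _) = below
  PathFrom-below p (s ∷ w) (_ , below ∷ _) = below

  PathFrom-uncons : ∀ p s w → PathFrom p (s ∷ w) → PathFrom (move p s) w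
  PathFrom-uncons p s w (end , _ ∷ belows) = end , All.map⁻ belows

  PathFrom-cons : ∀ p s w → Below p → PathFrom (move p s) w → PathFrom p (s ∷ w)
  PathFrom-cons p s w below (end , belows) = end , below ∷ All.map⁺ belows

  move-≤ : ∀ p w → proj₁ p ≤ proj₁ (foldl move p w)
  move-≤ p []             = ℕ.≤-refl
  move-≤ p (north ∷ w)    = move-≤ (move p north) w
  move-≤ p (east ∷ w)     = ℕ.≤-trans (ℕ.n≤1+n _) (move-≤ (move p east) w)
  move-≤ p (diagonal ∷ w) = ℕ.≤-trans (ℕ.n≤1+n _) (move-≤ (move p diagonal) w)

  paths : ℕ × ℕ → ℕ → ℕ
  paths p l = count (pathFrom? p) (words l)

  paths-above : ∀ {x y} → x < y → ∀ l → paths (x , y) l ≡ 0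
  paths-above x<y l = count-none (pathFrom? _)
    (λ w path → ℕ.<⇒≱ x<y (PathFrom-below _ w path)) (words l)

  paths-right : ∀ {x y} → m < x → ∀ l → paths (x , y) l ≡ 0
  paths-right {x} {y} m<x l = count-none (pathFrom? _)
    (λ { w (end , _) → ℕ.<⇒≱ m<x (subst (x ≤_) (cong proj₁ end) (move-≤ (x , y) w)) }) (words l)

  paths-suc : ∀ p → Below p → ∀ l → paths p (suc l)
            ≡ paths (move p north) l ℕ.+ (paths (move p east) l ℕ.+ paths (move p diagonal) l)
  paths-suc p below l =
    trans (count-++ (pathFrom? p) (map (north ∷_) (words l)) _) (cong₂ ℕ._+_ (first north)
    (trans (count-++ (pathFrom? p) (map (east ∷_) (words l)) _) (cong₂ ℕ._+_ (first east)
    (trans (count-++ (pathFrom? p) (map (diagonal ∷_) (words l)) [])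
      (trans (ℕ.+-identityʳ _) (first diagonal))))))
    where
    first : ∀ s → count (pathFrom? p) (map (s ∷_) (words l)) ≡ paths (move p s) l
    first s = count-map (pathFrom? p) (pathFrom? (move p s)) (s ∷_)
      (PathFrom-uncons p s) (λ w → PathFrom-cons p s w below) (words l)

  paths-zero≡1 : paths (m , m) 0 ≡ 1
  paths-zero≡1 = cong length (filter-accept (pathFrom? (m , m)) {x = []} {xs = []} (refl , ℕ.≤-refl ∷ []))

  paths-zero≡0 : ∀ {p} → p ≢ (m , m) → paths p 0 ≡ 0
  paths-zero≡0 {p} p≢ = cong length (filter-reject (pathFrom? p) {x = []} {xs = []} (λ path → p≢ (proj₁ path)))

-- ρ b k counts the paths from (x , y) to (m , m) for b = m - x and k = x - y.
ρ : ℕ → ℕ → ℕ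
ρ zero    zero    = 1
ρ zero    (suc k) = ρ zero k
ρ (suc b) zero    = ρ b 1 ℕ.+ ρ b 0
ρ (suc b) (suc k) = ρ (suc b) k ℕ.+ (ρ b (2 ℕ.+ k) ℕ.+ ρ b (1 ℕ.+ k))

-- The longest paths from (x , y) use only north and east steps and have 2b + k of them, so the
-- lengths below n miss no path. Removing the first step lowers n and leads to the starting points
-- in the recursion of `ρ`.
sumBelow-paths : ∀ n {m} b k x y → y ℕ.+ k ≡ x → x ℕ.+ b ≡ m → b ℕ.+ b ℕ.+ k < n →
                 sumBelow n (paths m (x , y)) ≡ ρ b k
sumBelow-paths (suc n) {m} b k x y y+k≡x x+b≡m (s≤s b+b+k≤n) = trans
  (cong (paths m (x , y) 0 ℕ.+_)
    (trans (sumBelow-cong n (paths-suc m (x , y) (subst (y ≤_) y+k≡x (ℕ.m≤m+n y k))))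
    (trans (sumBelow-+ n _ _) (cong (sumBelow n (paths m (x , suc y)) ℕ.+_) (sumBelow-+ n _ _)))))
  (split b k y+k≡x x+b≡m b+b+k≤n)
  where
  beyond : x ℕ.+ 0 ≡ m → m < suc x
  beyond x+0≡m = ℕ.≤-reflexive (cong suc (trans (sym x+0≡m) (ℕ.+-identityʳ x)))

  northward : ∀ k → y ℕ.+ suc k ≡ x → suc y ℕ.+ k ≡ x
  northward k eq = trans (sym (ℕ.+-suc y k)) eq

  eastward : ∀ b → x ℕ.+ suc b ≡ m → suc x ℕ.+ b ≡ m
  eastward b eq = trans (sym (ℕ.+-suc x b)) eq

  off : ∀ {b k} → y ℕ.+ k ≡ x → x ℕ.+ b ≡ m → 0 < b ℕ.+ k → (x , y) ≢ (m , m)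
  off {zero} {suc k} e e′ _ refl = ℕ.m+1+n≢m m e
  off {suc b}        e e′ _ refl = ℕ.m+1+n≢m m e′

  lem₁ : ∀ b k → suc b ℕ.+ suc b ℕ.+ suc k ≡ suc (suc b ℕ.+ suc b ℕ.+ k)
  lem₁ = ℕ-Solver.solve-∀
  lem₂ : ∀ b k → suc b ℕ.+ suc b ℕ.+ k ≡ suc (b ℕ.+ b ℕ.+ suc k)
  lem₂ = ℕ-Solver.solve-∀

  -- Starting points above the diagonal or to the right of x = m contribute nothing; this removes
  -- summands when k or b is zero.
  split : ∀ b k → y ℕ.+ k ≡ x → x ℕ.+ b ≡ m → b ℕ.+ b ℕ.+ k ≤ n →
    paths m (x , y) 0 ℕ.+ (sumBelow n (paths m (x , suc y)) ℕ.+
      (sumBelow n (paths m (suc x , y)) ℕ.+ sumBelow n (paths m (suc x , suc y)))) ≡ ρ b k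
  split zero zero e e′ _
    rewrite sumBelow-zero n (paths-above m {x} {suc y} (s≤s (ℕ.≤-reflexive (trans (sym e) (ℕ.+-identityʳ y)))))
          | sumBelow-zero n (paths-right m {suc x} {y} (beyond e′))
          | sumBelow-zero n (paths-right m {suc x} {suc y} (beyond e′))
    with refl ← trans (sym (ℕ.+-identityʳ x)) e′ | refl ← trans (sym (ℕ.+-identityʳ y)) e
    = cong (ℕ._+ 0) (paths-zero≡1 m)
  split zero (suc k) e e′ k<n
    rewrite sumBelow-zero n (paths-right m {suc x} {y} (beyond e′))
          | sumBelow-zero n (paths-right m {suc x} {suc y} (beyond e′))
          | paths-zero≡0 m (off e e′ (s≤s z≤n))
          | sumBelow-paths n {m} 0 k x (suc y) (northward k e) e′ k<n
    = ℕ.+-identityʳ _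
  split (suc b) zero e e′ b≤n
    rewrite sumBelow-zero n (paths-above m {x} {suc y} (s≤s (ℕ.≤-reflexive (trans (sym e) (ℕ.+-identityʳ y)))))
          | paths-zero≡0 m (off e e′ (s≤s z≤n))
          | sumBelow-paths n {m} b 1 (suc x) y (trans (ℕ.+-suc y 0) (cong suc e)) (eastward b e′)
              (ℕ.≤-trans (ℕ.≤-reflexive (sym (lem₂ b 0))) b≤n)
          | sumBelow-paths n {m} b 0 (suc x) (suc y) (cong suc e) (eastward b e′)
              (ℕ.≤-trans (s≤s (ℕ.+-monoˡ-≤ 0 (ℕ.+-monoʳ-≤ b (ℕ.n≤1+n b)))) b≤n)
    = refl
  split (suc b) (suc k) e e′ b≤n
    rewrite paths-zero≡0 m (off e e′ (s≤s z≤n))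
          | sumBelow-paths n {m} (suc b) k x (suc y) (northward k e) e′ (subst (_≤ n) (lem₁ b k) b≤n)
          | sumBelow-paths n {m} b (2 ℕ.+ k) (suc x) y (trans (ℕ.+-suc y (suc k)) (cong suc e)) (eastward b e′)
              (subst (_≤ n) (lem₂ b (suc k)) b≤n)
          | sumBelow-paths n {m} b (1 ℕ.+ k) (suc x) (suc y) (cong suc e) (eastward b e′)
              (ℕ.≤-trans (s≤s (ℕ.+-monoˡ-≤ (suc k) (ℕ.+-monoʳ-≤ b (ℕ.n≤1+n b)))) b≤n)
    = refl

schröder≡ρ : ∀ m → schröder m ≡ ρ m 0
schröder≡ρ m = trans (count-concatMap (pathFrom? m (0 , 0)) words id (suc (2 ℕ.* m)))
  (sumBelow-paths (suc (2 ℕ.* m)) m 0 0 0 refl refl (s≤s (ℕ.≤-reflexive (lem m))))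
  where
  lem : ∀ m → m ℕ.+ m ℕ.+ 0 ≡ 2 ℕ.* m
  lem = ℕ-Solver.solve-∀

-- The generating function of the Schröder numbers

s : Series
s m = + schröder m

private
  R : ℕ → Series
  R k b = + ρ b k

  R-zero : R 0 ≗ one ⊕ x· (R 1 ⊕ R 0)
  R-zero zero    = refl
  R-zero (suc b) = sym (ℤ.+-identityˡ _)

  R-suc : ∀ k → R (suc k) ≗ R k ⊕ x· (R (2 ℕ.+ k) ⊕ R (1 ℕ.+ k))
  R-suc k zero    = sym (ℤ.+-identityʳ _)
  R-suc k (suc b) = refl

  -- `R k` is the power s^(k+1): multiplying the equation for `R k` by `R 0` yields the equation for
  -- `R (suc k)`. A product at index b refers to products at b - 1, or at b with smaller k, so the
  -- induction is on b, then on k.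
  R⊛R : ∀ b k → (R 0 ⊛ R k) b ≡ R (suc k) b

  expand : ∀ b k a → (R 0 ⊛ (a ⊕ x· (R (suc k) ⊕ R k))) b ≡ (R 0 ⊛ a) b ℤ.+ (x· (R (2 ℕ.+ k) ⊕ R (1 ℕ.+ k))) b
  expand zero    k a = trans (⊛-distribˡ (R 0) a (x· (R (suc k) ⊕ R k)) zero)
    (cong (λ z → (R 0 ⊛ a) zero ℤ.+ z) (⊛-x·ʳ (R 0) (R (suc k) ⊕ R k) zero))
  expand (suc b) k a = trans (⊛-distribˡ (R 0) a _ (suc b))
    (cong (λ z → (R 0 ⊛ a) (suc b) ℤ.+ z) (trans (⊛-x·ʳ (R 0) (R (suc k) ⊕ R k) (suc b))
      (trans (⊛-distribˡ (R 0) (R (suc k)) (R k) b) (cong₂ ℤ._+_ (R⊛R b (suc k)) (R⊛R b k)))))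

  R⊛R b zero    = trans (⊛-cong (λ _ → refl) R-zero b) (trans (expand b 0 one)
    (trans (cong (ℤ._+ (x· (R 2 ⊕ R 1)) b) (⊛-identityʳ (R 0) b)) (sym (R-suc 0 b))))
  R⊛R b (suc k) = trans (⊛-cong (λ _ → refl) (R-suc k) b) (trans (expand b (suc k) (R k))
    (trans (cong (ℤ._+ (x· (R (3 ℕ.+ k) ⊕ R (2 ℕ.+ k))) b) (R⊛R b k)) (sym (R-suc (suc k) b))))

s-zero : s 0 ≡ 1ℤ
s-zero = refl

-- From the diagonal the first step leads to R 1 + R 0, and R 1 is the square of R 0.
s-suc : ∀ n → s (suc n) ≡ s n ℤ.+ (s ⊛ s) n
s-suc n = begin
  s (suc n)                  ≡⟨ s≡R (suc n) ⟩
  R 1 n ℤ.+ R 0 n            ≡⟨ ℤ.+-comm (R 1 n) (R 0 n) ⟩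
  R 0 n ℤ.+ R 1 n            ≡⟨ cong (λ z → R 0 n ℤ.+ z) (R⊛R n 0) ⟨
  R 0 n ℤ.+ (R 0 ⊛ R 0) n    ≡⟨ cong₂ ℤ._+_ (s≡R n) (⊛-cong s≡R s≡R n) ⟨
  s n ℤ.+ (s ⊛ s) n          ∎
  where
  open ≡-Reasoning
  s≡R : s ≗ R 0
  s≡R m = cong +_ (schröder≡ρ m)

-- Determinants of triangular matrices

_*ᴹ_ : ∀ {m n p} → Matrix m n → Matrix n p → Matrix m p
(A *ᴹ B) i j = sum λ k → A i k ℤ.* B k j

minor : ∀ {m n} → Matrix m (suc n) → Fin (suc n) → Matrix m n
minor M j i = Vector.removeAt (M i) j

below : ∀ {m n} → Matrix (suc m) n → Matrix m n
below M i = M (suc i)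

sum≡0 : ∀ {n} {t : Fin n → ℤ} → (∀ i → t i ≡ 0ℤ) → sum t ≡ 0ℤ
sum≡0 {n} t≡0 = trans (sum-cong-≗ t≡0) (sum-replicate-zero n)

det-cong : ∀ {n} {M N : Matrix n n} → (∀ i j → M i j ≡ N i j) → det M ≡ det N
det-cong {zero}  M≡N = refl
det-cong {suc n} M≡N = sum-cong-≗ λ j → cong₂ (λ a b → -1ℤ ℤ.^ toℕ j ℤ.* a ℤ.* b)
  (M≡N zero j) (det-cong λ i k → M≡N (suc i) (punchIn j k))

punchIn-≤ : ∀ {n} {j k : Fin n} → toℕ j ℕ.≤ toℕ k → punchIn (inject₁ j) k ≡ suc k
punchIn-≤ {j = zero}              j≤k         = refl
punchIn-≤ {j = suc j} {k = suc k} (ℕ.s≤s j≤k) = cong suc (punchIn-≤ j≤k)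

punchIn-> : ∀ {n} {j k : Fin n} → toℕ j ℕ.≤ toℕ k → punchIn (suc k) j ≡ inject₁ j
punchIn-> {j = zero}              j≤k         = refl
punchIn-> {j = suc j} {k = suc k} (ℕ.s≤s j≤k) = cong suc (punchIn-> j≤k)

-- Both sides skip the same two columns, j and k + 1.
punchIn-punchIn : ∀ {n} {j k : Fin (suc n)} → toℕ j ℕ.≤ toℕ k → ∀ i →
  punchIn (inject₁ j) (punchIn k i) ≡ punchIn (suc k) (punchIn j i)
punchIn-punchIn {j = zero}              j≤k         i       = refl
punchIn-punchIn {suc n} {j = suc j} {k = suc k} (ℕ.s≤s j≤k) zero    = refl
punchIn-punchIn {suc n} {j = suc j} {k = suc k} (ℕ.s≤s j≤k) (suc i) = cong suc (punchIn-punchIn j≤k i)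

-- An index pair (j , k) stands for the ordered pair of distinct columns j and `punchIn j k`. For j
-- ≤ k, (`inject₁ j` , k) and (`suc k` , j) name the same columns in opposite orders, so the terms
-- cancel in pairs.
sum-antisym : ∀ {m} (G : Fin (suc m) → Fin m → ℤ) →
  (∀ {j k} → toℕ j ℕ.≤ toℕ k → G (inject₁ j) k ℤ.+ G (suc k) j ≡ 0ℤ) →
  sum (λ j → sum (G j)) ≡ 0ℤ
sum-antisym {zero}  G G≡0 = refl
sum-antisym {suc m} G G≡0 = begin
  sum (G zero) ℤ.+ sum (λ j → G (suc j) zero ℤ.+ sum (λ k → G (suc j) (suc k)))
    ≡⟨ cong (ℤ._+_ (sum (G zero))) (∑-distrib-+ (λ j → G (suc j) zero) (λ j → sum (λ k → G (suc j) (suc k)))) ⟩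
  sum (G zero) ℤ.+ (sum (λ j → G (suc j) zero) ℤ.+ sum (λ j → sum (λ k → G (suc j) (suc k))))
    ≡⟨ ℤ.+-assoc (sum (G zero)) _ _ ⟨
  sum (G zero) ℤ.+ sum (λ j → G (suc j) zero) ℤ.+ sum (λ j → sum (λ k → G (suc j) (suc k)))
    ≡⟨ cong₂ ℤ._+_
         (trans (sym (∑-distrib-+ (G zero) (λ j → G (suc j) zero)))
                (sum≡0 λ j → G≡0 {zero} {j} ℕ.z≤n))
         (sum-antisym (λ j k → G (suc j) (suc k)) (λ j≤k → G≡0 (ℕ.s≤s j≤k))) ⟩
  0ℤ ∎
  where open ≡-Reasoning

private
  term₂ : ∀ {n} → Matrix (2 ℕ.+ n) (2 ℕ.+ n) → Fin (2 ℕ.+ n) → Fin (1 ℕ.+ n) → ℤ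
  term₂ M j k = -1ℤ ℤ.^ toℕ j ℤ.* M zero j ℤ.*
    (-1ℤ ℤ.^ toℕ k ℤ.* M (suc zero) (punchIn j k) ℤ.* det (minor (minor (below (below M)) j) k))

  det-expand₂ : ∀ {n} (M : Matrix (2 ℕ.+ n) (2 ℕ.+ n)) → det M ≡ sum (λ j → sum (term₂ M j))
  det-expand₂ M = sum-cong-≗ λ j → 
    *-distribˡ-sum (-1ℤ ℤ.^ toℕ j ℤ.* M zero j) (λ k →
      -1ℤ ℤ.^ toℕ k ℤ.* M (suc zero) (punchIn j k) ℤ.* det (minor (minor (below (below M)) j) k))

-- Expansion along the first two rows runs over ordered pairs of columns. Swapping the rows swaps
-- the columns of each pair and shifts the position of one of them by one, which changes the sign.
det-swap : ∀ {n} (M N : Matrix (2 ℕ.+ n) (2 ℕ.+ n)) →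
  M zero ≗ N (suc zero) → M (suc zero) ≗ N zero → (∀ i → below (below M) i ≗ below (below N) i) →
  det M ℤ.+ det N ≡ 0ℤ
det-swap M N M₀≗N₁ M₁≗N₀ M≗N = begin
  det M ℤ.+ det N
    ≡⟨ cong₂ ℤ._+_ (det-expand₂ M) (det-expand₂ N) ⟩
  sum (λ j → sum (term₂ M j)) ℤ.+ sum (λ j → sum (term₂ N j))
    ≡⟨ ∑-distrib-+ (λ j → sum (term₂ M j)) (λ j → sum (term₂ N j)) ⟨
  sum (λ j → sum (term₂ M j) ℤ.+ sum (term₂ N j))
    ≡⟨ sum-cong-≗ (λ j → ∑-distrib-+ (term₂ M j) (term₂ N j)) ⟨
  sum (λ j → sum (λ k → term₂ M j k ℤ.+ term₂ N j k))
    ≡⟨ sum-antisym (λ j k → term₂ M j k ℤ.+ term₂ N j k) cancel ⟩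
  0ℤ ∎
  where
  open ≡-Reasoning
  pair : ∀ {j k} (P Q : Matrix _ _) →
    P zero ≗ Q (suc zero) → P (suc zero) ≗ Q zero → (∀ i → below (below P) i ≗ below (below Q) i) →
    toℕ j ℕ.≤ toℕ k → term₂ P (inject₁ j) k ≡ ℤ.- term₂ Q (suc k) j
  pair {j} {k} P Q P₀≗Q₁ P₁≗Q₀ P≗Q j≤k
    rewrite toℕ-inject₁ j | punchIn-≤ j≤k | punchIn-> j≤k
          | P₀≗Q₁ (inject₁ j) | P₁≗Q₀ (suc k)
          | det-cong {M = minor (minor (below (below P)) (inject₁ j)) k}
                     {N = minor (minor (below (below Q)) (suc k)) j}
                     (λ i l → trans (P≗Q i _) (cong (below (below Q) i) (punchIn-punchIn j≤k l)))
    = lem (-1ℤ ℤ.^ toℕ j) (-1ℤ ℤ.^ toℕ k) (Q (suc zero) (inject₁ j)) (Q zero (suc k)) _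
    where
    lem : ∀ s t a b d → s ℤ.* a ℤ.* (t ℤ.* b ℤ.* d) ≡ ℤ.- (-1ℤ ℤ.* t ℤ.* b ℤ.* (s ℤ.* a ℤ.* d))
    lem = ℤ-Solver.solve-∀
  cancel : ∀ {j k} → toℕ j ℕ.≤ toℕ k →
    (term₂ M (inject₁ j) k ℤ.+ term₂ N (inject₁ j) k) ℤ.+ (term₂ M (suc k) j ℤ.+ term₂ N (suc k) j) ≡ 0ℤ
  cancel {j} {k} j≤k = trans
    (cong (ℤ._+ (term₂ M (suc k) j ℤ.+ term₂ N (suc k) j)) (cong₂ ℤ._+_
      (pair M N M₀≗N₁ M₁≗N₀ M≗N j≤k)
      (pair N M (λ l → sym (M₁≗N₀ l)) (λ l → sym (M₀≗N₁ l)) (λ i l → sym (M≗N i l)) j≤k)))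
    (lem (term₂ N (suc k) j) (term₂ M (suc k) j))
    where
    lem : ∀ a b → (ℤ.- a ℤ.+ ℤ.- b) ℤ.+ (b ℤ.+ a) ≡ 0ℤ
    lem = ℤ-Solver.solve-∀

i+i≡0⇒i≡0 : ∀ i → i ℤ.+ i ≡ 0ℤ → i ≡ 0ℤ
i+i≡0⇒i≡0 (+ zero)  _ = refl

-- If rows zero and one agree, swapping them gives 2 det M = 0. Otherwise swapping rows zero and one
-- moves both equal rows below the first, so every minor of the expansion contains them and vanishes
-- by induction.
det-alternating : ∀ {n} (M : Matrix (suc n) (suc n)) i → M zero ≗ M (suc i) → det M ≡ 0ℤ
det-alternating M zero    M₀≗M₁ =
  i+i≡0⇒i≡0 (det M) (det-swap M M M₀≗M₁ (λ j → sym (M₀≗M₁ j)) (λ _ _ → refl))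
det-alternating {suc n} M (suc i) M₀≗Mᵢ = begin
  det M            ≡⟨ ℤ.+-identityʳ (det M) ⟨
  det M ℤ.+ 0ℤ     ≡⟨ cong (λ z → det M ℤ.+ z) det-M′≡0 ⟨
  det M ℤ.+ det M′ ≡⟨ det-swap M M′ (λ _ → refl) (λ _ → refl) (λ _ _ → refl) ⟩
  0ℤ               ∎
  where
  open ≡-Reasoning
  M′ : Matrix _ _
  M′ zero          = M (suc zero)
  M′ (suc zero)    = M zero
  M′ (suc (suc k)) = M (suc (suc k))
  det-M′≡0 : det M′ ≡ 0ℤ
  det-M′≡0 = sum≡0 λ j → trans
    (cong (-1ℤ ℤ.^ toℕ j ℤ.* M′ zero j ℤ.*_)
      (det-alternating (minor (below M′) j) i (λ l → M₀≗Mᵢ (punchIn j l))))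
    (ℤ.*-zeroʳ (-1ℤ ℤ.^ toℕ j ℤ.* M′ zero j))

record UpperUnitriangular {n} (T : Matrix n n) : Set where
  field
    diagonal≡1 : ∀ i → T i i ≡ 1ℤ
    below≡0    : ∀ {i j} → toℕ j ℕ.< toℕ i → T i j ≡ 0ℤ
open UpperUnitriangular

-- Row zero of T M is a combination of the rows of M; all its terms but the
-- leading one repeat a lower row and so contribute nothing.
det-unitriangular : ∀ {n} (T M : Matrix n n) → UpperUnitriangular T → det (T *ᴹ M) ≡ det M
det-unitriangular {zero}  T M T-uni = refl
det-unitriangular {suc n} T M T-uni = begin
  det (T *ᴹ M)
    ≡⟨ sum-cong-≗ (λ j → cong (-1ℤ ℤ.^ toℕ j ℤ.* sum (λ p → T zero p ℤ.* M p j) ℤ.*_) (minors j)) ⟩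
  sum (λ j → -1ℤ ℤ.^ toℕ j ℤ.* sum (λ p → T zero p ℤ.* M p j) ℤ.* det (minor (below M) j))
    ≡⟨ sum-cong-≗ pull ⟩
  sum (λ j → sum (λ p → T zero p ℤ.* term p j))
    ≡⟨ ∑-comm (λ j p → T zero p ℤ.* term p j) ⟩
  sum (λ p → sum (λ j → T zero p ℤ.* term p j))
    ≡⟨ sum-cong-≗ (λ p → *-distribˡ-sum (T zero p) (term p)) ⟨
  T zero zero ℤ.* det M ℤ.+ sum (λ p → T zero (suc p) ℤ.* sum (term (suc p)))
    ≡⟨ cong₂ ℤ._+_ (trans (cong (ℤ._* det M) (diagonal≡1 T-uni zero)) (ℤ.*-identityˡ (det M)))
         (sum≡0 λ p → trans (cong (T zero (suc p) ℤ.*_) (repeated p)) (ℤ.*-zeroʳ (T zero (suc p)))) ⟩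
  det M ℤ.+ 0ℤ
    ≡⟨ ℤ.+-identityʳ (det M) ⟩
  det M ∎
  where
  open ≡-Reasoning
  T′ : Matrix n n
  T′ i j = T (suc i) (suc j)
  -- Column zero of `T` vanishes below the diagonal, so the lower rows of the product combine only
  -- lower rows of `M`.
  minors : ∀ j → det (minor (below (T *ᴹ M)) j) ≡ det (minor (below M) j)
  minors j = trans
    (det-cong λ i k → trans
      (cong (λ a → a ℤ.* M zero (punchIn j k) ℤ.+
                   sum (λ p → T′ i p ℤ.* M (suc p) (punchIn j k)))
            (below≡0 T-uni {suc i} {zero} (ℕ.s≤s ℕ.z≤n)))
      (ℤ.+-identityˡ _))
    (det-unitriangular T′ (minor (below M) j)
      record { diagonal≡1 = λ i → diagonal≡1 T-uni (suc i) ; below≡0 = λ j<i → below≡0 T-uni (ℕ.s≤s j<i) })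
  term : Fin (suc n) → Fin (suc n) → ℤ
  term p j = -1ℤ ℤ.^ toℕ j ℤ.* M p j ℤ.* det (minor (below M) j)
  pull : ∀ j → -1ℤ ℤ.^ toℕ j ℤ.* sum (λ p → T zero p ℤ.* M p j) ℤ.* det (minor (below M) j)
             ≡ sum (λ p → T zero p ℤ.* term p j)
  pull j = trans
    (cong (ℤ._* det (minor (below M) j)) (*-distribˡ-sum (-1ℤ ℤ.^ toℕ j) (λ p → T zero p ℤ.* M p j)))
    (trans (*-distribʳ-sum (det (minor (below M) j)) (λ p → -1ℤ ℤ.^ toℕ j ℤ.* (T zero p ℤ.* M p j)))
      (sum-cong-≗ λ p → lem (-1ℤ ℤ.^ toℕ j) (T zero p) (M p j) (det (minor (below M) j))))
    where
    lem : ∀ s t a d → s ℤ.* (t ℤ.* a) ℤ.* d ≡ t ℤ.* (s ℤ.* a ℤ.* d)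
    lem = ℤ-Solver.solve-∀
  -- This sum is the expansion of `M` with row zero replaced by row p + 1.
  repeated : ∀ p → sum (term (suc p)) ≡ 0ℤ
  repeated p = det-alternating M′ p (λ _ → refl)
    where
    M′ : Matrix (suc n) (suc n)
    M′ zero    = M (suc p)
    M′ (suc i) = M (suc i)

∏ : ∀ {n} → (Fin n → ℤ) → ℤ
∏ = Vector.foldr ℤ._*_ 1ℤ

det-lower : ∀ {n} (M : Matrix n n) → (∀ {i j} → toℕ i ℕ.< toℕ j → M i j ≡ 0ℤ) →
            det M ≡ ∏ (λ i → M i i)
det-lower {zero}  M lower = refl
det-lower {suc n} M lower = trans (cong₂ ℤ._+_
    (cong₂ ℤ._*_ (ℤ.*-identityˡ (M zero zero))
      (det-lower (minor (below M) zero) (λ i<j → lower (ℕ.s≤s i<j))))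
    (sum≡0 λ j → trans
      (cong (λ a → -1ℤ ℤ.^ toℕ (suc j) ℤ.* a ℤ.* det (minor (below M) (suc j))) (lower {zero} {suc j} (ℕ.s≤s ℕ.z≤n)))
      (lem (-1ℤ ℤ.^ toℕ (suc j)) _)))
  (ℤ.+-identityʳ _)
  where
  lem : ∀ s d → s ℤ.* 0ℤ ℤ.* d ≡ 0ℤ
  lem = ℤ-Solver.solve-∀

-- The determinant

open Elimination s s-zero s-suc


↑-elim : ∀ m {n} (P : Fin (m ℕ.+ n) → Set) → (∀ i → P (i ↑ˡ n)) → (∀ i → P (m ↑ʳ i)) → ∀ i → P i
↑-elim m {n} P left right i with Fin.splitAt m i | join-splitAt m n i
... | inj₁ j | refl = left j
... | inj₂ j | refl = right j

sum-split : ∀ m {n} (t : Fin (m ℕ.+ n) → ℤ) → sum t ≡ sum (t ∘ (_↑ˡ n)) ℤ.+ sum (t ∘ (m ↑ʳ_))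
sum-split zero    t = sym (ℤ.+-identityˡ _)
sum-split (suc m) t = trans (cong (λ z → t zero ℤ.+ z) (sum-split m (t ∘ suc))) (sym (ℤ.+-assoc (t zero) _ _))

∏-cong : ∀ {n} {t u : Fin n → ℤ} → t ≗ u → ∏ t ≡ ∏ u
∏-cong {zero}  t≗u = refl
∏-cong {suc n} t≗u = cong₂ ℤ._*_ (t≗u zero) (∏-cong (t≗u ∘ suc))

∏-split : ∀ m {n} (t : Fin (m ℕ.+ n) → ℤ) → ∏ t ≡ ∏ (t ∘ (_↑ˡ n)) ℤ.* ∏ (t ∘ (m ↑ʳ_))
∏-split zero    t = sym (ℤ.*-identityˡ _)
∏-split (suc m) t = trans (cong (t zero ℤ.*_) (∏-split m (t ∘ suc))) (sym (ℤ.*-assoc (t zero) _ _))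

∏-one : ∀ n {t : Fin n → ℤ} → (∀ i → t i ≡ 1ℤ) → ∏ t ≡ 1ℤ
∏-one zero    t≡1 = refl
∏-one (suc n) t≡1 = cong₂ ℤ._*_ (t≡1 zero) (∏-one n (t≡1 ∘ suc))

module _ {m n p q} (A : Matrix m p) (B : Matrix m q) (C : Matrix n p) (D : Matrix n q) where

  block-ˡˡ : ∀ i j → block A B C D (i ↑ˡ n) (j ↑ˡ q) ≡ A i j
  block-ˡˡ i j = trans (cong (λ row → row (j ↑ˡ q)) (lookup-++ˡ (λ i → A i Vector.++ B i) _ i)) (lookup-++ˡ (A i) (B i) j)

  block-ˡʳ : ∀ i j → block A B C D (i ↑ˡ n) (p ↑ʳ j) ≡ B i j
  block-ˡʳ i j = trans (cong (λ row → row (p ↑ʳ j)) (lookup-++ˡ (λ i → A i Vector.++ B i) _ i)) (lookup-++ʳ (A i) (B i) j)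

  block-ʳˡ : ∀ i j → block A B C D (m ↑ʳ i) (j ↑ˡ q) ≡ C i j
  block-ʳˡ i j = trans (cong (λ row → row (j ↑ˡ q)) (lookup-++ʳ (λ i → A i Vector.++ B i) _ i)) (lookup-++ˡ (C i) (D i) j)

  block-ʳʳ : ∀ i j → block A B C D (m ↑ʳ i) (p ↑ʳ j) ≡ D i j
  block-ʳʳ i j = trans (cong (λ row → row (p ↑ʳ j)) (lookup-++ʳ (λ i → A i Vector.++ B i) _ i)) (lookup-++ʳ (C i) (D i) j)

I-diagonal : ∀ {n} (i : Fin n) → I n i i ≡ 1ℤ
I-diagonal zero    = refl
I-diagonal (suc i) = I-diagonal i

I-below : ∀ {n} {i j : Fin n} → toℕ j ℕ.< toℕ i → I n i j ≡ 0ℤ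
I-below {i = suc i} {zero}  _           = refl
I-below {i = suc i} {suc j} (ℕ.s≤s j<i) = I-below j<i

*ᴹ-I : ∀ {m n} (A : Matrix m n) i j → (A *ᴹ I n) i j ≡ A i j
*ᴹ-I {m} {n} A i = go (A i)
  where
  go : ∀ {n} (v : Fin n → ℤ) j → sum (λ k → v k ℤ.* I n k j) ≡ v j
  go v zero    = trans (cong₂ ℤ._+_ (ℤ.*-identityʳ (v zero)) (sum≡0 λ k → ℤ.*-zeroʳ (v (suc k)))) (ℤ.+-identityʳ (v zero))
  go v (suc j) = trans (cong₂ ℤ._+_ (ℤ.*-zeroʳ (v zero)) (go (v ∘ suc) j)) (ℤ.+-identityˡ (v (suc j)))

I-*ᴹ : ∀ {m n} (A : Matrix m n) i j → (I m *ᴹ A) i j ≡ A i j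
I-*ᴹ {suc m} A zero j = trans
  (cong₂ ℤ._+_ (ℤ.*-identityˡ (A zero j)) (sum≡0 {m} {λ k → 0ℤ ℤ.* A (suc k) j} λ k → refl))
  (ℤ.+-identityʳ (A zero j))
I-*ᴹ {suc m} A (suc i) j = trans
  (ℤ.+-identityˡ (sum λ k → I m i k ℤ.* A (suc k) j)) (I-*ᴹ (A ∘ suc) i j)

-- Toeplitz matrices and power series

fromEnd : ∀ {n} → Fin n → ℕ
fromEnd {suc n} zero    = n
fromEnd {suc n} (suc i) = fromEnd i

fromEnd< : ∀ {n} (p : Fin n) → fromEnd p ℕ.< n
fromEnd< zero    = ℕ.≤-refl
fromEnd< (suc p) = ℕ.m≤n⇒m≤1+n (fromEnd< p)

toeplitz : Series → ∀ {n} → Matrix n n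
toeplitz a zero    j       = a (toℕ j)
toeplitz a (suc i) zero    = 0ℤ
toeplitz a (suc i) (suc j) = toeplitz a i j

S≡toeplitz : ∀ n p q → S n p q ≡ toeplitz s p q
S≡toeplitz (suc n) zero    zero    = refl
S≡toeplitz (suc n) zero    (suc q) = refl
S≡toeplitz (suc n) (suc p) zero    = refl
S≡toeplitz (suc n) (suc p) (suc q) = trans (shift p q) (S≡toeplitz n p q)
  where
  shift : ∀ {n} (p q : Fin n) → S (suc n) (suc p) (suc q) ≡ S n p q
  shift zero    q = refl
  shift (suc p) q = refl

toeplitz-* : ∀ a b {n} (p q : Fin n) → (toeplitz a *ᴹ toeplitz b) p q ≡ toeplitz (a ⊛ b) p q
toeplitz-* a b zero    q = row a q
  where
  row : ∀ {n} a (q : Fin n) → sum (λ k → a (toℕ k) ℤ.* toeplitz b k q) ≡ (a ⊛ b) (toℕ q)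
  row {suc n} a zero    = trans (cong (λ z → a 0 ℤ.* b 0 ℤ.+ z) (sum≡0 {n} λ k → ℤ.*-zeroʳ (a (suc (toℕ k))))) (ℤ.+-identityʳ _)
  row {suc n} a (suc q) = cong (λ z → a 0 ℤ.* b (suc (toℕ q)) ℤ.+ z) (row (a ∘ suc) q)
toeplitz-* a b {suc n} (suc p) zero    = trans
  (ℤ.+-identityˡ (sum λ k → toeplitz a p k ℤ.* 0ℤ)) (sum≡0 λ k → ℤ.*-zeroʳ (toeplitz a p k))
toeplitz-* a b {suc n} (suc p) (suc q) = trans
  (ℤ.+-identityˡ (sum λ k → toeplitz a p k ℤ.* toeplitz b k q)) (toeplitz-* a b p q)

-- For k from q on, the distance from q to k and the position of k from the end add up to the
-- position of q from the end. So the transpose acts by convolution on a row read from the right.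
toeplitzᵀ-* : ∀ a b {n} (q : Fin n) → sum (λ k → b (fromEnd k) ℤ.* toeplitz a q k) ≡ (a ⊛ b) (fromEnd q)
toeplitzᵀ-* a b zero    = row _ a
  where
  row : ∀ n a → sum {suc n} (λ k → b (fromEnd k) ℤ.* a (toℕ k)) ≡ (a ⊛ b) n
  row zero    a = trans (ℤ.+-identityʳ _) (ℤ.*-comm (b 0) (a 0))
  row (suc n) a = cong₂ ℤ._+_ (ℤ.*-comm (b (suc n)) (a 0)) (row n (a ∘ suc))
toeplitzᵀ-* a b {suc n} (suc q) = trans
  (cong₂ ℤ._+_ (ℤ.*-zeroʳ (b n)) (toeplitzᵀ-* a b q)) (ℤ.+-identityˡ _)

-- Translates between the two readings of a row: on and right of the diagonal, the distance i from
-- the diagonal and the position from the end have a constant sum along the row.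
toeplitz-entry : ∀ {n} (p q : Fin n) →
  (∃ λ i → i ℕ.+ fromEnd q ≡ fromEnd p × (∀ a → toeplitz a p q ≡ a i)) ⊎
  (fromEnd p ℕ.< fromEnd q × (∀ a → toeplitz a p q ≡ 0ℤ))
toeplitz-entry zero    q       = inj₁ (toℕ q , toℕ+fromEnd q , λ a → refl)
  where
  toℕ+fromEnd : ∀ {n} (q : Fin (suc n)) → toℕ q ℕ.+ fromEnd q ≡ n
  toℕ+fromEnd zero            = refl
  toℕ+fromEnd {suc n} (suc q) = cong suc (toℕ+fromEnd q)
toeplitz-entry (suc p) zero    = inj₂ (fromEnd< p , λ a → refl)
toeplitz-entry (suc p) (suc q) = toeplitz-entry p q

fromEnd-antitone : ∀ {n} {p q : Fin n} → toℕ p ℕ.< toℕ q → fromEnd q ℕ.< fromEnd p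
fromEnd-antitone {p = zero} {suc q}  _           = fromEnd< q
fromEnd-antitone {p = suc p} {suc q} (ℕ.s≤s p<q) = fromEnd-antitone p<q

toeplitz-diagonal : ∀ a {n} (p : Fin n) → toeplitz a p p ≡ a 0
toeplitz-diagonal a zero    = refl
toeplitz-diagonal a (suc p) = toeplitz-diagonal a p

toeplitz-below : ∀ a {n} {p q : Fin n} → toℕ q ℕ.< toℕ p → toeplitz a p q ≡ 0ℤ
toeplitz-below a {p = suc p} {zero}  _           = refl
toeplitz-below a {p = suc p} {suc q} (ℕ.s≤s q<p) = toeplitz-below a q<p

-- Elimination in the block matrix

module _ (n : ℕ) where

  private
    -- Row p belongs to t = `fromEnd p`. Read from the right end, its two halves are γ_t and δ_t;
    -- `γʳ` appears because `toeplitz` reads from the diagonal.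
    Tγ Tδ O : Matrix n n
    Tγ p q = toeplitz (γʳ (fromEnd p)) p q
    Tδ p q = δ (fromEnd p) (fromEnd q)
    O  p q = 0ℤ

    T M : Matrix (n ℕ.+ n) (n ℕ.+ n)
    T = block Tγ Tδ O (I n)
    M = block (S n) (I n) (-ᴹ I n) (S n ᵀ)

    Tˡ-M : ∀ p j → (T *ᴹ M) (p ↑ˡ n) j ≡
      sum (λ k → Tγ p k ℤ.* M (k ↑ˡ n) j) ℤ.+ sum (λ k → Tδ p k ℤ.* M (n ↑ʳ k) j)
    Tˡ-M p j = trans (sum-split n (λ k → T (p ↑ˡ n) k ℤ.* M k j)) (cong₂ ℤ._+_
      (sum-cong-≗ λ k → cong (ℤ._* M (k ↑ˡ n) j) (block-ˡˡ Tγ Tδ O (I n) p k))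
      (sum-cong-≗ λ k → cong (ℤ._* M (n ↑ʳ k) j) (block-ˡʳ Tγ Tδ O (I n) p k)))

    Tʳ-M : ∀ p j → (T *ᴹ M) (n ↑ʳ p) j ≡ M (n ↑ʳ p) j
    Tʳ-M p j = trans (sum-split n (λ k → T (n ↑ʳ p) k ℤ.* M k j)) (trans (cong₂ ℤ._+_
      (sum≡0 λ k → cong (ℤ._* M (k ↑ˡ n) j) (block-ʳˡ Tγ Tδ O (I n) p k))
      (trans (sum-cong-≗ λ k → cong (ℤ._* M (n ↑ʳ k) j) (block-ʳʳ Tγ Tδ O (I n) p k))
        (I-*ᴹ (λ k → M (n ↑ʳ k)) p j)))
      (ℤ.+-identityˡ _))

    TMˡˡ : ∀ p q → (T *ᴹ M) (p ↑ˡ n) (q ↑ˡ n)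
         ≡ toeplitz (γʳ (fromEnd p) ⊛ s) p q ℤ.+ -1ℤ ℤ.* δ (fromEnd p) (fromEnd q)
    TMˡˡ p q = trans (Tˡ-M p (q ↑ˡ n)) (cong₂ ℤ._+_
      (trans (sum-cong-≗ λ k → cong (Tγ p k ℤ.*_)
          (trans (block-ˡˡ (S n) (I n) (-ᴹ I n) (S n ᵀ) k q) (S≡toeplitz n k q)))
        (toeplitz-* (γʳ (fromEnd p)) s p q))
      (trans (sum-cong-≗ λ k → trans (cong (Tδ p k ℤ.*_) (block-ʳˡ (S n) (I n) (-ᴹ I n) (S n ᵀ) k q))
                                     (negate (Tδ p k) (I n k q)))
        (trans (sym (*-distribˡ-sum -1ℤ (λ k → Tδ p k ℤ.* I n k q)))
          (cong (-1ℤ ℤ.*_) (*ᴹ-I Tδ p q)))))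
      where
      negate : ∀ a b → a ℤ.* ℤ.- b ≡ -1ℤ ℤ.* (a ℤ.* b)
      negate = ℤ-Solver.solve-∀

    -- Both summands are series read from the right end, so the entry is a coefficient of γ_t + s
    -- δ_t.
    TMˡʳ : ∀ p q → (T *ᴹ M) (p ↑ˡ n) (n ↑ʳ q) ≡ 0ℤ
    TMˡʳ p q = trans (Tˡ-M p (n ↑ʳ q)) (trans (cong₂ ℤ._+_
      (trans (sum-cong-≗ λ k → cong (Tγ p k ℤ.*_) (block-ˡʳ (S n) (I n) (-ᴹ I n) (S n ᵀ) k q))
        (trans (*ᴹ-I Tγ p q) Tγ≡γ))
      (trans (sum-cong-≗ λ k → cong (Tδ p k ℤ.*_)
          (trans (block-ʳʳ (S n) (I n) (-ᴹ I n) (S n ᵀ) k q) (S≡toeplitz n q k)))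
        (trans (toeplitzᵀ-* s (δ (fromEnd p)) q) (s⊛δ (fromEnd p) (fromEnd q)))))
      (cancel (γ (fromEnd p) (fromEnd q))))
      where
      Tγ≡γ : Tγ p q ≡ γ (fromEnd p) (fromEnd q)
      Tγ≡γ with toeplitz-entry p q
      ... | inj₁ (i , i+q≡p , entry) = trans (entry _) (γʳ-reverse (fromEnd p) i (fromEnd q) i+q≡p)
      -- Left of the diagonal the position from the end exceeds t, where γ_t has no coefficients.
      ... | inj₂ (p<q , entry)       = trans (entry _) (sym (γ-degree (fromEnd p) p<q))
      cancel : ∀ a → a ℤ.+ -1ℤ ℤ.* a ≡ 0ℤ
      cancel = ℤ-Solver.solve-∀

    TMʳʳ : ∀ p q → (T *ᴹ M) (n ↑ʳ p) (n ↑ʳ q) ≡ toeplitz s q p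
    TMʳʳ p q = trans (Tʳ-M p (n ↑ʳ q)) (trans (block-ʳʳ (S n) (I n) (-ᴹ I n) (S n ᵀ) p q) (S≡toeplitz n q p))

    ↑ˡ<↑ʳ : ∀ (p q : Fin n) → toℕ (p ↑ˡ n) ℕ.< toℕ (n ↑ʳ q)
    ↑ˡ<↑ʳ p q = subst₂ ℕ._<_ (sym (toℕ-↑ˡ p n)) (sym (toℕ-↑ʳ n q)) (ℕ.≤-trans (toℕ<n p) (ℕ.m≤m+n n (toℕ q)))

    T-unitriangular : UpperUnitriangular T
    T-unitriangular .UpperUnitriangular.diagonal≡1 = ↑-elim n _
      (λ p → trans (block-ˡˡ Tγ Tδ O (I n) p p) (trans (toeplitz-diagonal _ p) (γʳ-zero (fromEnd p))))
      (λ p → trans (block-ʳʳ Tγ Tδ O (I n) p p) (I-diagonal p))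
    T-unitriangular .UpperUnitriangular.below≡0 {i} {j} =
      ↑-elim n (λ i → ∀ j → toℕ j ℕ.< toℕ i → T i j ≡ 0ℤ)
        (λ p → ↑-elim n _
          (λ q q<p → trans (block-ˡˡ Tγ Tδ O (I n) p q)
            (toeplitz-below _ (subst₂ ℕ._<_ (toℕ-↑ˡ q n) (toℕ-↑ˡ p n) q<p)))
          (λ q q<p → ⊥-elim (ℕ.<-asym q<p (↑ˡ<↑ʳ p q))))
        (λ p → ↑-elim n _
          (λ q q<p → block-ʳˡ Tγ Tδ O (I n) p q)
          (λ q q<p → trans (block-ʳʳ Tγ Tδ O (I n) p q)
            (I-below (ℕ.+-cancelˡ-< n _ _ (subst₂ ℕ._<_ (toℕ-↑ʳ n q) (toℕ-↑ʳ n p) q<p)))))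
        i j

    upper : ∀ p q → toℕ p ℕ.< toℕ q → (T *ᴹ M) (p ↑ˡ n) (q ↑ˡ n) ≡ 0ℤ
    upper p q p<q = trans (TMˡˡ p q) (go (toeplitz-entry p q))
      where
      go : _ → toeplitz (γʳ (fromEnd p) ⊛ s) p q ℤ.+ -1ℤ ℤ.* δ (fromEnd p) (fromEnd q) ≡ 0ℤ
      go (inj₁ (i , i+q≡p , entry)) =
        trans (cong (ℤ._+ -1ℤ ℤ.* δ (fromEnd p) (fromEnd q)) (entry (γʳ (fromEnd p) ⊛ s)))
        (trans (γʳ⊛s-δ (fromEnd p) i (fromEnd q) i+q≡p)
          (cong (+ 2 ℤ.*_) (P-vanish (fromEnd p) (fromEnd-antitone p<q))))
      go (inj₂ (p<q′ , _)) = ⊥-elim (ℕ.<-asym p<q′ (fromEnd-antitone p<q))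

    TM-lower : ∀ {i j} → toℕ i ℕ.< toℕ j → (T *ᴹ M) i j ≡ 0ℤ
    TM-lower {i} {j} = ↑-elim n (λ i → ∀ j → toℕ i ℕ.< toℕ j → (T *ᴹ M) i j ≡ 0ℤ)
      (λ p → ↑-elim n (λ j → toℕ (p ↑ˡ n) ℕ.< toℕ j → (T *ᴹ M) (p ↑ˡ n) j ≡ 0ℤ)
        (λ q p<q → upper p q (subst₂ ℕ._<_ (toℕ-↑ˡ p n) (toℕ-↑ˡ q n) p<q))
        (λ q _ → TMˡʳ p q))
      (λ p → ↑-elim n (λ j → toℕ (n ↑ʳ p) ℕ.< toℕ j → (T *ᴹ M) (n ↑ʳ p) j ≡ 0ℤ)
        (λ q p<q → ⊥-elim (ℕ.<-asym p<q (↑ˡ<↑ʳ q p)))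
        (λ q p<q → trans (TMʳʳ p q) (toeplitz-below s
          (ℕ.+-cancelˡ-< n _ _ (subst₂ ℕ._<_ (toℕ-↑ʳ n p) (toℕ-↑ʳ n q) p<q)))))
      i j

    -- The entry is twice the leading coefficient 2^t of λ^t.
    TM-diagonalˡ : ∀ p → (T *ᴹ M) (p ↑ˡ n) (p ↑ˡ n) ≡ 2^ suc (fromEnd p)
    TM-diagonalˡ p = trans (TMˡˡ p p) (trans
      (cong (ℤ._+ -1ℤ ℤ.* δ (fromEnd p) (fromEnd p)) (toeplitz-diagonal (γʳ (fromEnd p) ⊛ s) p))
      (trans (γʳ⊛s-δ (fromEnd p) 0 (fromEnd p) refl)
        (trans (cong (+ 2 ℤ.*_) (P-leading (fromEnd p))) (sym (2^-suc (fromEnd p))))))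

  det-block : det M ≡ 2^ triangle n
  det-block = begin
    det M                                ≡⟨ det-unitriangular T M T-unitriangular ⟨
    det (T *ᴹ M)                         ≡⟨ det-lower (T *ᴹ M) TM-lower ⟩
    ∏ (λ i → (T *ᴹ M) i i)               ≡⟨ ∏-split n (λ i → (T *ᴹ M) i i) ⟩
    ∏ (λ p → (T *ᴹ M) (p ↑ˡ n) (p ↑ˡ n)) ℤ.* ∏ (λ p → (T *ᴹ M) (n ↑ʳ p) (n ↑ʳ p))
      ≡⟨ cong₂ ℤ._*_ (trans (∏-cong TM-diagonalˡ) (∏-powers n))
           (∏-one n λ p → trans (TMʳʳ p p) (trans (toeplitz-diagonal s p) s-zero)) ⟩
    2^ triangle n ℤ.* 1ℤ                 ≡⟨ ℤ.*-identityʳ _ ⟩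
    2^ triangle n                        ∎
    where
    open ≡-Reasoning
    ∏-powers : ∀ n → ∏ {n} (λ p → 2^ suc (fromEnd p)) ≡ 2^ triangle n
    ∏-powers zero    = refl
    ∏-powers (suc n) = trans (cong (2^ suc n ℤ.*_) (∏-powers n))
      (trans (sym (ℤ.pos-* (2 ℕ.^ suc n) (2 ℕ.^ triangle n)))
        (cong +_ (sym (ℕ.^-distribˡ-+-* 2 (suc n) (triangle n)))))

-- Transfer operators

-- The coverage of a row is a vector of Booleans, true for a cell that is already
-- covered.  The uncovered j-th cell of a row of n cells is matched with the j-th or
-- (j + 1)-st cell of the next row (opA), that of a row of n + 1 cells with the
-- (j - 1)-st or j-th (opB); K weighs the resulting coverage.  The Boolean argument is
-- the coverage that the leftmost open cell of the next row has received so far.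
opA : ∀ {n} → (Vec Bool (suc n) → ℕ) → Bool → Vec Bool n → ℕ
opA K b     []           = K (b ∷ [])
opA K b     (true ∷ us)  = opA (K ∘ (b ∷_)) false us
opA K false (false ∷ us) = opA (K ∘ (true ∷_)) false us ℕ.+ opA (K ∘ (false ∷_)) true us
opA K true  (false ∷ us) = opA (K ∘ (true ∷_)) true us

opB′ : ∀ {n} → (Vec Bool n → ℕ) → Bool → Vec Bool n → ℕ
opB′ K false []           = K []
-- The last cell has been matched past the end of the next row.
opB′ K true  []           = 0
opB′ K w     (true ∷ bs)  = opB′ (K ∘ (w ∷_)) false bs
opB′ K false (false ∷ bs) = opB′ (K ∘ (true ∷_)) false bs ℕ.+ opB′ (K ∘ (false ∷_)) true bs
opB′ K true  (false ∷ bs) = opB′ (K ∘ (true ∷_)) true bs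

opB : ∀ {n} → (Vec Bool n → ℕ) → Vec Bool (suc n) → ℕ
-- The leftmost cell has only cell zero of the next row to go to, and takes it exactly when it is
-- uncovered.
opB K (b ∷ bs) = opB′ K (not b) bs

opA-+ : ∀ {n} (K L : Vec Bool (suc n) → ℕ) b us →
        opA (λ bs → K bs ℕ.+ L bs) b us ≡ opA K b us ℕ.+ opA L b us
opA-+ K L b     []           = refl
opA-+ K L b     (true ∷ us)  = opA-+ (K ∘ (b ∷_)) (L ∘ (b ∷_)) false us
opA-+ K L false (false ∷ us) = trans
  (cong₂ ℕ._+_ (opA-+ (K ∘ (true ∷_)) (L ∘ (true ∷_)) false us)
             (opA-+ (K ∘ (false ∷_)) (L ∘ (false ∷_)) true us))
  (+-interchange (opA (K ∘ (true ∷_)) false us) _ _ _)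
opA-+ K L true  (false ∷ us) = opA-+ (K ∘ (true ∷_)) (L ∘ (true ∷_)) true us

opB′-+ : ∀ {n} (K L : Vec Bool n → ℕ) w bs →
         opB′ (λ us → K us ℕ.+ L us) w bs ≡ opB′ K w bs ℕ.+ opB′ L w bs
opB′-+ K L false []           = refl
opB′-+ K L true  []           = refl
opB′-+ K L false (true ∷ bs)  = opB′-+ (K ∘ (false ∷_)) (L ∘ (false ∷_)) false bs
opB′-+ K L true  (true ∷ bs)  = opB′-+ (K ∘ (true ∷_)) (L ∘ (true ∷_)) false bs
opB′-+ K L false (false ∷ bs) = trans
  (cong₂ ℕ._+_ (opB′-+ (K ∘ (true ∷_)) (L ∘ (true ∷_)) false bs)
             (opB′-+ (K ∘ (false ∷_)) (L ∘ (false ∷_)) true bs))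
  (+-interchange (opB′ (K ∘ (true ∷_)) false bs) _ _ _)
opB′-+ K L true  (false ∷ bs) = opB′-+ (K ∘ (true ∷_)) (L ∘ (true ∷_)) true bs

opA-cong : ∀ {n} {K L : Vec Bool (suc n) → ℕ} → K ≗ L → ∀ b us → opA K b us ≡ opA L b us
opA-cong K≗L b     []           = K≗L _
opA-cong K≗L b     (true ∷ us)  = opA-cong (K≗L ∘ (b ∷_)) false us
opA-cong K≗L false (false ∷ us) =
  cong₂ ℕ._+_ (opA-cong (K≗L ∘ (true ∷_)) false us) (opA-cong (K≗L ∘ (false ∷_)) true us)
opA-cong K≗L true  (false ∷ us) = opA-cong (K≗L ∘ (true ∷_)) true us

opB′-cong : ∀ {n} {K L : Vec Bool n → ℕ} → K ≗ L → ∀ w bs → opB′ K w bs ≡ opB′ L w bs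
opB′-cong K≗L false []           = K≗L []
opB′-cong K≗L true  []           = refl
opB′-cong K≗L false (true ∷ bs)  = opB′-cong (K≗L ∘ (false ∷_)) false bs
opB′-cong K≗L true  (true ∷ bs)  = opB′-cong (K≗L ∘ (true ∷_)) false bs
opB′-cong K≗L false (false ∷ bs) =
  cong₂ ℕ._+_ (opB′-cong (K≗L ∘ (true ∷_)) false bs) (opB′-cong (K≗L ∘ (false ∷_)) true bs)
opB′-cong K≗L true  (false ∷ bs) = opB′-cong (K≗L ∘ (true ∷_)) true bs

opB-cong : ∀ {n} {K L : Vec Bool n → ℕ} → K ≗ L → opB K ≗ opB L
opB-cong K≗L (b ∷ bs) = opB′-cong K≗L (not b) bs

-- Both composites read a row from left to right, keeping as state the coverage
-- that is still open in each of the two rows produced.  AB and BA are the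
-- resulting automata; the four equations after them intertwine their states.
private
  AB BA : ∀ {n} → Bool → Bool → (Vec Bool (suc n) → ℕ) → Vec Bool n → ℕ
  AB b w K us = opA (opB′ K w) b us
  BA x v K us = opB′ (opA (K ∘ Vec.map not) v) x (Vec.map not us)

  AB-diagonal : ∀ {n} K (us : Vec Bool n) → AB false false K us ℕ.+ AB true true K us ≡ 2 ℕ.* BA false false K us
  AB-false-true : ∀ {n} K (us : Vec Bool n) → AB false true K us ≡ 2 ℕ.* BA true false K us
  AB-false-false : ∀ {n} K (us : Vec Bool n) → AB false false K us ≡ BA false false K us ℕ.+ BA true true K us
  AB-true-false : ∀ {n} K (us : Vec Bool n) → AB true false K us ≡ BA false true K us

  AB-true : ∀ {n} K (us : Vec Bool n) → AB false false K (true ∷ us)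
         ≡ AB false false (K ∘ (true ∷_)) us ℕ.+ AB false true (K ∘ (false ∷_)) us
  AB-true K us = opA-+ (opB′ (K ∘ (true ∷_)) false) (opB′ (K ∘ (false ∷_)) true) false us
  AB-false : ∀ {n} K (us : Vec Bool n) → AB false false K (false ∷ us)
         ≡ AB false false (K ∘ (false ∷_)) us ℕ.+ (AB true false (K ∘ (true ∷_)) us ℕ.+ AB true true (K ∘ (false ∷_)) us)
  AB-false K us = cong (AB false false (K ∘ (false ∷_)) us ℕ.+_)
    (opA-+ (opB′ (K ∘ (true ∷_)) false) (opB′ (K ∘ (false ∷_)) true) true us)
  BA-true : ∀ {n} K (us : Vec Bool n) → BA false false K (true ∷ us)
         ≡ BA false false (K ∘ (true ∷_)) us ℕ.+ (BA true false (K ∘ (false ∷_)) us ℕ.+ BA true true (K ∘ (true ∷_)) us)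
  BA-true K us = cong (BA false false (K ∘ (true ∷_)) us ℕ.+_)
    (opB′-+ (opA (K ∘ (false ∷_) ∘ Vec.map not) false) (opA (K ∘ (true ∷_) ∘ Vec.map not) true) true (Vec.map not us))
  BA-false : ∀ {n} K (us : Vec Bool n) → BA false false K (false ∷ us)
         ≡ BA false false (K ∘ (false ∷_)) us ℕ.+ BA false true (K ∘ (true ∷_)) us
  BA-false K us =
    opB′-+ (opA (K ∘ (false ∷_) ∘ Vec.map not) false) (opA (K ∘ (true ∷_) ∘ Vec.map not) true) false (Vec.map not us)

  -- At the end of the row the factor 2 is visible: both `AB` states complete to the same covered
  -- cell, as does the single `BA` state.
  AB-diagonal K [] = lem (K (true ∷ []))
    where lem : ∀ k → k ℕ.+ 0 ℕ.+ k ≡ 2 ℕ.* k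
          lem = ℕ-Solver.solve-∀
  AB-diagonal K (true ∷ us) rewrite AB-true K us | BA-true K us
    | AB-false-false (K ∘ (true ∷_)) us | AB-false-true (K ∘ (false ∷_)) us =
      lem (BA false false (K ∘ (true ∷_)) us) (BA true true (K ∘ (true ∷_)) us) (BA true false (K ∘ (false ∷_)) us)
    where lem : ∀ a b c → (a ℕ.+ b) ℕ.+ 2 ℕ.* c ℕ.+ (a ℕ.+ b) ≡ 2 ℕ.* (a ℕ.+ (c ℕ.+ b))
          lem = ℕ-Solver.solve-∀
  AB-diagonal K (false ∷ us) rewrite AB-false K us | BA-false K us =
    trans (lem (AB false false (K ∘ (false ∷_)) us) (AB true false (K ∘ (true ∷_)) us) _)
    (trans (cong₂ ℕ._+_ (AB-diagonal (K ∘ (false ∷_)) us) (cong (2 ℕ.*_) (AB-true-false (K ∘ (true ∷_)) us)))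
      (sym (ℕ.*-distribˡ-+ 2 (BA false false (K ∘ (false ∷_)) us) _)))
    where lem : ∀ a b c → a ℕ.+ (b ℕ.+ c) ℕ.+ b ≡ a ℕ.+ c ℕ.+ 2 ℕ.* b
          lem = ℕ-Solver.solve-∀
  AB-false-true K [] = refl
  AB-false-true K (true ∷ us) = AB-false-true (K ∘ (true ∷_)) us
  AB-false-true K (false ∷ us) = AB-diagonal (K ∘ (true ∷_)) us
  AB-false-false K [] = refl
  AB-false-false K (true ∷ us) rewrite AB-true K us | BA-true K us
    | AB-false-false (K ∘ (true ∷_)) us | AB-false-true (K ∘ (false ∷_)) us =
      lem (BA false false (K ∘ (true ∷_)) us) (BA true true (K ∘ (true ∷_)) us) (BA true false (K ∘ (false ∷_)) us)
    where lem : ∀ a b c → (a ℕ.+ b) ℕ.+ 2 ℕ.* c ≡ (a ℕ.+ (c ℕ.+ b)) ℕ.+ c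
          lem = ℕ-Solver.solve-∀
  AB-false-false K (false ∷ us) rewrite AB-false K us | BA-false K us =
    trans (lem (AB false false (K ∘ (false ∷_)) us) (AB true false (K ∘ (true ∷_)) us) _)
    (trans (cong₂ ℕ._+_ (AB-diagonal (K ∘ (false ∷_)) us) (AB-true-false (K ∘ (true ∷_)) us))
      (lem′ (BA false false (K ∘ (false ∷_)) us) _))
    where lem : ∀ a b c → a ℕ.+ (b ℕ.+ c) ≡ a ℕ.+ c ℕ.+ b
          lem = ℕ-Solver.solve-∀
          lem′ : ∀ a b → 2 ℕ.* a ℕ.+ b ≡ a ℕ.+ b ℕ.+ a
          lem′ = ℕ-Solver.solve-∀
  AB-true-false K [] = refl
  AB-true-false K (true ∷ us) = AB-false-false (K ∘ (false ∷_)) us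
  AB-true-false K (false ∷ us) = AB-true-false (K ∘ (false ∷_)) us

-- The first cell sets the initial states: a covered cell leads to those of `AB-false-true`, an
-- uncovered one to those of `AB-diagonal`.
opA∘opB : ∀ {n} (K : Vec Bool (suc n) → ℕ) us →
  opA (opB K) false us ≡ 2 ℕ.* opB (opA (K ∘ Vec.map not) false) (Vec.map not us)
opA∘opB K (true ∷ us)  = AB-false-true K us
opA∘opB K (false ∷ us) =
  AB-diagonal K us

transfer : ∀ {n} → (Vec Bool n → ℕ) → Vec Bool n → ℕ
transfer K = opA (opB K) false

opA-* : ∀ {n} c (K : Vec Bool (suc n) → ℕ) b us → opA (λ bs → c ℕ.* K bs) b us ≡ c ℕ.* opA K b us
opA-* c K b     []           = refl
opA-* c K b     (true ∷ us)  = opA-* c (K ∘ (b ∷_)) false us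
opA-* c K false (false ∷ us) = trans
  (cong₂ ℕ._+_ (opA-* c (K ∘ (true ∷_)) false us) (opA-* c (K ∘ (false ∷_)) true us))
  (sym (ℕ.*-distribˡ-+ c (opA (K ∘ (true ∷_)) false us) _))
opA-* c K true  (false ∷ us) = opA-* c (K ∘ (true ∷_)) true us

opB′-* : ∀ {n} c (K : Vec Bool n → ℕ) w bs → opB′ (λ us → c ℕ.* K us) w bs ≡ c ℕ.* opB′ K w bs
opB′-* c K false []           = refl
opB′-* c K true  []           = sym (ℕ.*-zeroʳ c)
opB′-* c K false (true ∷ bs)  = opB′-* c (K ∘ (false ∷_)) false bs
opB′-* c K true  (true ∷ bs)  = opB′-* c (K ∘ (true ∷_)) false bs
opB′-* c K false (false ∷ bs) = trans
  (cong₂ ℕ._+_ (opB′-* c (K ∘ (true ∷_)) false bs) (opB′-* c (K ∘ (false ∷_)) true bs))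
  (sym (ℕ.*-distribˡ-+ c (opB′ (K ∘ (true ∷_)) false bs) _))
opB′-* c K true  (false ∷ bs) = opB′-* c (K ∘ (true ∷_)) true bs

opB-* : ∀ {n} c (K : Vec Bool n → ℕ) bs → opB (λ us → c ℕ.* K us) bs ≡ c ℕ.* opB K bs
opB-* c K (b ∷ bs) = opB′-* c K (not b) bs

-- Iterating the exchange

transfers : ∀ {n} → ℕ → (Vec Bool n → ℕ) → Vec Bool n → ℕ
transfers zero    K = K
transfers (suc k) K = transfer (transfers k K)

-- With N for the complement, AB = 2 N B A N. In a power the inner complements cancel, so (AB)^(k+1)
-- = 2^(k+1) N B (AB)^k A N, and the inner power acts on rows that are shorter by one.
transfers-suc : ∀ {n} k (K : Vec Bool (suc n) → ℕ) us → transfers (suc k) K us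
              ≡ 2 ℕ.^ suc k ℕ.* opB (transfers k (opA (K ∘ Vec.map not) false)) (Vec.map not us)
transfers-suc zero    K us = opA∘opB K us
transfers-suc (suc k) K us = begin
  transfer (transfers (suc k) K) us
    ≡⟨ opA-cong (opB-cong (transfers-suc k K)) false us ⟩
  transfer (λ vs → 2 ℕ.^ suc k ℕ.* L (Vec.map not vs)) us
    ≡⟨ opA-cong (opB-* (2 ℕ.^ suc k) (L ∘ Vec.map not)) false us ⟩
  opA (λ bs → 2 ℕ.^ suc k ℕ.* opB (L ∘ Vec.map not) bs) false us
    ≡⟨ opA-* (2 ℕ.^ suc k) (opB (L ∘ Vec.map not)) false us ⟩
  2 ℕ.^ suc k ℕ.* transfer (L ∘ Vec.map not) us
    ≡⟨ cong (2 ℕ.^ suc k ℕ.*_) (opA∘opB (L ∘ Vec.map not) us) ⟩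
  2 ℕ.^ suc k ℕ.* (2 ℕ.* opB (opA (L ∘ Vec.map not ∘ Vec.map not) false) (Vec.map not us))
    ≡⟨ cong (λ z → 2 ℕ.^ suc k ℕ.* (2 ℕ.* z))
         (opB-cong (opA-cong (λ vs → cong L (map-not-not vs)) false) (Vec.map not us)) ⟩
  2 ℕ.^ suc k ℕ.* (2 ℕ.* opB (opA L false) (Vec.map not us))
    ≡⟨ lem (2 ℕ.^ suc k) _ ⟩
  2 ℕ.^ suc (suc k) ℕ.* opB (opA L false) (Vec.map not us) ∎
  where
  open ≡-Reasoning
  L = opB (transfers k (opA (K ∘ Vec.map not) false))
  lem : ∀ a b → a ℕ.* (2 ℕ.* b) ≡ 2 ℕ.* a ℕ.* b
  lem = ℕ-Solver.solve-∀
  map-not-not : ∀ {n} (vs : Vec Bool n) → Vec.map not (Vec.map not vs) ≡ vs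
  map-not-not []       = refl
  map-not-not (v ∷ vs) = cong₂ _∷_ (not-involutive v) (map-not-not vs)

full : ∀ {n} → Vec Bool n → ℕ
full []           = 1
full (true ∷ us)  = full us
full (false ∷ us) = 0

-- An uncovered cell would cover a cell of the next row, whereas `full ∘ Vec.map not` requires that
-- row to be empty.
opA-full : ∀ {n} (us : Vec Bool n) → opA (full ∘ Vec.map not) false us ≡ full us
opA-full []           = refl
opA-full (true ∷ us)  = opA-full us
opA-full (false ∷ us) = trans (cong₂ ℕ._+_ (opA-0 (λ _ → refl) false us) (carry us)) refl
  where
  opA-0 : ∀ {n} {K : Vec Bool (suc n) → ℕ} → (∀ bs → K bs ≡ 0) → ∀ b us → opA K b us ≡ 0
  opA-0 K≡0 b us = trans (opA-cong K≡0 b us) (opA-* 0 (λ _ → 0) b us)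
  carry : ∀ {n} (us : Vec Bool n) → opA (full ∘ Vec.map not) true us ≡ 0
  carry []           = refl
  carry (true ∷ us)  = opA-0 (λ _ → refl) false us
  carry (false ∷ us) = opA-0 (λ _ → refl) true us

opB′-full : ∀ {n} (K : Vec Bool n → ℕ) → opB′ K false (replicate n true) ≡ K (replicate n false)
opB′-full {zero}  K = refl
opB′-full {suc n} K = opB′-full (K ∘ (false ∷_))

transfers-cong : ∀ {n} k {K L : Vec Bool n → ℕ} → K ≗ L → transfers k K ≗ transfers k L
transfers-cong zero    K≗L    = K≗L
transfers-cong (suc k) K≗L us = opA-cong (opB-cong (transfers-cong k K≗L)) false us

-- The boundary conditions become those of the smaller diamond: the complement of the empty row is
-- full and passes nothing on, so the inner power starts again from an empty row, and `opA-full`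
-- restores `full` at the other end.
transfers-full : ∀ n → transfers n full (replicate n false) ≡ 2 ℕ.^ triangle n
transfers-full zero    = refl
transfers-full (suc n) = begin
  transfers (suc n) full (replicate (suc n) false)
    ≡⟨ transfers-suc n full (replicate (suc n) false) ⟩
  2 ℕ.^ suc n ℕ.* opB (transfers n (opA (full ∘ Vec.map not) false)) (Vec.map not (replicate (suc n) false))
    ≡⟨ cong (λ bs → 2 ℕ.^ suc n ℕ.* opB (transfers n (opA (full ∘ Vec.map not) false)) bs)
         (map-replicate not false (suc n)) ⟩
  2 ℕ.^ suc n ℕ.* opB′ (transfers n (opA (full ∘ Vec.map not) false)) false (replicate n true)
    ≡⟨ cong (2 ℕ.^ suc n ℕ.*_) (opB′-full {n} _) ⟩
  2 ℕ.^ suc n ℕ.* transfers n (opA (full ∘ Vec.map not) false) (replicate n false)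
    ≡⟨ cong (2 ℕ.^ suc n ℕ.*_) (transfers-cong n opA-full (replicate n false)) ⟩
  2 ℕ.^ suc n ℕ.* transfers n full (replicate n false)
    ≡⟨ cong (2 ℕ.^ suc n ℕ.*_) (transfers-full n) ⟩
  2 ℕ.^ suc n ℕ.* 2 ℕ.^ triangle n
    ≡⟨ ℕ.^-distribˡ-+-* 2 (suc n) (triangle n) ⟨
  2 ℕ.^ triangle (suc n) ∎
  where open ≡-Reasoning

-- Exact covers

-- Used both for dominoes on squares of the plane and for edges on cells of the row model, with
-- `tilings-map` between the two.
module ExactCover {E Q : Set} (_≟_ : DecidableEquality Q) (ends : E → List Q) (qs : List Q) where

  Coverage : Set
  Coverage = Q → ℕ

  incidence : E → Coverage
  incidence e q = if does (mem? _≟_ q (ends e)) then 1 else 0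

  infixl 6 _⊞_
  _⊞_ : Coverage → E → Coverage
  (c ⊞ e) q = c q ℕ.+ incidence e q

  tilings : List E → Coverage → ℕ
  tilings []       c = if does (all? (λ q → c q ℕ.≟ 1) qs) then 1 else 0
  tilings (e ∷ es) c = tilings es (c ⊞ e) ℕ.+ tilings es c

  ⊞-∈ : ∀ c {e q} → q ∈ ends e → (c ⊞ e) q ≡ suc (c q)
  ⊞-∈ c {e} {q} q∈e with mem? _≟_ q (ends e)
  ... | yes _  = ℕ.+-comm (c q) 1
  ... | no q∉e = ⊥-elim (q∉e q∈e)

  ⊞-∉ : ∀ c {e q} → q ∉ ends e → (c ⊞ e) q ≡ c q
  ⊞-∉ c {e} {q} q∉e with mem? _≟_ q (ends e)
  ... | yes q∈e = ⊥-elim (q∉e q∈e)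
  ... | no _    = ℕ.+-identityʳ (c q)

  tilings-[]-complete : ∀ {c} → All (λ q → c q ≡ 1) qs → tilings [] c ≡ 1
  tilings-[]-complete {c} all with all? (λ q → c q ℕ.≟ 1) qs
  ... | yes _   = refl
  ... | no ¬all = ⊥-elim (¬all all)

  tilings-[]-incomplete : ∀ {c q} → q ∈ qs → c q ≢ 1 → tilings [] c ≡ 0
  tilings-[]-incomplete {c} q∈qs cq≢1 with all? (λ q → c q ℕ.≟ 1) qs
  ... | yes all = ⊥-elim (cq≢1 (All.lookup all q∈qs))
  ... | no _    = refl

  tilings-cong : ∀ es {c d} → c ≗ d → tilings es c ≡ tilings es d
  tilings-cong [] {c} {d} c≗d with all? (λ q → c q ℕ.≟ 1) qs | all? (λ q → d q ℕ.≟ 1) qs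
  ... | yes _ | yes _ = refl
  ... | no _  | no _  = refl
  ... | yes a | no ¬a = ⊥-elim (¬a (All.map (trans (sym (c≗d _))) a))
  ... | no ¬a | yes a = ⊥-elim (¬a (All.map (trans (c≗d _)) a))
  tilings-cong (e ∷ es) c≗d =
    cong₂ ℕ._+_ (tilings-cong es λ q → cong (ℕ._+ incidence e q) (c≗d q)) (tilings-cong es c≗d)

  -- Allows the pieces to be listed in the order of the sweep. Swapping two neighbours only permutes
  -- four summands, because coverages add commutatively.
  tilings-↭ : ∀ {es fs} → es ↭ fs → ∀ c → tilings es c ≡ tilings fs c
  tilings-↭ ↭.refl         c = refl
  tilings-↭ (↭.prep e p)   c = cong₂ ℕ._+_ (tilings-↭ p (c ⊞ e)) (tilings-↭ p c)
  tilings-↭ (↭.swap {es} {fs} e f p) c = begin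
    tilings es (c ⊞ e ⊞ f) ℕ.+ tilings es (c ⊞ e) ℕ.+ (tilings es (c ⊞ f) ℕ.+ tilings es c)
      ≡⟨ +-interchange (tilings es (c ⊞ e ⊞ f)) _ _ _ ⟩
    tilings es (c ⊞ e ⊞ f) ℕ.+ tilings es (c ⊞ f) ℕ.+ (tilings es (c ⊞ e) ℕ.+ tilings es c)
      ≡⟨ cong₂ ℕ._+_ (cong₂ ℕ._+_
           (trans (tilings-cong es (λ q → +-swap (c q) (incidence e q) (incidence f q))) (tilings-↭ p _))
           (tilings-↭ p _)) (cong₂ ℕ._+_ (tilings-↭ p _) (tilings-↭ p _)) ⟩
    tilings fs (c ⊞ f ⊞ e) ℕ.+ tilings fs (c ⊞ f) ℕ.+ (tilings fs (c ⊞ e) ℕ.+ tilings fs c) ∎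
    where
    open ≡-Reasoning
    +-swap : ∀ a b d → a ℕ.+ b ℕ.+ d ≡ a ℕ.+ d ℕ.+ b
    +-swap a b d = trans (ℕ.+-assoc a b d) (trans (cong (a ℕ.+_) (ℕ.+-comm b d)) (sym (ℕ.+-assoc a d b)))
  tilings-↭ (↭.trans p p′) c = trans (tilings-↭ p c) (tilings-↭ p′ c)

  tilings-over : ∀ es {c q} → q ∈ qs → 2 ≤ c q → tilings es c ≡ 0
  tilings-over []       q∈qs 2≤c = tilings-[]-incomplete q∈qs λ cq≡1 → ℕ.<⇒≢ 2≤c (sym cq≡1)
  tilings-over (e ∷ es) q∈qs 2≤c = cong₂ ℕ._+_
    (tilings-over es q∈qs (ℕ.≤-trans 2≤c (ℕ.m≤m+n _ _))) (tilings-over es q∈qs 2≤c)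

  tilings-under : ∀ {es c q} → q ∈ qs → c q ≡ 0 → All (λ e → q ∉ ends e) es → tilings es c ≡ 0
  tilings-under {[]}     q∈qs cq≡0 []           =
    tilings-[]-incomplete q∈qs λ cq≡1 → ℕ.0≢1+n (trans (sym cq≡0) cq≡1)
  tilings-under {e ∷ es} {c} q∈qs cq≡0 (q∉e ∷ q∉es) = cong₂ ℕ._+_
    (tilings-under q∈qs (trans (⊞-∉ c q∉e) cq≡0) q∉es) (tilings-under q∈qs cq≡0 q∉es)

  module _ {es : List E} {c : Coverage} {q : Q} (q∈qs : q ∈ qs) where

    private
      over : ∀ {d} e → q ∈ ends e → 1 ≤ d q → tilings es (d ⊞ e) ≡ 0
      over {d} e q∈e 1≤d = tilings-over es q∈qs (ℕ.≤-trans (s≤s 1≤d) (ℕ.≤-reflexive (sym (⊞-∈ d {e} q∈e))))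

    skip : ∀ e → q ∈ ends e → c q ≡ 1 → tilings (e ∷ es) c ≡ tilings es c
    skip e q∈e cq≡1 = cong (ℕ._+ tilings es c) (over e q∈e (ℕ.≤-reflexive (sym cq≡1)))

    pick : ∀ e → q ∈ ends e → All (λ e → q ∉ ends e) es → c q ≡ 0 → tilings (e ∷ es) c ≡ tilings es (c ⊞ e)
    pick e q∈e q∉es cq≡0 = trans (cong (tilings es (c ⊞ e) ℕ.+_) (tilings-under q∈qs cq≡0 q∉es)) (ℕ.+-identityʳ _)

    skip₂ : ∀ e f → q ∈ ends e → q ∈ ends f → c q ≡ 1 → tilings (e ∷ f ∷ es) c ≡ tilings es c
    skip₂ e f q∈e q∈f cq≡1 = cong₂ ℕ._+_
      (cong₂ ℕ._+_ (over f q∈f (ℕ.≤-trans 1≤c (ℕ.m≤m+n (c q) (incidence e q)))) (over e q∈e 1≤c))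
      (skip f q∈f cq≡1)
      where 1≤c = ℕ.≤-reflexive (sym cq≡1)

    -- Taking both pieces covers `q` twice, and taking neither leaves it uncovered for good, so
    -- exactly one is taken.
    pick₂ : ∀ e f → q ∈ ends e → q ∈ ends f → All (λ e → q ∉ ends e) es → c q ≡ 0 →
            tilings (e ∷ f ∷ es) c ≡ tilings es (c ⊞ e) ℕ.+ tilings es (c ⊞ f)
    pick₂ e f q∈e q∈f q∉es cq≡0 = cong₂ ℕ._+_
      (cong (ℕ._+ tilings es (c ⊞ e)) (over f q∈f (ℕ.≤-reflexive (sym (trans (⊞-∈ c {e} q∈e) (cong suc cq≡0))))))
      (pick f q∈f q∉es cq≡0)

  covers : Q → List E → List E
  covers q = filter (λ e → mem? _≟_ q (ends e))

  length-covers : ∀ q e t → length (covers q (e ∷ t)) ≡ incidence e q ℕ.+ length (covers q t)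
  length-covers q e t with mem? _≟_ q (ends e)
  ... | yes _ = refl
  ... | no _  = refl

  -- The coverage `c` stands for the pieces already taken; keeping it general lets the induction
  -- absorb each further piece into it.
  count-sublists : ∀ es c →
    count (λ t → all? (λ q → c q ℕ.+ length (covers q t) ℕ.≟ 1) qs) (sublists es) ≡ tilings es c
  count-sublists [] c with all? (λ q → c q ℕ.+ 0 ℕ.≟ 1) qs | all? (λ q → c q ℕ.≟ 1) qs
  ... | yes _ | yes _ = refl
  ... | no _  | no _  = refl
  ... | yes a | no ¬a = ⊥-elim (¬a (All.map (λ {q} → trans (sym (ℕ.+-identityʳ (c q)))) a))
  ... | no ¬a | yes a = ⊥-elim (¬a (All.map (λ {q} → trans (ℕ.+-identityʳ (c q))) a))
  count-sublists (e ∷ es) c = trans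
    (count-++ _ (map (e ∷_) (sublists es)) (sublists es))
    (cong₂ ℕ._+_
      (trans (count-map _ _ (e ∷_)
               (λ t → All.map (λ {q} → trans (sym (shift q t))))
               (λ t → All.map (λ {q} → trans (shift q t))) (sublists es))
             (count-sublists es (c ⊞ e)))
      (count-sublists es c))
    where
    shift : ∀ q t → c q ℕ.+ length (covers q (e ∷ t)) ≡ (c ⊞ e) q ℕ.+ length (covers q t)
    shift q t = trans (cong (c q ℕ.+_) (length-covers q e t)) (sym (ℕ.+-assoc (c q) (incidence e q) _))

module _ {E Q E′ Q′ : Set} {_≟_ : DecidableEquality Q} {_≟′_ : DecidableEquality Q′}
         {ends : E → List Q} {ends′ : E′ → List Q′} {qs : List Q} {qs′ : List Q′}
         (φ : E → E′) (ψ : Q → Q′) where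

  private
    module X = ExactCover _≟_ ends qs
    module Y = ExactCover _≟′_ ends′ qs′

  -- Every position to be covered in the target is an image under `ψ`, so coverages that correspond
  -- along `ψ` pass the final test together.
  tilings-map : (∀ {p q} → ψ p ≡ ψ q → p ≡ q) → (∀ e → ends′ (φ e) ≡ map ψ (ends e)) →
    (∀ {q} → q ∈ qs → ψ q ∈ qs′) → (∀ {q′} → q′ ∈ qs′ → q′ ∈ map ψ qs) →
    ∀ es {c c′} → (∀ q → c′ (ψ q) ≡ c q) → Y.tilings (map φ es) c′ ≡ X.tilings es c
  tilings-map ψ-inj ends-φ qs⊆qs′ qs′⊆qs = go
    where
    same : ∀ e q → Y.incidence (φ e) (ψ q) ≡ X.incidence e q
    same e q with mem? _≟′_ (ψ q) (ends′ (φ e)) | mem? _≟_ q (ends e)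
    ... | yes _  | yes _  = refl
    ... | no _   | no _   = refl
    ... | yes m′ | no ¬m  = ⊥-elim (¬m (∈-map-injective (subst (ψ q ∈_) (ends-φ e) m′)))
      where
      ∈-map-injective : ∀ {qs} → ψ q ∈ map ψ qs → q ∈ qs
      ∈-map-injective {_ ∷ _} (here eq) = here (ψ-inj eq)
      ∈-map-injective {_ ∷ _} (there m) = there (∈-map-injective m)
    ... | no ¬m′ | yes m  = ⊥-elim (¬m′ (subst (ψ q ∈_) (sym (ends-φ e)) (∈-map m)))
      where
      ∈-map : ∀ {qs} → q ∈ qs → ψ q ∈ map ψ qs
      ∈-map (here eq) = here (cong ψ eq)
      ∈-map (there m) = there (∈-map m)
    go : ∀ es {c c′} → (∀ q → c′ (ψ q) ≡ c q) → Y.tilings (map φ es) c′ ≡ X.tilings es c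
    go [] {c} {c′} c′≡c with all? (λ q → c′ q ℕ.≟ 1) qs′ | all? (λ q → c q ℕ.≟ 1) qs
    ... | yes _ | yes _ = refl
    ... | no _  | no _  = refl
    ... | yes a | no ¬a = ⊥-elim (¬a (All.tabulate λ q∈ → trans (sym (c′≡c _)) (All.lookup a (qs⊆qs′ q∈))))
    ... | no ¬a | yes a = ⊥-elim (¬a (All.tabulate λ q∈ →
            All.lookup (All.map⁺ (All.map (λ {q} → trans (c′≡c q)) a)) (qs′⊆qs q∈)))
    go (e ∷ es) c′≡c = cong₂ ℕ._+_
      (go es λ q → cong₂ ℕ._+_ (c′≡c q) (same e q)) (go es c′≡c)

-- Tilings of the rotated diamond

-- The diagonals x + y = const of the diamond are rows W 0, B 0, W 1, …, B (n - 1),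
-- W n of alternately n and n + 1 squares; consecutive rows form a zigzag path.
data Cell : Set where
  W B : ℕ → ℕ → Cell

_≟ᶜ_ : DecidableEquality Cell
W i j ≟ᶜ W k l = map′ (λ { (refl , refl) → refl }) (λ { refl → refl , refl }) (i ℕ.≟ k ×-dec j ℕ.≟ l)
W i j ≟ᶜ B k l = no λ ()
B i j ≟ᶜ W k l = no λ ()
B i j ≟ᶜ B k l = map′ (λ { (refl , refl) → refl }) (λ { refl → refl , refl }) (i ℕ.≟ k ×-dec j ℕ.≟ l)

data Edge : Set where
  WB WB⁺ BW B⁺W : ℕ → ℕ → Edge

ends : Edge → List Cell
ends (WB  i j) = W i j ∷ B i j ∷ []
ends (WB⁺ i j) = W i j ∷ B i (suc j) ∷ []
ends (BW  i j) = B i j ∷ W (suc i) j ∷ []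
ends (B⁺W i j) = B i (suc j) ∷ W (suc i) j ∷ []

cells : ℕ → List Cell
cells n = cartesianProductWith W (upTo (suc n)) (upTo n) ++ cartesianProductWith B (upTo n) (upTo (suc n))

data Valid (n : ℕ) : Cell → Set where
  validW : ∀ {i j} → i ≤ n → j < n → Valid n (W i j)
  validB : ∀ {i j} → i < n → j ≤ n → Valid n (B i j)

Valid⇒∈ : ∀ {n q} → Valid n q → q ∈ cells n
Valid⇒∈ (validW i≤n j<n) = ∈-++⁺ˡ (∈-cartesianProductWith⁺ W (∈-upTo⁺ (s≤s i≤n)) (∈-upTo⁺ j<n))
Valid⇒∈ {n} (validB i<n j≤n) = ∈-++⁺ʳ (cartesianProductWith W (upTo (suc n)) (upTo n))
  (∈-cartesianProductWith⁺ B (∈-upTo⁺ i<n) (∈-upTo⁺ (s≤s j≤n)))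

∈⇒Valid : ∀ {n q} → q ∈ cells n → Valid n q
∈⇒Valid {n} q∈ with ∈-++⁻ (cartesianProductWith W (upTo (suc n)) (upTo n)) q∈
... | inj₁ q∈W with ∈-cartesianProductWith⁻ W (upTo (suc n)) (upTo n) q∈W
...   | _ , _ , i∈ , j∈ , refl = validW (ℕ.≤-pred (∈-upTo⁻ i∈)) (∈-upTo⁻ j∈)
∈⇒Valid {n} q∈ | inj₂ q∈B with ∈-cartesianProductWith⁻ B (upTo n) (upTo (suc n)) q∈B
...   | _ , _ , i∈ , j∈ , refl = validB (∈-upTo⁻ i∈) (ℕ.≤-pred (∈-upTo⁻ j∈))

layerA : ℕ → ℕ → ℕ → List Edge
layerA i j zero    = []
layerA i j (suc r) = WB i j ∷ WB⁺ i j ∷ layerA i (suc j) r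

layerB : ℕ → ℕ → ℕ → List Edge
layerB i j zero    = B⁺W i j ∷ []
layerB i j (suc r) = B⁺W i j ∷ BW i (suc j) ∷ layerB i (suc j) r

-- The order of the sweep: the edges from a cell to the next row are consecutive and are the last
-- ones containing it. `BW i 0` stands alone because the leftmost B-cell has one such edge, like the
-- rightmost, whose edge ends `layerB`. The diamond has order m + 1.
layers : ℕ → ℕ → ℕ → List Edge
layers m i zero    = []
layers m i (suc k) = layerA i 0 (suc m) ++ BW i 0 ∷ layerB i 0 m ++ layers m (suc i) k

layerA-avoids-W : ∀ i j r {l} → l < j → All (λ e → W i l ∉ ends e) (layerA i j r)
layerA-avoids-W i j zero    l<j = []
layerA-avoids-W i j (suc r) l<j =
  (λ { (here refl) → ℕ.<-irrefl refl l<j ; (there (here ())) ; (there (there ())) }) ∷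
  (λ { (here refl) → ℕ.<-irrefl refl l<j ; (there (here ())) ; (there (there ())) }) ∷
  layerA-avoids-W i (suc j) r (ℕ.m≤n⇒m≤1+n l<j)

layerB-avoids-B : ∀ i j r {l} → l ≤ j → All (λ e → B i l ∉ ends e) (layerB i j r)
layerB-avoids-B i j zero    l≤j =
  (λ { (here refl) → ℕ.<-irrefl refl l≤j ; (there (here ())) ; (there (there ())) }) ∷ []
layerB-avoids-B i j (suc r) l≤j =
  (λ { (here refl) → ℕ.<-irrefl refl l≤j ; (there (here ())) ; (there (there ())) }) ∷
  (λ { (here refl) → ℕ.<-irrefl refl l≤j ; (there (here ())) ; (there (there ())) }) ∷
  layerB-avoids-B i (suc j) r (ℕ.m≤n⇒m≤1+n l≤j)

layerA-avoids-B : ∀ i j r {k l} → k < i → All (λ e → B k l ∉ ends e) (layerA i j r)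
layerA-avoids-B i j zero    k<i = []
layerA-avoids-B i j (suc r) k<i =
  (λ { (there (here refl)) → ℕ.<-irrefl refl k<i }) ∷
  (λ { (there (here refl)) → ℕ.<-irrefl refl k<i }) ∷
  layerA-avoids-B i (suc j) r k<i

layerA-avoids-W< : ∀ i j r {k l} → k < i → All (λ e → W k l ∉ ends e) (layerA i j r)
layerA-avoids-W< i j zero    k<i = []
layerA-avoids-W< i j (suc r) k<i =
  (λ { (here refl) → ℕ.<-irrefl refl k<i ; (there (here ())) ; (there (there ())) }) ∷
  (λ { (here refl) → ℕ.<-irrefl refl k<i ; (there (here ())) ; (there (there ())) }) ∷
  layerA-avoids-W< i (suc j) r k<i

layerB-avoids-W : ∀ i j r {k l} → k ≤ i → All (λ e → W k l ∉ ends e) (layerB i j r)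
layerB-avoids-W i j zero    k≤i = (λ { (there (here refl)) → ℕ.<-irrefl refl k≤i }) ∷ []
layerB-avoids-W i j (suc r) k≤i =
  (λ { (there (here refl)) → ℕ.<-irrefl refl k≤i }) ∷
  (λ { (there (here refl)) → ℕ.<-irrefl refl k≤i }) ∷
  layerB-avoids-W i (suc j) r k≤i

layerB-avoids-B< : ∀ i j r {k l} → k < i → All (λ e → B k l ∉ ends e) (layerB i j r)
layerB-avoids-B< i j zero    k<i =
  (λ { (here refl) → ℕ.<-irrefl refl k<i ; (there (here ())) ; (there (there ())) }) ∷ []
layerB-avoids-B< i j (suc r) k<i =
  (λ { (here refl) → ℕ.<-irrefl refl k<i ; (there (here ())) ; (there (there ())) }) ∷
  (λ { (here refl) → ℕ.<-irrefl refl k<i ; (there (here ())) ; (there (there ())) }) ∷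
  layerB-avoids-B< i (suc j) r k<i

layers-avoids-W : ∀ m i k {h l} → h < i → All (λ e → W h l ∉ ends e) (layers m i k)
layers-avoids-W m i zero    h<i = []
layers-avoids-W m i (suc k) h<i = All.++⁺ (layerA-avoids-W< i 0 (suc m) h<i)
  ((λ { (there (here refl)) → ℕ.<-irrefl refl (ℕ.<-trans h<i ℕ.≤-refl) }) ∷
  All.++⁺ (layerB-avoids-W i 0 m (ℕ.<⇒≤ h<i)) (layers-avoids-W m (suc i) k (ℕ.m≤n⇒m≤1+n h<i)))

layers-avoids-B : ∀ m i k {h l} → h < i → All (λ e → B h l ∉ ends e) (layers m i k)
layers-avoids-B m i zero    h<i = []
layers-avoids-B m i (suc k) h<i = All.++⁺ (layerA-avoids-B i 0 (suc m) h<i)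
  ((λ { (here refl) → ℕ.<-irrefl refl h<i ; (there (here ())) ; (there (there ())) }) ∷
  All.++⁺ (layerB-avoids-B< i 0 m h<i) (layers-avoids-B m (suc i) k (ℕ.m≤n⇒m≤1+n h<i)))

bit : Bool → ℕ
bit b = if b then 1 else 0

-- The bridge from coverages to the vectors of the transfer operators; it also records that no cell
-- of the row is covered twice.
Row : (ℕ → ℕ) → ℕ → ∀ {r} → Vec Bool r → Set
Row f j []       = ⊤
Row f j (b ∷ bs) = f j ≡ bit b × Row f (suc j) bs

Row-cong : ∀ {f g} j {r} (bs : Vec Bool r) → (∀ l → j ≤ l → f l ≡ g l) → Row f j bs → Row g j bs
Row-cong j []       f≡g _           = tt
Row-cong j (b ∷ bs) f≡g (fj , row) =
  trans (sym (f≡g j ℕ.≤-refl)) fj , Row-cong (suc j) bs (λ l j<l → f≡g l (ℕ.<⇒≤ j<l)) row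

Row-replicate : ∀ {f} b j r → (∀ {l} → j ≤ l → l < j ℕ.+ r → f l ≡ bit b) → Row f j (replicate r b)
Row-replicate b j zero    f≡b = tt
Row-replicate b j (suc r) f≡b = f≡b ℕ.≤-refl (ℕ.m<m+n j (s≤s z≤n)) ,
  Row-replicate b (suc j) r λ {l} j<l l< → f≡b (ℕ.<⇒≤ j<l) (subst (l <_) (sym (ℕ.+-suc j r)) l<)

Row-lookup : ∀ {f b} j r → Row f j (replicate r b) → ∀ {l} → j ≤ l → l < j ℕ.+ r → f l ≡ bit b
Row-lookup j zero    _          {l} j≤l l< = ⊥-elim (ℕ.<⇒≱ l< (subst (_≤ l) (sym (ℕ.+-identityʳ j)) j≤l))
Row-lookup j (suc r) (fj , row) {l} j≤l l< with ℕ.m≤n⇒m<n∨m≡n j≤l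
... | inj₂ refl = fj
... | inj₁ j<l  = Row-lookup (suc j) r row j<l (subst (l <_) (ℕ.+-suc j r) l<)

-- The sweep over the layers as a product of transfer operators

module _ (m : ℕ) where

  private n = suc m

  open ExactCover _≟ᶜ_ ends (cells n) public

  -- A frame condition: a layer may change the coverage only in row W i from column j on and in row
  -- B h from column l on.
  record AgreeOff (i j h l : ℕ) (c′ c : Coverage) : Set where
    constructor agree
    field
      onW : ∀ {p q} → p ≢ i ⊎ q < j → c′ (W p q) ≡ c (W p q)
      onB : ∀ {p q} → p ≢ h ⊎ q < l → c′ (B p q) ≡ c (B p q)
  open AgreeOff

  agree-refl : ∀ {i j h l c} → AgreeOff i j h l c c
  agree-refl = agree (λ _ → refl) (λ _ → refl)

  agree-trans : ∀ {i j h l c d e} → AgreeOff i (suc j) h (suc l) c d → AgreeOff i j h l d e → AgreeOff i j h l c e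
  agree-trans (agree w b) (agree w′ b′) = agree (λ p → trans (w (weaken p)) (w′ p)) (λ p → trans (b (weaken p)) (b′ p))
    where
    weaken : ∀ {p i q j : ℕ} → p ≢ i ⊎ q < j → p ≢ i ⊎ q < suc j
    weaken (inj₁ p≢i) = inj₁ p≢i
    weaken (inj₂ q<j) = inj₂ (ℕ.m≤n⇒m≤1+n q<j)

  off : ∀ {p i q j : ℕ} → p ≢ i ⊎ q < j → ¬ (p ≡ i × j ≤ q)
  off (inj₁ p≢i) (p≡i , _) = p≢i p≡i
  off (inj₂ q<j) (_ , j≤q) = ℕ.<⇒≱ q<j j≤q

  -- The last hypothesis makes `K` the value of the rest of the sweep. Both sides branch alike at
  -- cell j: a covered cell skips its two edges, an uncovered one takes exactly one of them.
  tilings-layerA : ∀ {r} (us : Vec Bool r) i j b c (K : Vec Bool (suc r) → ℕ) rest →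
    i < n → j ℕ.+ r ≡ n → (∀ l → All (λ e → W i l ∉ ends e) rest) →
    Row (c ∘ W i) j us → c (B i j) ≡ bit b → (∀ l → j < l → c (B i l) ≡ 0) →
    (∀ c′ ts → Row (c′ ∘ W i) j (replicate r true) → Row (c′ ∘ B i) j ts →
       AgreeOff i j i j c′ c → tilings rest c′ ≡ K ts) →
    tilings (layerA i j r ++ rest) c ≡ opA K b us
  tilings-layerA [] i j b c K rest i<n j+r≡n avoid row cb c0 cont =
    cont c (b ∷ []) tt (cb , tt) agree-refl
  tilings-layerA {suc r} (true ∷ us) i j b c K rest i<n j+r≡n avoid (cw , row) cb c0 cont = trans
    (skip₂ {es = layerA i (suc j) r ++ rest} {c = c} (Valid⇒∈ (validW (ℕ.<⇒≤ i<n) j<n)) (WB i j) (WB⁺ i j) (here refl) (here refl) cw)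
    (lemma b cb cont)
    where
    j<n : j < n
    j<n = subst (j <_) j+r≡n (ℕ.m<m+n j (s≤s z≤n))
    lemma : ∀ b → c (B i j) ≡ bit b → (∀ c′ ts → Row (c′ ∘ W i) j (replicate (suc r) true) → Row (c′ ∘ B i) j ts →
       AgreeOff i j i j c′ c → tilings rest c′ ≡ K ts) →
      tilings (layerA i (suc j) r ++ rest) c ≡ opA (K ∘ (b ∷_)) false us
    lemma b cb cont = tilings-layerA us i (suc j) false c (K ∘ (b ∷_)) rest i<n (trans (sym (ℕ.+-suc j r)) j+r≡n) avoid
      row (c0 (suc j) ℕ.≤-refl) (λ l j<l → c0 l (ℕ.<⇒≤ j<l))
      λ c′ ts roww rowb ag → cont c′ (b ∷ ts)
        (trans (onW ag (inj₂ ℕ.≤-refl)) cw , roww)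
        (trans (onB ag (inj₂ ℕ.≤-refl)) cb , rowb)
        (agree-trans ag agree-refl)
  tilings-layerA {suc r} (false ∷ us) i j b c K rest i<n j+r≡n avoid (cw , row) cb c0 cont = trans
    (pick₂ (Valid⇒∈ (validW (ℕ.<⇒≤ i<n) j<n)) (WB i j) (WB⁺ i j) (here refl) (here refl)
      (All.++⁺ (layerA-avoids-W i (suc j) r ℕ.≤-refl) (avoid j)) cw)
    (split b cb)
    where
    j<n : j < n
    j<n = subst (j <_) j+r≡n (ℕ.m<m+n j (s≤s z≤n))
    c₁ = c ⊞ WB i j
    c₂ = c ⊞ WB⁺ i j
    c₁-W : ∀ {p q} → ¬ (p ≡ i × q ≡ j) → c₁ (W p q) ≡ c (W p q)
    c₁-W ne = ⊞-∉ c {WB i j} λ { (here refl) → ne (refl , refl) ; (there (here ())) ; (there (there ())) }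
    c₂-W : ∀ {p q} → ¬ (p ≡ i × q ≡ j) → c₂ (W p q) ≡ c (W p q)
    c₂-W ne = ⊞-∉ c {WB⁺ i j} λ { (here refl) → ne (refl , refl) ; (there (here ())) ; (there (there ())) }
    c₁-B : ∀ {p q} → ¬ (p ≡ i × q ≡ j) → c₁ (B p q) ≡ c (B p q)
    c₁-B ne = ⊞-∉ c {WB i j} λ { (there (here refl)) → ne (refl , refl) }
    c₂-B : ∀ {p q} → ¬ (p ≡ i × q ≡ suc j) → c₂ (B p q) ≡ c (B p q)
    c₂-B ne = ⊞-∉ c {WB⁺ i j} λ { (there (here refl)) → ne (refl , refl) }
    agree₁ : AgreeOff i j i j c₁ c
    agree₁ = agree (λ o → c₁-W λ { (refl , refl) → off o (refl , ℕ.≤-refl) })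
                   (λ o → c₁-B λ { (refl , refl) → off o (refl , ℕ.≤-refl) })
    agree₂ : AgreeOff i j i j c₂ c
    agree₂ = agree (λ o → c₂-W λ { (refl , refl) → off o (refl , ℕ.≤-refl) })
                   (λ o → c₂-B λ { (refl , refl) → off o (refl , ℕ.n≤1+n j) })
    left : ∀ {b b′} → c (B i j) ≡ bit b → suc (bit b) ≡ bit b′ →
           tilings (layerA i (suc j) r ++ rest) c₁ ≡ opA (K ∘ (b′ ∷_)) false us
    left {b} {b′} cb sb = tilings-layerA us i (suc j) false c₁ (K ∘ (b′ ∷_)) rest i<n (trans (sym (ℕ.+-suc j r)) j+r≡n) avoid
      (Row-cong (suc j) us (λ l j<l → sym (c₁-W λ { (_ , refl) → ℕ.<-irrefl refl j<l })) row)
      (trans (c₁-B λ { (_ , ()) }) (c0 (suc j) ℕ.≤-refl))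
      (λ l j<l → trans (c₁-B λ { (_ , refl) → ℕ.<-irrefl refl (ℕ.<⇒≤ j<l) }) (c0 l (ℕ.<⇒≤ j<l)))
      λ c′ ts roww rowb ag → cont c′ (b′ ∷ ts)
        (trans (onW ag (inj₂ ℕ.≤-refl)) (trans (⊞-∈ c {WB i j} (here refl)) (cong suc cw)) , roww)
        (trans (onB ag (inj₂ ℕ.≤-refl)) (trans (⊞-∈ c {WB i j} (there (here refl))) (trans (cong suc cb) sb)) , rowb)
        (agree-trans ag agree₁)
    right : ∀ {b} → c (B i j) ≡ bit b →
           tilings (layerA i (suc j) r ++ rest) c₂ ≡ opA (K ∘ (b ∷_)) true us
    right {b} cb = tilings-layerA us i (suc j) true c₂ (K ∘ (b ∷_)) rest i<n (trans (sym (ℕ.+-suc j r)) j+r≡n) avoid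
      (Row-cong (suc j) us (λ l j<l → sym (c₂-W λ { (_ , refl) → ℕ.<-irrefl refl j<l })) row)
      (trans (⊞-∈ c {WB⁺ i j} (there (here refl))) (cong suc (c0 (suc j) ℕ.≤-refl)))
      (λ l j<l → trans (c₂-B λ { (_ , refl) → ℕ.<-irrefl refl j<l }) (c0 l (ℕ.<⇒≤ j<l)))
      λ c′ ts roww rowb ag → cont c′ (b ∷ ts)
        (trans (onW ag (inj₂ ℕ.≤-refl)) (trans (⊞-∈ c {WB⁺ i j} (here refl)) (cong suc cw)) , roww)
        (trans (onB ag (inj₂ ℕ.≤-refl)) (trans (c₂-B λ { (_ , ()) }) cb) , rowb)
        (agree-trans ag agree₂)
    split : ∀ b → c (B i j) ≡ bit b →
      tilings (layerA i (suc j) r ++ rest) c₁ ℕ.+ tilings (layerA i (suc j) r ++ rest) c₂ ≡ opA K b (false ∷ us)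
    split false cb = cong₂ ℕ._+_ (left cb refl) (right cb)
    -- `WB i j` would cover its B-cell a second time, which is why `opA` has no branch for it.
    split true  cb = cong₂ ℕ._+_
      (tilings-over (layerA i (suc j) r ++ rest) (Valid⇒∈ (validB i<n (ℕ.<⇒≤ j<n)))
        (ℕ.≤-reflexive (sym (trans (⊞-∈ c {WB i j} (there (here refl))) (cong suc cb)))))
      (right cb)

  -- As for the other kind of layer, but the B-row is read from j + 1: the leftmost B-cell has been
  -- treated with `BW i 0`. At r = 0 the last B-cell has a single edge.
  tilings-layerB : ∀ r (bs : Vec Bool (suc r)) i j w c (K : Vec Bool (suc r) → ℕ) rest →
    i < n → j ℕ.+ suc r ≡ n → (∀ l → All (λ e → B i l ∉ ends e) rest) →
    Row (c ∘ B i) (suc j) bs → c (W (suc i) j) ≡ bit w → (∀ l → j < l → c (W (suc i) l) ≡ 0) →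
    (∀ c′ ts → Row (c′ ∘ B i) (suc j) (replicate (suc r) true) → Row (c′ ∘ W (suc i)) j ts →
       AgreeOff (suc i) j i (suc j) c′ c → tilings rest c′ ≡ K ts) →
    tilings (layerB i j r ++ rest) c ≡ opB′ K w bs
  tilings-layerB zero (true ∷ []) i j w c K rest i<n j+r≡n avoid (cb , _) cw c0 cont = trans
    (skip {es = rest} {c = c} (Valid⇒∈ (validB i<n (ℕ.≤-reflexive (trans (ℕ.+-comm 1 j) j+r≡n)))) (B⁺W i j) (here refl) cb)
    (last w cw)
    where
    last : ∀ w → c (W (suc i) j) ≡ bit w → tilings rest c ≡ opB′ K w (true ∷ [])
    last false cw = cont c (false ∷ []) (cb , tt) (cw , tt) agree-refl
    last true  cw = cont c (true ∷ []) (cb , tt) (cw , tt) agree-refl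
  tilings-layerB zero (false ∷ []) i j w c K rest i<n j+r≡n avoid (cb , _) cw c0 cont = trans
    (pick (Valid⇒∈ (validB i<n (ℕ.≤-reflexive (trans (ℕ.+-comm 1 j) j+r≡n)))) (B⁺W i j) (here refl) (avoid (suc j)) cb)
    (last w cw)
    where
    c₁ = c ⊞ B⁺W i j
    c₁-W : c₁ (W (suc i) j) ≡ suc (c (W (suc i) j))
    c₁-W = ⊞-∈ c {B⁺W i j} (there (here refl))
    last : ∀ w → c (W (suc i) j) ≡ bit w → tilings rest c₁ ≡ opB′ K w (false ∷ [])
    last false cw = trans
      (cont c₁ (true ∷ []) (trans (⊞-∈ c {B⁺W i j} (here refl)) (cong suc cb) , tt) (trans c₁-W (cong suc cw) , tt)
        (agree (λ o → ⊞-∉ c {B⁺W i j} λ { (there (here refl)) → off o (refl , ℕ.≤-refl) })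
               (λ o → ⊞-∉ c {B⁺W i j} λ { (here refl) → off o (refl , ℕ.≤-refl) ; (there (here ())) ; (there (there ())) })))
      (sym (ℕ.+-identityʳ _))
    -- The only edge hits a covered cell; this is the value 0 of `opB′` past the end of the row.
    last true cw = tilings-over rest
      (Valid⇒∈ (validW i<n (ℕ.≤-reflexive (trans (ℕ.+-comm 1 j) j+r≡n))))
      (ℕ.≤-reflexive (sym (trans c₁-W (cong suc cw))))
  tilings-layerB (suc r) (true ∷ bs) i j w c K rest i<n j+r≡n avoid (cb , row) cw c0 cont = trans
    (skip₂ {es = layerB i (suc j) r ++ rest} {c = c} (Valid⇒∈ (validB i<n j<n)) (B⁺W i j) (BW i (suc j)) (here refl) (here refl) cb)
    (split w cw)
    where
    j<n : j < n
    j<n = subst (j <_) j+r≡n (ℕ.m<m+n j (s≤s z≤n))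
    next : ∀ w → c (W (suc i) j) ≡ bit w →
      tilings (layerB i (suc j) r ++ rest) c ≡ opB′ (K ∘ (w ∷_)) false bs
    next w cw = tilings-layerB r bs i (suc j) false c (K ∘ (w ∷_)) rest i<n (trans (sym (ℕ.+-suc j (suc r))) j+r≡n) avoid
      row (c0 (suc j) ℕ.≤-refl) (λ l j<l → c0 l (ℕ.<⇒≤ j<l))
      λ c′ ts rowb roww ag → cont c′ (w ∷ ts)
        (trans (onB ag (inj₂ ℕ.≤-refl)) cb , rowb)
        (trans (onW ag (inj₂ ℕ.≤-refl)) cw , roww)
        (agree-trans ag agree-refl)
    split : ∀ w → c (W (suc i) j) ≡ bit w →
      tilings (layerB i (suc j) r ++ rest) c ≡ opB′ K w (true ∷ bs)
    split false cw = next false cw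
    split true  cw = next true cw
  tilings-layerB (suc r) (false ∷ bs) i j w c K rest i<n j+r≡n avoid (cb , row) cw c0 cont = trans
    (pick₂ (Valid⇒∈ (validB i<n j<n)) (B⁺W i j) (BW i (suc j)) (here refl) (here refl)
      (All.++⁺ (layerB-avoids-B i (suc j) r ℕ.≤-refl) (avoid (suc j))) cb)
    (split w cw)
    where
    j<n : j < n
    j<n = subst (j <_) j+r≡n (ℕ.m<m+n j (s≤s z≤n))
    c₁ = c ⊞ B⁺W i j
    c₂ = c ⊞ BW i (suc j)
    c₁-B : ∀ {p q} → ¬ (p ≡ i × q ≡ suc j) → c₁ (B p q) ≡ c (B p q)
    c₁-B ne = ⊞-∉ c {B⁺W i j} λ { (here refl) → ne (refl , refl) ; (there (here ())) ; (there (there ())) }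
    c₂-B : ∀ {p q} → ¬ (p ≡ i × q ≡ suc j) → c₂ (B p q) ≡ c (B p q)
    c₂-B ne = ⊞-∉ c {BW i (suc j)} λ { (here refl) → ne (refl , refl) ; (there (here ())) ; (there (there ())) }
    c₁-W : ∀ {p q} → ¬ (p ≡ suc i × q ≡ j) → c₁ (W p q) ≡ c (W p q)
    c₁-W ne = ⊞-∉ c {B⁺W i j} λ { (there (here refl)) → ne (refl , refl) }
    c₂-W : ∀ {p q} → ¬ (p ≡ suc i × q ≡ suc j) → c₂ (W p q) ≡ c (W p q)
    c₂-W ne = ⊞-∉ c {BW i (suc j)} λ { (there (here refl)) → ne (refl , refl) }
    agree₁ : AgreeOff (suc i) j i (suc j) c₁ c
    agree₁ = agree (λ o → c₁-W λ { (refl , refl) → off o (refl , ℕ.≤-refl) })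
                   (λ o → c₁-B λ { (refl , refl) → off o (refl , ℕ.≤-refl) })
    agree₂ : AgreeOff (suc i) j i (suc j) c₂ c
    agree₂ = agree (λ o → c₂-W λ { (refl , refl) → off o (refl , ℕ.n≤1+n j) })
                   (λ o → c₂-B λ { (refl , refl) → off o (refl , ℕ.≤-refl) })
    left : ∀ {w w′} → c (W (suc i) j) ≡ bit w → suc (bit w) ≡ bit w′ →
           tilings (layerB i (suc j) r ++ rest) c₁ ≡ opB′ (K ∘ (w′ ∷_)) false bs
    left {w} {w′} cw sw = tilings-layerB r bs i (suc j) false c₁ (K ∘ (w′ ∷_)) rest i<n (trans (sym (ℕ.+-suc j (suc r))) j+r≡n) avoid
      (Row-cong (2 ℕ.+ j) bs (λ l j<l → sym (c₁-B λ { (_ , refl) → ℕ.<-irrefl refl j<l })) row)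
      (trans (c₁-W λ { (_ , ()) }) (c0 (suc j) ℕ.≤-refl))
      (λ l j<l → trans (c₁-W λ { (_ , refl) → ℕ.<-irrefl refl (ℕ.<⇒≤ j<l) }) (c0 l (ℕ.<⇒≤ j<l)))
      λ c′ ts rowb roww ag → cont c′ (w′ ∷ ts)
        (trans (onB ag (inj₂ ℕ.≤-refl)) (trans (⊞-∈ c {B⁺W i j} (here refl)) (cong suc cb)) , rowb)
        (trans (onW ag (inj₂ ℕ.≤-refl)) (trans (⊞-∈ c {B⁺W i j} (there (here refl))) (trans (cong suc cw) sw)) , roww)
        (agree-trans ag agree₁)
    right : ∀ {w} → c (W (suc i) j) ≡ bit w →
           tilings (layerB i (suc j) r ++ rest) c₂ ≡ opB′ (K ∘ (w ∷_)) true bs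
    right {w} cw = tilings-layerB r bs i (suc j) true c₂ (K ∘ (w ∷_)) rest i<n (trans (sym (ℕ.+-suc j (suc r))) j+r≡n) avoid
      (Row-cong (2 ℕ.+ j) bs (λ l j<l → sym (c₂-B λ { (_ , refl) → ℕ.<-irrefl refl j<l })) row)
      (trans (⊞-∈ c {BW i (suc j)} (there (here refl))) (cong suc (c0 (suc j) ℕ.≤-refl)))
      (λ l j<l → trans (c₂-W λ { (_ , refl) → ℕ.<-irrefl refl j<l }) (c0 l (ℕ.<⇒≤ j<l)))
      λ c′ ts rowb roww ag → cont c′ (w ∷ ts)
        (trans (onB ag (inj₂ ℕ.≤-refl)) (trans (⊞-∈ c {BW i (suc j)} (here refl)) (cong suc cb)) , rowb)
        (trans (onW ag (inj₂ ℕ.≤-refl)) (trans (c₂-W λ { (_ , ()) }) cw) , roww)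
        (agree-trans ag agree₂)
    split : ∀ w → c (W (suc i) j) ≡ bit w →
      tilings (layerB i (suc j) r ++ rest) c₁ ℕ.+ tilings (layerB i (suc j) r ++ rest) c₂ ≡ opB′ K w (false ∷ bs)
    split false cw = cong₂ ℕ._+_ (left cw refl) (right cw)
    split true  cw = cong₂ ℕ._+_
      (tilings-over (layerB i (suc j) r ++ rest) (Valid⇒∈ (validW i<n j<n))
        (ℕ.≤-reflexive (sym (trans (⊞-∈ c {B⁺W i j} (there (here refl))) (cong suc cw)))))
      (right cw)

  -- The invariant of the sweep at the start of layer i.
  record Stage (i : ℕ) (u : Vec Bool n) (c : Coverage) : Set where
    field
      W<  : ∀ {p q} → p < i → q < n → c (W p q) ≡ 1
      B<  : ∀ {p q} → p < i → q ≤ n → c (B p q) ≡ 1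
      row : Row (c ∘ W i) 0 u
      W>  : ∀ {p q} → i < p → c (W p q) ≡ 0
      B≥  : ∀ {p q} → i ≤ p → c (B p q) ≡ 0
  open Stage

  full-row : ∀ {f} j {r} (u : Vec Bool r) → Row f j u →
    (full u ≡ 1 × (∀ {l} → j ≤ l → l < j ℕ.+ r → f l ≡ 1)) ⊎
    (full u ≡ 0 × ∃ λ l → l < j ℕ.+ r × f l ≡ 0)
  full-row j []          _          = inj₁ (refl , λ {l} j≤l l< → ⊥-elim (ℕ.<⇒≱ l< (subst (_≤ l) (sym (ℕ.+-identityʳ j)) j≤l)))
  full-row j {suc r} (false ∷ u) (fj , _)   = inj₂ (refl , j , ℕ.m<m+n j (s≤s z≤n) , fj)
  full-row j {suc r} (true ∷ u)  (fj , row) with full-row (suc j) u row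
  ... | inj₂ (full≡0 , l , l< , fl≡0) = inj₂ (full≡0 , l , subst (l <_) (sym (ℕ.+-suc j r)) l< , fl≡0)
  ... | inj₁ (full≡1 , ones) = inj₁ (full≡1 , go)
    where
    go : ∀ {l} → j ≤ l → l < j ℕ.+ suc r → _ ≡ 1
    go {l} j≤l l< with ℕ.m≤n⇒m<n∨m≡n j≤l
    ... | inj₂ refl = fj
    ... | inj₁ j<l  = ones j<l (subst (l <_) (ℕ.+-suc j r) l<)

  -- Each layer is one `transfer`. After the last, every row but W n is complete, so the final test
  -- on the coverage is `full` for that row.
  tilings-layers : ∀ k i u c → i ℕ.+ k ≡ n → Stage i u c → tilings (layers m i k) c ≡ transfers k full u
  tilings-layers zero i u c i+0≡n st with trans (sym (ℕ.+-identityʳ i)) i+0≡n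
  ... | refl with full-row 0 u (row st)
  ... | inj₁ (full≡1 , ones) = trans (tilings-[]-complete (All.tabulate λ q∈ → all (∈⇒Valid q∈))) (sym full≡1)
    where
    all : ∀ {q} → Valid n q → c q ≡ 1
    all (validW p≤n q<n) with ℕ.m≤n⇒m<n∨m≡n p≤n
    ... | inj₁ p<n  = W< st p<n q<n
    ... | inj₂ refl = ones z≤n q<n
    all (validB p<n q≤n) = B< st p<n q≤n
  ... | inj₂ (full≡0 , l , l<n , c≡0) =
    trans (tilings-[]-incomplete (Valid⇒∈ (validW ℕ.≤-refl l<n)) λ c≡1 → ℕ.0≢1+n (trans (sym c≡0) c≡1)) (sym full≡0)
  tilings-layers (suc k) i u c i+k≡n st =
    tilings-layerA u i 0 false c (opB (transfers k full)) rest i<n refl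
      (λ l → (λ { (there (here ())) ; (there (there ())) }) ∷
        All.++⁺ (layerB-avoids-W i 0 m ℕ.≤-refl) (layers-avoids-W m (suc i) k ℕ.≤-refl))
      (row st) (B≥ st ℕ.≤-refl) (λ _ _ → B≥ st ℕ.≤-refl)
      afterA
    where
    i<n : i < n
    i<n = subst (i <_) i+k≡n (ℕ.m<m+n i (s≤s z≤n))
    restB = layerB i 0 m ++ layers m (suc i) k
    rest = BW i 0 ∷ restB
    beyond : ∀ l → All (λ e → B i l ∉ ends e) (layers m (suc i) k)
    beyond l = layers-avoids-B m (suc i) k ℕ.≤-refl

    -- Common to both cases for the leftmost B-cell; `w` records whether `BW i 0` has covered the
    -- first cell of the next row.
    afterB : ∀ w ts d → (∀ {q} → q < n → d (W i q) ≡ 1) → d (B i 0) ≡ 1 → Row (d ∘ B i) 1 ts →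
      d (W (suc i) 0) ≡ bit w → (∀ l → 0 < l → d (W (suc i) l) ≡ 0) →
      (∀ {p q} → p ≢ i → p ≢ suc i → d (W p q) ≡ c (W p q)) → (∀ {p q} → p ≢ i → d (B p q) ≡ c (B p q)) →
      tilings restB d ≡ opB′ (transfers k full) w ts
    afterB w ts d dW dB₀ dB dW₀ dW₊ onW′ onB′ =
      tilings-layerB m ts i 0 w d (transfers k full) (layers m (suc i) k) i<n refl beyond dB dW₀ dW₊
        λ c′ us rowb roww ag → tilings-layers k (suc i) us c′ (trans (sym (ℕ.+-suc i k)) i+k≡n) record
          { W<  = λ p<1+i q<n → trans (onW ag (inj₁ (ℕ.<⇒≢ p<1+i))) (W-done p<1+i q<n)
          ; B<  = λ p<1+i q≤n → B-done ag rowb p<1+i q≤n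
          ; row = roww
          ; W>  = λ 1+i<p → trans (onW ag (inj₁ (≢-sym (ℕ.<⇒≢ 1+i<p))))
                    (trans (onW′ (≢-sym (ℕ.<⇒≢ (ℕ.<⇒≤ 1+i<p))) (≢-sym (ℕ.<⇒≢ 1+i<p))) (W> st (ℕ.<⇒≤ 1+i<p)))
          ; B≥  = λ 1+i≤p → trans (onB ag (inj₁ (≢-sym (ℕ.<⇒≢ 1+i≤p))))
                    (trans (onB′ (≢-sym (ℕ.<⇒≢ 1+i≤p))) (B≥ st (ℕ.<⇒≤ 1+i≤p)))
          }
      where
      W-done : ∀ {p q} → p < suc i → q < n → d (W p q) ≡ 1
      W-done p<1+i q<n with ℕ.m≤n⇒m<n∨m≡n (ℕ.≤-pred p<1+i)
      ... | inj₁ p<i  = trans (onW′ (ℕ.<⇒≢ p<i) (ℕ.<⇒≢ p<1+i)) (W< st p<i q<n)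
      ... | inj₂ refl = dW q<n
      B-done : ∀ {c′ p q} → AgreeOff (suc i) 0 i 1 c′ d → Row (c′ ∘ B i) 1 (replicate n true) →
               p < suc i → q ≤ n → c′ (B p q) ≡ 1
      B-done ag rowb p<1+i q≤n with ℕ.m≤n⇒m<n∨m≡n (ℕ.≤-pred p<1+i)
      ... | inj₁ p<i = trans (onB ag (inj₁ (ℕ.<⇒≢ p<i))) (trans (onB′ (ℕ.<⇒≢ p<i)) (B< st p<i q≤n))
      B-done {q = zero}  ag rowb p<1+i q≤n | inj₂ refl = trans (onB ag (inj₂ (s≤s z≤n))) dB₀
      B-done {q = suc q} ag rowb p<1+i q≤n | inj₂ refl = Row-lookup 1 n rowb (s≤s z≤n) (s≤s q≤n)

    afterA : ∀ c′ ts → Row (c′ ∘ W i) 0 (replicate n true) → Row (c′ ∘ B i) 0 ts →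
      AgreeOff i 0 i 0 c′ c → tilings rest c′ ≡ opB (transfers k full) ts
    afterA c′ (true ∷ ts) roww (cb , rowb) ag = trans
      (skip {es = restB} {c = c′} (Valid⇒∈ (validB i<n z≤n)) (BW i 0) (here refl) cb)
      (afterB false ts c′ (Row-lookup 0 n roww z≤n) cb rowb
        (trans (onW ag (inj₁ λ ())) (W> st ℕ.≤-refl)) (λ l _ → trans (onW ag (inj₁ λ ())) (W> st ℕ.≤-refl))
        (λ p≢i _ → onW ag (inj₁ p≢i)) (λ p≢i → onB ag (inj₁ p≢i)))
    afterA c′ (false ∷ ts) roww (cb , rowb) ag = trans
      (pick (Valid⇒∈ (validB i<n z≤n)) (BW i 0) (here refl)
        (All.++⁺ (layerB-avoids-B i 0 m z≤n) (beyond 0)) cb)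
      (afterB true ts d
        (λ q<n → trans (d-W λ { (() , _) }) (Row-lookup 0 n roww z≤n q<n))
        (trans (⊞-∈ c′ {BW i 0} (here refl)) (cong suc cb))
        (Row-cong 1 ts (λ { (suc l) _ → sym (d-B λ { (_ , ()) }) }) rowb)
        (trans (⊞-∈ c′ {BW i 0} (there (here refl))) (cong suc (trans (onW ag (inj₁ λ ())) (W> st ℕ.≤-refl))))
        (λ { (suc l) _ → trans (d-W λ { (_ , ()) }) (trans (onW ag (inj₁ λ ())) (W> st ℕ.≤-refl)) })
        (λ p≢i p≢1+i → trans (d-W λ { (p≡1+i , _) → p≢1+i p≡1+i }) (onW ag (inj₁ p≢i)))
        (λ p≢i → trans (d-B λ { (p≡i , _) → p≢i p≡i }) (onB ag (inj₁ p≢i))))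
      where
      d = c′ ⊞ BW i 0
      d-W : ∀ {p q} → ¬ (p ≡ suc i × q ≡ 0) → d (W p q) ≡ c′ (W p q)
      d-W ne = ⊞-∉ c′ {BW i 0} λ { (there (here refl)) → ne (refl , refl) }
      d-B : ∀ {p q} → ¬ (p ≡ i × q ≡ 0) → d (B p q) ≡ c′ (B p q)
      d-B ne = ⊞-∉ c′ {BW i 0} λ { (here refl) → ne (refl , refl) ; (there (here ())) ; (there (there ())) }

  tilings-all : tilings (layers m 0 n) (λ _ → 0) ≡ transfers n full (replicate n false)
  tilings-all = tilings-layers n 0 (replicate n false) (λ _ → 0) refl record
    { W<  = λ ()
    ; B<  = λ ()
    ; row = Row-replicate false 0 n λ _ _ → refl
    ; W>  = λ _ → refl
    ; B≥  = λ _ → refl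
    }

-- Geometry of the diamond

data InLayers (n : ℕ) : Edge → Set where
  inWB  : ∀ {i j} → i < n → j < n → InLayers n (WB i j)
  inWB⁺ : ∀ {i j} → i < n → j < n → InLayers n (WB⁺ i j)
  inBW  : ∀ {i j} → i < n → j < n → InLayers n (BW i j)
  inB⁺W : ∀ {i j} → i < n → j < n → InLayers n (B⁺W i j)

layerA-in : ∀ {n} i j r → i < n → j ℕ.+ r ≤ n → All (InLayers n) (layerA i j r)
layerA-in i j zero    i<n j+r≤n = []
layerA-in {n} i j (suc r) i<n j+r≤n = inWB i<n j<n ∷ inWB⁺ i<n j<n ∷ layerA-in i (suc j) r i<n 1+j+r≤n
  where
  1+j+r≤n = subst (_≤ n) (ℕ.+-suc j r) j+r≤n
  j<n = ℕ.≤-trans (s≤s (ℕ.m≤m+n j r)) 1+j+r≤n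

layerB-in : ∀ {n} i j r → i < n → j ℕ.+ r < n → All (InLayers n) (layerB i j r)
layerB-in {n} i j zero    i<n j+r<n = inB⁺W i<n (subst (_< n) (ℕ.+-identityʳ j) j+r<n) ∷ []
layerB-in {n} i j (suc r) i<n j+r<n =
  inB⁺W i<n (ℕ.<⇒≤ 1+j<n) ∷ inBW i<n 1+j<n ∷ layerB-in i (suc j) r i<n 1+j+r<n
  where
  1+j+r<n = subst (_< n) (ℕ.+-suc j r) j+r<n
  1+j<n = ℕ.≤-<-trans (s≤s (ℕ.m≤m+n j r)) 1+j+r<n

layers-in : ∀ m i k → i ℕ.+ k ≤ suc m → All (InLayers (suc m)) (layers m i k)
layers-in m i zero    i+k≤n = []
layers-in m i (suc k) i+k≤n = All.++⁺ (layerA-in i 0 (suc m) i<n ℕ.≤-refl)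
  (inBW i<n (s≤s z≤n) ∷ All.++⁺ (layerB-in i 0 m i<n ℕ.≤-refl) (layers-in m (suc i) k 1+i+k≤n))
  where
  1+i+k≤n = subst (_≤ suc m) (ℕ.+-suc i k) i+k≤n
  i<n = ℕ.≤-trans (s≤s (ℕ.m≤m+n i k)) 1+i+k≤n

layerA-∋ : ∀ i j r {l} → j ≤ l → l < j ℕ.+ r → WB i l ∈ layerA i j r × WB⁺ i l ∈ layerA i j r
layerA-∋ i j zero    {l} j≤l l< = ⊥-elim (ℕ.<⇒≱ l< (subst (_≤ l) (sym (ℕ.+-identityʳ j)) j≤l))
layerA-∋ i j (suc r) {l} j≤l l< with ℕ.m≤n⇒m<n∨m≡n j≤l
... | inj₂ refl = here refl , there (here refl)
... | inj₁ j<l with layerA-∋ i (suc j) r j<l (subst (l <_) (ℕ.+-suc j r) l<)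
...   | p , q = there (there p) , there (there q)

layerB-∋-B⁺W : ∀ i j r {l} → j ≤ l → l ≤ j ℕ.+ r → B⁺W i l ∈ layerB i j r
layerB-∋-B⁺W i j zero    {l} j≤l l≤ with refl ← ℕ.≤-antisym j≤l (subst (l ≤_) (ℕ.+-identityʳ j) l≤) = here refl
layerB-∋-B⁺W i j (suc r) {l} j≤l l≤ with ℕ.m≤n⇒m<n∨m≡n j≤l
... | inj₂ refl = here refl
... | inj₁ j<l  = there (there (layerB-∋-B⁺W i (suc j) r j<l (subst (l ≤_) (ℕ.+-suc j r) l≤)))

layerB-∋-BW : ∀ i j r {l} → j < l → l ≤ j ℕ.+ r → BW i l ∈ layerB i j r
layerB-∋-BW i j zero    {l} j<l l≤ = ⊥-elim (ℕ.<⇒≱ j<l (subst (l ≤_) (ℕ.+-identityʳ j) l≤))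
layerB-∋-BW i j (suc r) {l} j<l l≤ with ℕ.m≤n⇒m<n∨m≡n j<l
... | inj₂ refl  = there (here refl)
... | inj₁ 1+j<l = there (there (layerB-∋-BW i (suc j) r 1+j<l (subst (l ≤_) (ℕ.+-suc j r) l≤)))

layers-∋ : ∀ m i k {h} → i ≤ h → h < i ℕ.+ k →
  ∀ {e} → e ∈ layerA h 0 (suc m) ++ BW h 0 ∷ layerB h 0 m → e ∈ layers m i k
layers-∋ m i zero    {h} i≤h h< e∈ = ⊥-elim (ℕ.<⇒≱ h< (subst (_≤ h) (sym (ℕ.+-identityʳ i)) i≤h))
layers-∋ m i (suc k) {h} i≤h h< e∈ with ℕ.m≤n⇒m<n∨m≡n i≤h
layers-∋ m i (suc k) {h} i≤h h< e∈ | inj₂ refl with ∈-++⁻ (layerA i 0 (suc m)) e∈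
... | inj₁ e∈A         = ∈-++⁺ˡ e∈A
... | inj₂ (here refl) = ∈-++⁺ʳ (layerA i 0 (suc m)) (here refl)
... | inj₂ (there e∈B) = ∈-++⁺ʳ (layerA i 0 (suc m)) (there (∈-++⁺ˡ e∈B))
layers-∋ m i (suc k) {h} i≤h h< e∈ | inj₁ i<h = ∈-++⁺ʳ (layerA i 0 (suc m)) (there (∈-++⁺ʳ (layerB i 0 m)
  (layers-∋ m (suc i) k i<h (subst (h <_) (ℕ.+-suc i k) h<) e∈)))

InLayers⇒∈ : ∀ m {e} → InLayers (suc m) e → e ∈ layers m 0 (suc m)
InLayers⇒∈ m (inWB {i} i<n j<n)  = layers-∋ m 0 (suc m) z≤n i<n (∈-++⁺ˡ (proj₁ (layerA-∋ i 0 (suc m) z≤n j<n)))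
InLayers⇒∈ m (inWB⁺ {i} i<n j<n) = layers-∋ m 0 (suc m) z≤n i<n (∈-++⁺ˡ (proj₂ (layerA-∋ i 0 (suc m) z≤n j<n)))
InLayers⇒∈ m (inBW {i} {zero}  i<n j<n) = layers-∋ m 0 (suc m) z≤n i<n (∈-++⁺ʳ (layerA i 0 (suc m)) (here refl))
InLayers⇒∈ m (inBW {i} {suc j} i<n j<n) = layers-∋ m 0 (suc m) z≤n i<n
  (∈-++⁺ʳ (layerA i 0 (suc m)) (there (layerB-∋-BW i 0 m (s≤s z≤n) (ℕ.≤-pred j<n))))
InLayers⇒∈ m (inB⁺W {i} i<n j<n) = layers-∋ m 0 (suc m) z≤n i<n
  (∈-++⁺ʳ (layerA i 0 (suc m)) (there (layerB-∋-B⁺W i 0 m z≤n (ℕ.≤-pred j<n))))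

-- An edge cannot recur once its cell `q` is avoided by all later edges, so the avoidance lemmas
-- also rule out repetitions.
fresh : ∀ {e q es} → q ∈ ends e → All (λ f → q ∉ ends f) es → All (e ≢_) es
fresh q∈e = All.map λ { q∉f refl → q∉f q∈e }

layerA-unique : ∀ i j r {rest} → (∀ l → All (λ e → W i l ∉ ends e) rest) → Unique rest → Unique (layerA i j r ++ rest)
layerA-unique i j zero    avoid unique = unique
layerA-unique i j (suc r) avoid unique =
  ((λ ()) ∷ fresh (here refl) avoids) ∷ fresh (here refl) avoids ∷ layerA-unique i (suc j) r avoid unique
  where avoids = All.++⁺ (layerA-avoids-W i (suc j) r ℕ.≤-refl) (avoid j)

layerB-unique : ∀ i j r {rest} → (∀ l → All (λ e → B i l ∉ ends e) rest) → Unique rest → Unique (layerB i j r ++ rest)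
layerB-unique i j zero    avoid unique = fresh (here refl) (avoid (suc j)) ∷ unique
layerB-unique i j (suc r) avoid unique =
  ((λ ()) ∷ fresh (here refl) avoids) ∷ fresh (here refl) avoids ∷ layerB-unique i (suc j) r avoid unique
  where avoids = All.++⁺ (layerB-avoids-B i (suc j) r ℕ.≤-refl) (avoid (suc j))

layers-unique : ∀ m i k → Unique (layers m i k)
layers-unique m i zero    = []
layers-unique m i (suc k) = layerA-unique i 0 (suc m)
  (λ l → (λ { (there (here ())) ; (there (there ())) }) ∷
    All.++⁺ (layerB-avoids-W i 0 m ℕ.≤-refl) (layers-avoids-W m (suc i) k ℕ.≤-refl))
  (fresh (here refl) (All.++⁺ (layerB-avoids-B i 0 m z≤n) (layers-avoids-B m (suc i) k ℕ.≤-refl)) ∷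
   layerB-unique i 0 m (λ l → layers-avoids-B m (suc i) k ℕ.≤-refl) (layers-unique m (suc i) k))

i+i≢1 : ∀ i → i ℤ.+ i ≢ 1ℤ
i+i≢1 (+ suc n) eq with ℕ.suc-injective (ℤ.+-injective eq)
... | n+1+n≡0 = ℕ.1+n≢0 (trans (sym (ℕ.+-suc n n)) n+1+n≡0)

+-double-injective : ∀ {i k} → i ℕ.+ i ≡ k ℕ.+ k → i ≡ k
+-double-injective {zero}  {zero}  eq = refl
+-double-injective {suc i} {suc k} eq = cong suc (+-double-injective
  (ℕ.suc-injective (trans (sym (ℕ.+-suc i i)) (trans (ℕ.suc-injective eq) (ℕ.+-suc k k)))))

ℤ-double-injective : ∀ i k → i ℤ.+ i ≡ k ℤ.+ k → i ≡ k
ℤ-double-injective i k eq = ℤ.*-cancelˡ-≡ (+ 2) i k (trans (lem i) (trans eq (sym (lem k))))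
  where
  lem : ∀ i → + 2 ℤ.* i ≡ i ℤ.+ i
  lem = ℤ-Solver.solve-∀

even≢odd : ∀ i k → i ℕ.+ i ≢ suc (k ℕ.+ k)
even≢odd (suc i) k eq = even≢odd k i (sym (trans (sym (ℕ.+-suc i i)) (ℕ.suc-injective eq)))

half : ∀ p → ∃ λ i → p ≡ i ℕ.+ i ⊎ p ≡ suc (i ℕ.+ i)
half zero = 0 , inj₁ refl
half (suc p) with half p
... | i , inj₁ p≡ = i , inj₂ (cong suc p≡)
... | i , inj₂ p≡ = suc i , inj₁ (trans (cong suc p≡) (cong suc (sym (ℕ.+-suc i i))))

-- Squares of the diamond in diagonal coordinates

module _ (n : ℕ) where

  -- Increasing i moves one step right and up, increasing j one step right and down. W i j lies
  -- directly below B i j.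
  square : Cell → Square
  square (W i j) = (+ i ℤ.+ + j ℤ.- + n) , (+ i ℤ.- + suc j)
  square (B i j) = (+ i ℤ.+ + j ℤ.- + n) , (+ i ℤ.- + j)

  domino : Edge → Domino
  domino (WB  i j) = vertical (square (W i j))
  domino (WB⁺ i j) = horizontal (square (W i j))
  domino (BW  i j) = horizontal (square (B i j))
  domino (B⁺W i j) = vertical (square (B i (suc j)))

  squares-domino : ∀ e → squares (domino e) ≡ map square (ends e)
  squares-domino (WB i j) = cong (λ y → square (W i j) ∷ (+ i ℤ.+ + j ℤ.- + n , y) ∷ []) (lem (+ i) (+ j))
    where
    lem : ∀ i j → i ℤ.- (1ℤ ℤ.+ j) ℤ.+ 1ℤ ≡ i ℤ.- j
    lem = ℤ-Solver.solve-∀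
  squares-domino (WB⁺ i j) = cong (λ x → square (W i j) ∷ (x , + i ℤ.- + suc j) ∷ []) (lem (+ i) (+ j) (+ n))
    where
    lem : ∀ i j n → i ℤ.+ j ℤ.- n ℤ.+ 1ℤ ≡ i ℤ.+ (1ℤ ℤ.+ j) ℤ.- n
    lem = ℤ-Solver.solve-∀
  squares-domino (BW i j) = cong₂ (λ x y → square (B i j) ∷ (x , y) ∷ []) (lem (+ i) (+ j) (+ n)) (lem′ (+ i) (+ j))
    where
    lem : ∀ i j n → i ℤ.+ j ℤ.- n ℤ.+ 1ℤ ≡ (1ℤ ℤ.+ i) ℤ.+ j ℤ.- n
    lem = ℤ-Solver.solve-∀
    lem′ : ∀ i j → i ℤ.- j ≡ (1ℤ ℤ.+ i) ℤ.- (1ℤ ℤ.+ j)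
    lem′ = ℤ-Solver.solve-∀
  squares-domino (B⁺W i j) = cong₂ (λ x y → square (B i (suc j)) ∷ (x , y) ∷ []) (lem (+ i) (+ j) (+ n)) (lem′ (+ i) (+ j))
    where
    lem : ∀ i j n → i ℤ.+ (1ℤ ℤ.+ j) ℤ.- n ≡ (1ℤ ℤ.+ i) ℤ.+ j ℤ.- n
    lem = ℤ-Solver.solve-∀
    lem′ : ∀ i j → i ℤ.- (1ℤ ℤ.+ j) ℤ.+ 1ℤ ≡ (1ℤ ℤ.+ i) ℤ.- (1ℤ ℤ.+ j)
    lem′ = ℤ-Solver.solve-∀

  -- Diagonal coordinates of a square, normalised to run from 0 to 2n.
  diag anti : Square → ℤ
  diag (x , y) = x ℤ.+ y ℤ.+ 1ℤ ℤ.+ + n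
  anti (x , y) = x ℤ.- y ℤ.+ + n

  diagᶜ antiᶜ : Cell → ℕ
  diagᶜ (W i j) = i ℕ.+ i
  diagᶜ (B i j) = suc (i ℕ.+ i)
  antiᶜ (W i j) = suc (j ℕ.+ j)
  antiᶜ (B i j) = j ℕ.+ j

  diag-square : ∀ q → diag (square q) ≡ + diagᶜ q
  diag-square (W i j) = lem (+ i) (+ j) (+ n)
    where
    lem : ∀ i j n → (i ℤ.+ j ℤ.- n) ℤ.+ (i ℤ.- (1ℤ ℤ.+ j)) ℤ.+ 1ℤ ℤ.+ n ≡ i ℤ.+ i
    lem = ℤ-Solver.solve-∀
  diag-square (B i j) = lem (+ i) (+ j) (+ n)
    where
    lem : ∀ i j n → (i ℤ.+ j ℤ.- n) ℤ.+ (i ℤ.- j) ℤ.+ 1ℤ ℤ.+ n ≡ 1ℤ ℤ.+ (i ℤ.+ i)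
    lem = ℤ-Solver.solve-∀

  anti-square : ∀ q → anti (square q) ≡ + antiᶜ q
  anti-square (W i j) = lem (+ i) (+ j) (+ n)
    where
    lem : ∀ i j n → (i ℤ.+ j ℤ.- n) ℤ.- (i ℤ.- (1ℤ ℤ.+ j)) ℤ.+ n ≡ 1ℤ ℤ.+ (j ℤ.+ j)
    lem = ℤ-Solver.solve-∀
  anti-square (B i j) = lem (+ i) (+ j) (+ n)
    where
    lem : ∀ i j n → (i ℤ.+ j ℤ.- n) ℤ.- (i ℤ.- j) ℤ.+ n ≡ j ℤ.+ j
    lem = ℤ-Solver.solve-∀

  square-injective : ∀ {p q} → square p ≡ square q → p ≡ q
  square-injective {p} {q} eq = go p q
    (ℤ.+-injective (trans (sym (diag-square p)) (trans (cong diag eq) (diag-square q))))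
    (ℤ.+-injective (trans (sym (anti-square p)) (trans (cong anti eq) (anti-square q))))
    where
    go : ∀ p q → diagᶜ p ≡ diagᶜ q → antiᶜ p ≡ antiᶜ q → p ≡ q
    go (W i j) (W k l) d a = cong₂ W (+-double-injective d) (+-double-injective (ℕ.suc-injective a))
    go (W i j) (B k l) d a = ⊥-elim (even≢odd i k d)
    go (B i j) (W k l) d a = ⊥-elim (even≢odd k i (sym d))
    go (B i j) (B k l) d a = cong₂ B (+-double-injective (ℕ.suc-injective d)) (+-double-injective a)

  -- The two diagonal coordinates determine 2x and 2y.
  diag-anti-injective : ∀ {p q} → diag p ≡ diag q → anti p ≡ anti q → p ≡ q
  diag-anti-injective {x , y} {u , v} d a = cong₂ _,_
    (ℤ-double-injective x u (trans (lem x y (+ n)) (trans (cong₂ (λ d a → d ℤ.+ a ℤ.- 1ℤ ℤ.- (+ n ℤ.+ + n)) d a) (sym (lem u v (+ n))))))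
    (ℤ-double-injective y v (trans (lem′ x y (+ n)) (trans (cong₂ (λ d a → d ℤ.- a ℤ.- 1ℤ) d a) (sym (lem′ u v (+ n))))))
    where
    lem : ∀ x y n → x ℤ.+ x ≡ (x ℤ.+ y ℤ.+ 1ℤ ℤ.+ n) ℤ.+ (x ℤ.- y ℤ.+ n) ℤ.- 1ℤ ℤ.- (n ℤ.+ n)
    lem = ℤ-Solver.solve-∀
    lem′ : ∀ x y n → y ℤ.+ y ≡ (x ℤ.+ y ℤ.+ 1ℤ ℤ.+ n) ℤ.- (x ℤ.- y ℤ.+ n) ℤ.- 1ℤ
    lem′ = ℤ-Solver.solve-∀

  -- Both diagonal coordinates lie between 0 and 2n. Each inequality is given by a natural number
  -- equal to its slack, so that bounds turn into ring identities.
  record Central (q : Square) : Set where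
    field
      {p p′ r r′} : ℕ
      diag≡  : + p ≡ diag q
      diag′≡ : + p′ ≡ + n ℤ.+ + n ℤ.- diag q
      anti≡  : + r ≡ anti q
      anti′≡ : + r′ ≡ + n ℤ.+ + n ℤ.- anti q

  ∣i∣+i : ∀ i → ∃ λ k → + k ≡ + ∣ i ∣ ℤ.+ i
  ∣i∣+i (+ n)    = n ℕ.+ n , refl
  ∣i∣+i -[1+ n ] = 0 , sym (ℤ.n⊖n≡0 (suc n))

  -- ∣a∣ + a and ∣b∣ + b are natural; adding the slack N - ∣a∣ - ∣b∣ gives N + a + b.
  bound⁺ : ∀ {N} a b → ∣ a ∣ ℕ.+ ∣ b ∣ ≤ N → ∃ λ k → + k ≡ + N ℤ.+ a ℤ.+ b
  bound⁺ a b bound with ∣i∣+i a | ∣i∣+i b | ℕ.m≤n⇒∃[o]m+o≡n bound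
  ... | k , k≡ | l , l≡ | e , refl = k ℕ.+ l ℕ.+ e ,
    trans (cong₂ (λ u v → u ℤ.+ v ℤ.+ + e) k≡ l≡) (lem (+ ∣ a ∣) (+ ∣ b ∣) a b (+ e))
    where
    lem : ∀ u v a b e → (u ℤ.+ a) ℤ.+ (v ℤ.+ b) ℤ.+ e ≡ (u ℤ.+ v ℤ.+ e) ℤ.+ a ℤ.+ b
    lem = ℤ-Solver.solve-∀

  flip : ∀ a b {N} → ∣ a ∣ ℕ.+ ∣ b ∣ ≤ N → ∣ ℤ.- a ∣ ℕ.+ ∣ ℤ.- b ∣ ≤ N
  flip a b = subst₂ (λ u v → u ℕ.+ v ≤ _) (sym (ℤ.∣-i∣≡∣i∣ a)) (sym (ℤ.∣-i∣≡∣i∣ b))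

  flipˡ : ∀ a b {N} → ∣ a ∣ ℕ.+ ∣ b ∣ ≤ N → ∣ ℤ.- a ∣ ℕ.+ ∣ b ∣ ≤ N
  flipˡ a b = subst (λ u → u ℕ.+ ∣ b ∣ ≤ _) (sym (ℤ.∣-i∣≡∣i∣ a))

  flipʳ : ∀ a b {N} → ∣ a ∣ ℕ.+ ∣ b ∣ ≤ N → ∣ a ∣ ℕ.+ ∣ ℤ.- b ∣ ≤ N
  flipʳ a b = subst (λ v → ∣ a ∣ ℕ.+ v ≤ _) (sym (ℤ.∣-i∣≡∣i∣ b))

  ∣∣-sign : ∀ i → + ∣ i ∣ ≡ i ⊎ + ∣ i ∣ ≡ ℤ.- i
  ∣∣-sign (+ n)    = inj₁ refl
  ∣∣-sign -[1+ n ] = inj₂ refl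

  -- The signs of a and b select the hypothesis that reads N - ∣a∣ - ∣b∣.
  bound⁻ : ∀ {N} a b {k l g h} → + k ≡ + N ℤ.- a ℤ.- b → + l ≡ + N ℤ.- a ℤ.+ b →
           + g ≡ + N ℤ.+ a ℤ.- b → + h ≡ + N ℤ.+ a ℤ.+ b → ∣ a ∣ ℕ.+ ∣ b ∣ ≤ N
  bound⁻ {N} a b {k} {l} {g} {h} k≡ l≡ g≡ h≡ = go (∣∣-sign a) (∣∣-sign b)
    where
    from : ∀ e → + e ≡ + N ℤ.- + ∣ a ∣ ℤ.- + ∣ b ∣ → ∣ a ∣ ℕ.+ ∣ b ∣ ≤ N
    from e e≡ = subst (∣ a ∣ ℕ.+ ∣ b ∣ ≤_)
      (ℤ.+-injective (trans (cong (λ z → + ∣ a ∣ ℤ.+ + ∣ b ∣ ℤ.+ z) e≡) (lem (+ ∣ a ∣) (+ ∣ b ∣) (+ N)))) (ℕ.m≤m+n _ e)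
      where
      lem : ∀ a b N → a ℤ.+ b ℤ.+ (N ℤ.- a ℤ.- b) ≡ N
      lem = ℤ-Solver.solve-∀
    neg : ∀ {i} → + ∣ i ∣ ≡ ℤ.- i → i ≡ ℤ.- + ∣ i ∣
    neg {i} eq = trans (sym (ℤ.neg-involutive i)) (cong ℤ.-_ (sym eq))
    go : + ∣ a ∣ ≡ a ⊎ + ∣ a ∣ ≡ ℤ.- a → + ∣ b ∣ ≡ b ⊎ + ∣ b ∣ ≡ ℤ.- b → ∣ a ∣ ℕ.+ ∣ b ∣ ≤ N
    go (inj₁ a≡) (inj₁ b≡) = from k (trans k≡ (cong₂ (λ u v → + N ℤ.- u ℤ.- v) (sym a≡) (sym b≡)))
    go (inj₁ a≡) (inj₂ b≡) = from l (trans l≡ (cong₂ (λ u v → + N ℤ.- u ℤ.+ v) (sym a≡) (neg b≡)))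
    go (inj₂ a≡) (inj₁ b≡) = from g (trans g≡ (cong₂ (λ u v → + N ℤ.+ u ℤ.- v) (neg a≡) (sym b≡)))
    go (inj₂ a≡) (inj₂ b≡) = from h (trans h≡ (cong₂ (λ u v → + N ℤ.+ u ℤ.+ v) (neg a≡) (neg b≡)))

  -- Each of the four bounds comes from the vertex that is extreme in its diagonal direction.
  InAD⇒Central : ∀ q → InAD n q → Central q
  InAD⇒Central (x , y) (v₀₀ ∷ v₁₀ ∷ v₀₁ ∷ v₁₁ ∷ []) = record
    { diag≡  = trans (proj₂ (bound⁺ x y v₀₀)) (lem₁ x y (+ n))
    ; diag′≡ = trans (proj₂ (bound⁺ (ℤ.- (x ℤ.+ 1ℤ)) (ℤ.- (y ℤ.+ 1ℤ)) (flip (x ℤ.+ 1ℤ) (y ℤ.+ 1ℤ) v₁₁))) (lem₂ x y (+ n))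
    ; anti≡  = trans (proj₂ (bound⁺ x (ℤ.- (y ℤ.+ 1ℤ)) (flipʳ x (y ℤ.+ 1ℤ) v₀₁))) (lem₃ x y (+ n))
    ; anti′≡ = trans (proj₂ (bound⁺ (ℤ.- (x ℤ.+ 1ℤ)) y (flipˡ (x ℤ.+ 1ℤ) y v₁₀))) (lem₄ x y (+ n))
    }
    where
    lem₁ : ∀ x y n → 1ℤ ℤ.+ n ℤ.+ x ℤ.+ y ≡ x ℤ.+ y ℤ.+ 1ℤ ℤ.+ n
    lem₁ = ℤ-Solver.solve-∀
    lem₂ : ∀ x y n → 1ℤ ℤ.+ n ℤ.+ ℤ.- (x ℤ.+ 1ℤ) ℤ.+ ℤ.- (y ℤ.+ 1ℤ) ≡ n ℤ.+ n ℤ.- (x ℤ.+ y ℤ.+ 1ℤ ℤ.+ n)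
    lem₂ = ℤ-Solver.solve-∀
    lem₃ : ∀ x y n → 1ℤ ℤ.+ n ℤ.+ x ℤ.+ ℤ.- (y ℤ.+ 1ℤ) ≡ x ℤ.- y ℤ.+ n
    lem₃ = ℤ-Solver.solve-∀
    lem₄ : ∀ x y n → 1ℤ ℤ.+ n ℤ.+ ℤ.- (x ℤ.+ 1ℤ) ℤ.+ y ≡ n ℤ.+ n ℤ.- (x ℤ.- y ℤ.+ n)
    lem₄ = ℤ-Solver.solve-∀

  Central⇒InAD : ∀ q → Central q → InAD n q
  Central⇒InAD (x , y) central =
    vertex 0 1 0 1 refl refl (sym (ℤ.+-identityʳ x)) (sym (ℤ.+-identityʳ y)) ∷
    vertex 1 0 0 1 refl refl refl (sym (ℤ.+-identityʳ y)) ∷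
    vertex 0 1 1 0 refl refl (sym (ℤ.+-identityʳ x)) refl ∷
    vertex 1 0 1 0 refl refl refl refl ∷ []
    where
    open Central central
    -- `dx′` and `dy′` are 1 - dx and 1 - dy, which makes the four slacks at the vertex sums of
    -- naturals.
    vertex : ∀ dx dx′ dy dy′ {a b} → dx ℕ.+ dx′ ≡ 1 → dy ℕ.+ dy′ ≡ 1 →
             a ≡ x ℤ.+ + dx → b ≡ y ℤ.+ + dy → ∣ a ∣ ℕ.+ ∣ b ∣ ≤ suc n
    vertex dx dx′ dy dy′ sx sy refl refl = bound⁻ (x ℤ.+ + dx) (y ℤ.+ + dy)
      {p′ ℕ.+ dx′ ℕ.+ dy′} {r′ ℕ.+ dx′ ℕ.+ dy} {r ℕ.+ dx ℕ.+ dy′} {p ℕ.+ dx ℕ.+ dy}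
      (trans (cong₂ (λ u v → u ℤ.+ + dx′ ℤ.+ v) diag′≡ (one- sy))
        (trans (cong (λ u → + n ℤ.+ + n ℤ.- diag (x , y) ℤ.+ u ℤ.+ (1ℤ ℤ.- + dy)) (one- sx)) (lem₁ x y (+ n) (+ dx) (+ dy))))
      (trans (cong₂ (λ u v → u ℤ.+ v ℤ.+ + dy) anti′≡ (one- sx)) (lem₂ x y (+ n) (+ dx) (+ dy)))
      (trans (cong₂ (λ u v → u ℤ.+ + dx ℤ.+ v) anti≡ (one- sy)) (lem₃ x y (+ n) (+ dx) (+ dy)))
      (trans (cong (λ u → u ℤ.+ + dx ℤ.+ + dy) diag≡) (lem₄ x y (+ n) (+ dx) (+ dy)))
      where
      one- : ∀ {d d′} → d ℕ.+ d′ ≡ 1 → + d′ ≡ 1ℤ ℤ.- + d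
      one- {d} {d′} eq = trans (lem (+ d) (+ d′)) (cong (λ z → + z ℤ.- + d) eq)
        where
        lem : ∀ d e → e ≡ d ℤ.+ e ℤ.- d
        lem = ℤ-Solver.solve-∀
      lem₁ : ∀ x y n u v → n ℤ.+ n ℤ.- (x ℤ.+ y ℤ.+ 1ℤ ℤ.+ n) ℤ.+ (1ℤ ℤ.- u) ℤ.+ (1ℤ ℤ.- v)
                         ≡ 1ℤ ℤ.+ n ℤ.- (x ℤ.+ u) ℤ.- (y ℤ.+ v)
      lem₁ = ℤ-Solver.solve-∀
      lem₂ : ∀ x y n u v → n ℤ.+ n ℤ.- (x ℤ.- y ℤ.+ n) ℤ.+ (1ℤ ℤ.- u) ℤ.+ v ≡ 1ℤ ℤ.+ n ℤ.- (x ℤ.+ u) ℤ.+ (y ℤ.+ v)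
      lem₂ = ℤ-Solver.solve-∀
      lem₃ : ∀ x y n u v → x ℤ.- y ℤ.+ n ℤ.+ u ℤ.+ (1ℤ ℤ.- v) ≡ 1ℤ ℤ.+ n ℤ.+ (x ℤ.+ u) ℤ.- (y ℤ.+ v)
      lem₃ = ℤ-Solver.solve-∀
      lem₄ : ∀ x y n u v → x ℤ.+ y ℤ.+ 1ℤ ℤ.+ n ℤ.+ u ℤ.+ v ≡ 1ℤ ℤ.+ n ℤ.+ (x ℤ.+ u) ℤ.+ (y ℤ.+ v)
      lem₄ = ℤ-Solver.solve-∀

  Valid⇒Central : ∀ {q} → Valid n q → Central (square q)
  Valid⇒Central {q} valid = record
    { diag≡  = sym (diag-square q)
    ; diag′≡ = complement (diag-square q) (proj₂ (bounded valid .proj₁))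
    ; anti≡  = sym (anti-square q)
    ; anti′≡ = complement (anti-square q) (proj₂ (bounded valid .proj₂))
    }
    where
    complement : ∀ {z c d} → z ≡ + c → c ℕ.+ d ≡ n ℕ.+ n → + d ≡ + n ℤ.+ + n ℤ.- z
    complement {c = c} {d} refl c+d≡ = trans (lem (+ c) (+ d)) (cong (λ z → + z ℤ.- + c) c+d≡)
      where
      lem : ∀ c d → d ≡ c ℤ.+ d ℤ.- c
      lem = ℤ-Solver.solve-∀
    lem-≤ : ∀ {i} → i ≤ n → ∃ λ d → (i ℕ.+ i) ℕ.+ d ≡ n ℕ.+ n
    lem-≤ i≤n = ℕ.m≤n⇒∃[o]m+o≡n (ℕ.+-mono-≤ i≤n i≤n)
    lem-< : ∀ {i} → i < n → ∃ λ d → suc (i ℕ.+ i) ℕ.+ d ≡ n ℕ.+ n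
    lem-< i<n = ℕ.m≤n⇒∃[o]m+o≡n (ℕ.+-mono-≤ i<n (ℕ.<⇒≤ i<n))
    bounded : ∀ {q} → Valid n q → (∃ λ d → diagᶜ q ℕ.+ d ≡ n ℕ.+ n) × (∃ λ d → antiᶜ q ℕ.+ d ≡ n ℕ.+ n)
    bounded (validW i≤n j<n) = lem-≤ i≤n , lem-< j<n
    bounded (validB i<n j≤n) = lem-< i<n , lem-≤ j≤n

  private
    ≤-from : ∀ {c d z} → + c ≡ z → + d ≡ + n ℤ.+ + n ℤ.- z → c ≤ n ℕ.+ n
    ≤-from {c} {d} refl d≡ = subst (c ≤_)
      (ℤ.+-injective (trans (cong (λ w → + c ℤ.+ w) d≡) (lem (+ c) (+ n)))) (ℕ.m≤m+n c d)
      where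
      lem : ∀ c n → c ℤ.+ (n ℤ.+ n ℤ.- c) ≡ n ℤ.+ n
      lem = ℤ-Solver.solve-∀
    double-≤ : ∀ {i} → i ℕ.+ i ≤ n ℕ.+ n → i ≤ n
    double-≤ i+i≤n+n = ℕ.≮⇒≥ λ n<i → ℕ.<⇒≱ (ℕ.+-mono-< n<i n<i) i+i≤n+n
    double-< : ∀ {i} → i ℕ.+ i < n ℕ.+ n → i < n
    double-< i+i<n+n = ℕ.≰⇒> λ n≤i → ℕ.<⇒≱ i+i<n+n (ℕ.+-mono-≤ n≤i n≤i)

  -- The diagonal coordinates sum to the odd number 2 (x + n) + 1, so exactly one of them is even;
  -- which one decides between W and B.
  Central⇒Valid : ∀ s → Central s → ∃ λ q → Valid n q × s ≡ square q
  Central⇒Valid s@(x , y) central = go (half (Central.p central)) (half (Central.r central))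
    where
    open Central central
    sum≡ : ∀ {a b} → p ≡ a → r ≡ b → + a ℤ.+ + b ℤ.- (x ℤ.+ x ℤ.+ + n ℤ.+ + n) ≡ 1ℤ
    sum≡ refl refl = trans (cong₂ (λ u v → u ℤ.+ v ℤ.- (x ℤ.+ x ℤ.+ + n ℤ.+ + n)) diag≡ anti≡) (lem x y (+ n))
      where
      lem : ∀ x y n → (x ℤ.+ y ℤ.+ 1ℤ ℤ.+ n) ℤ.+ (x ℤ.- y ℤ.+ n) ℤ.- (x ℤ.+ x ℤ.+ n ℤ.+ n) ≡ 1ℤ
      lem = ℤ-Solver.solve-∀
    located : ∀ q → p ≡ diagᶜ q → r ≡ antiᶜ q → s ≡ square q
    located q p≡ r≡ = diag-anti-injective
      (trans (sym diag≡) (trans (cong +_ p≡) (sym (diag-square q))))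
      (trans (sym anti≡) (trans (cong +_ r≡) (sym (anti-square q))))
    p≤ : ∀ {c} → p ≡ c → c ≤ n ℕ.+ n
    p≤ refl = ≤-from diag≡ diag′≡
    r≤ : ∀ {c} → r ≡ c → c ≤ n ℕ.+ n
    r≤ refl = ≤-from anti≡ anti′≡
    go : (∃ λ i → p ≡ i ℕ.+ i ⊎ p ≡ suc (i ℕ.+ i)) → (∃ λ j → r ≡ j ℕ.+ j ⊎ r ≡ suc (j ℕ.+ j)) →
         ∃ λ q → Valid n q × s ≡ square q
    go (i , inj₁ p≡) (j , inj₂ r≡) =
      W i j , validW (double-≤ (p≤ p≡)) (double-< (r≤ r≡)) , located (W i j) p≡ r≡
    go (i , inj₂ p≡) (j , inj₁ r≡) =
      B i j , validB (double-< (p≤ p≡)) (double-≤ (r≤ r≡)) , located (B i j) p≡ r≡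
    go (i , inj₁ p≡) (j , inj₁ r≡) = ⊥-elim (i+i≢1 (+ i ℤ.+ + j ℤ.- x ℤ.- + n)
      (trans (lem (+ i) (+ j) x (+ n)) (sum≡ p≡ r≡)))
      where
      lem : ∀ i j x n → (i ℤ.+ j ℤ.- x ℤ.- n) ℤ.+ (i ℤ.+ j ℤ.- x ℤ.- n)
                      ≡ (i ℤ.+ i) ℤ.+ (j ℤ.+ j) ℤ.- (x ℤ.+ x ℤ.+ n ℤ.+ n)
      lem = ℤ-Solver.solve-∀
    go (i , inj₂ p≡) (j , inj₂ r≡) = ⊥-elim (i+i≢1 (+ i ℤ.+ + j ℤ.- x ℤ.- + n ℤ.+ 1ℤ)
      (trans (lem (+ i) (+ j) x (+ n)) (sum≡ p≡ r≡)))
      where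
      lem : ∀ i j x n → (i ℤ.+ j ℤ.- x ℤ.- n ℤ.+ 1ℤ) ℤ.+ (i ℤ.+ j ℤ.- x ℤ.- n ℤ.+ 1ℤ)
                      ≡ (1ℤ ℤ.+ (i ℤ.+ i)) ℤ.+ (1ℤ ℤ.+ (j ℤ.+ j)) ℤ.- (x ℤ.+ x ℤ.+ n ℤ.+ n)
      lem = ℤ-Solver.solve-∀

  InAD⇒Valid : ∀ s → InAD n s → ∃ λ q → Valid n q × s ≡ square q
  InAD⇒Valid s inAD = Central⇒Valid s (InAD⇒Central s inAD)

  Valid⇒InAD : ∀ {q} → Valid n q → InAD n (square q)
  Valid⇒InAD valid = Central⇒InAD _ (Valid⇒Central valid)

  ∈-range : ∀ {x} → ∣ x ∣ ≤ suc n → ∣ x ℤ.+ 1ℤ ∣ ≤ suc n → x ∈ range n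
  ∈-range {x} ∣x∣≤ ∣x+1∣≤ with bound⁺ x 0ℤ (subst (_≤ suc n) (sym (ℕ.+-identityʳ ∣ x ∣)) ∣x∣≤)
                               | bound⁺ (ℤ.- (x ℤ.+ 1ℤ)) 0ℤ (subst (_≤ suc n)
                                   (sym (trans (ℕ.+-identityʳ _) (ℤ.∣-i∣≡∣i∣ (x ℤ.+ 1ℤ)))) ∣x+1∣≤)
  ... | k , k≡ | l , l≡ = subst (_∈ range n) (trans (cong (ℤ._- + suc n) k≡) (lem x (+ n)))
        (∈-map⁺ (λ i → + i ℤ.- + suc n) (∈-upTo⁺ k<))
    where
    lem : ∀ x n → (1ℤ ℤ.+ n) ℤ.+ x ℤ.+ 0ℤ ℤ.- (1ℤ ℤ.+ n) ≡ x
    lem = ℤ-Solver.solve-∀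
    lem′ : ∀ x n → 1ℤ ℤ.+ ((1ℤ ℤ.+ n) ℤ.+ x ℤ.+ 0ℤ) ℤ.+ ((1ℤ ℤ.+ n) ℤ.+ ℤ.- (x ℤ.+ 1ℤ) ℤ.+ 0ℤ)
                 ≡ (1ℤ ℤ.+ n) ℤ.+ ((1ℤ ℤ.+ n) ℤ.+ 0ℤ)
    lem′ = ℤ-Solver.solve-∀
    -- Here k = n + 1 + x and l = n - x, so 1 + k + l = 2 (n + 1).
    k< : k < 2 ℕ.* suc n
    k< = subst (k <_) (ℤ.+-injective (trans (cong₂ (λ u v → 1ℤ ℤ.+ u ℤ.+ v) k≡ l≡) (lem′ x (+ n)))) (s≤s (ℕ.m≤m+n k l))

  InAD⇒∈ : ∀ {s} → InAD n s → s ∈ squaresAD n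
  InAD⇒∈ {x , y} inAD@(v₀₀ ∷ v₁₀ ∷ v₀₁ ∷ _) = ∈-filter⁺ (inAD? n) (∈-cartesianProduct⁺
    (∈-range (ℕ.m+n≤o⇒m≤o ∣ x ∣ v₀₀) (ℕ.m+n≤o⇒m≤o ∣ x ℤ.+ 1ℤ ∣ v₁₀))
    (∈-range (ℕ.m+n≤o⇒n≤o ∣ x ∣ v₀₀) (ℕ.m+n≤o⇒n≤o ∣ x ∣ v₀₁))) inAD

  ∈⇒InAD : ∀ {s} → s ∈ squaresAD n → InAD n s
  ∈⇒InAD s∈ = proj₂ (∈-filter⁻ (inAD? n) {xs = cartesianProduct (range n) (range n)} s∈)

  candidates : List Domino
  candidates = map horizontal (squaresAD n) ++ map vertical (squaresAD n)

  squares⊆⇒∈ : ∀ d → All (InAD n) (squares d) → d ∈ dominoesAD n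
  squares⊆⇒∈ (horizontal q) all@(inAD ∷ _) = ∈-filter⁺ (λ d → all? (inAD? n) (squares d))
    (∈-++⁺ˡ (∈-map⁺ horizontal (InAD⇒∈ inAD))) all
  squares⊆⇒∈ (vertical q)   all@(inAD ∷ _) = ∈-filter⁺ (λ d → all? (inAD? n) (squares d))
    (∈-++⁺ʳ (map horizontal (squaresAD n)) (∈-map⁺ vertical (InAD⇒∈ inAD))) all

  ∈⇒squares⊆ : ∀ {d} → d ∈ dominoesAD n → All (InAD n) (squares d)
  ∈⇒squares⊆ d∈ = proj₂ (∈-filter⁻ (λ d → all? (inAD? n) (squares d)) {xs = candidates} d∈)

  squaresAD-unique : Unique (squaresAD n)
  squaresAD-unique = Unique.filter⁺ (inAD? n) (Unique.cartesianProduct⁺ range-unique range-unique)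
    where
    lem : ∀ i n → i ℤ.- n ℤ.+ n ≡ i
    lem = ℤ-Solver.solve-∀
    range-unique : Unique (range n)
    range-unique = Unique.map⁺
      (λ {i} {j} eq → ℤ.+-injective (trans (sym (lem (+ i) (+ suc n))) (trans (cong (ℤ._+ + suc n) eq) (lem (+ j) (+ suc n)))))
      (Unique.upTo⁺ (2 ℕ.* suc n))

  dominoesAD-unique : Unique (dominoesAD n)
  dominoesAD-unique = Unique.filter⁺ (λ d → all? (inAD? n) (squares d)) (Unique.++⁺
    (Unique.map⁺ (λ { refl → refl }) squaresAD-unique)
    (Unique.map⁺ (λ { refl → refl }) squaresAD-unique)
    λ { (h∈ , v∈) → disjoint (∈-map⁻ horizontal h∈) (∈-map⁻ vertical v∈) })
    where
    disjoint : ∀ {d} → (∃ λ q → q ∈ squaresAD n × d ≡ horizontal q) → (∃ λ q → q ∈ squaresAD n × d ≡ vertical q) → _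
    disjoint (_ , _ , refl) (_ , _ , ())

  domino-injective : ∀ {e f} → domino e ≡ domino f → e ≡ f
  domino-injective {e} {f} eq = ends-injective e f (map-injective square-injective
    (trans (sym (squares-domino e)) (trans (cong squares eq) (squares-domino f))))
    where
    ends-injective : ∀ e f → ends e ≡ ends f → e ≡ f
    ends-injective (WB i j)  (WB k l)  refl = refl
    ends-injective (WB i j)  (WB⁺ k l) ()
    ends-injective (WB⁺ i j) (WB k l)  ()
    ends-injective (WB⁺ i j) (WB⁺ k l) refl = refl
    ends-injective (BW i j)  (BW k l)  refl = refl
    ends-injective (BW i j)  (B⁺W k l) ()
    ends-injective (B⁺W i j) (BW k l)  ()
    ends-injective (B⁺W i j) (B⁺W k l) refl = refl

∈layers⇒∈dominoes : ∀ m {d} → d ∈ map (domino (suc m)) (layers m 0 (suc m)) → d ∈ dominoesAD (suc m)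
∈layers⇒∈dominoes m d∈ with ∈-map⁻ (domino (suc m)) d∈
... | e , e∈ , refl = squares⊆⇒∈ n (domino n e)
      (subst (All (InAD n)) (sym (squares-domino n e)) (All.map⁺ (All.map (Valid⇒InAD n) (ends-valid in-e))))
  where
  n = suc m
  in-e = All.lookup (layers-in m 0 n ℕ.≤-refl) e∈
  ends-valid : ∀ {e} → InLayers n e → All (Valid n) (ends e)
  ends-valid (inWB i<n j<n)  = validW (ℕ.<⇒≤ i<n) j<n ∷ validB i<n (ℕ.<⇒≤ j<n) ∷ []
  ends-valid (inWB⁺ i<n j<n) = validW (ℕ.<⇒≤ i<n) j<n ∷ validB i<n j<n ∷ []
  ends-valid (inBW i<n j<n)  = validB i<n (ℕ.<⇒≤ j<n) ∷ validW i<n j<n ∷ []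
  ends-valid (inB⁺W i<n j<n) = validB i<n j<n ∷ validW i<n j<n ∷ []

∈dominoes⇒InLayers : ∀ n {d} → d ∈ dominoesAD n → ∃ λ e → InLayers n e × d ≡ domino n e
∈dominoes⇒InLayers n {d} d∈ = go d (∈⇒squares⊆ n d∈)
  where
  valid : ∀ {q} → InAD n (square n q) → Valid n q
  valid {q} inAD with InAD⇒Valid n _ inAD
  ... | q′ , valid-q′ , eq with refl ← square-injective n {q} {q′} eq = valid-q′
  ends-valid : ∀ e → All (InAD n) (squares (domino n e)) → All (Valid n) (ends e)
  ends-valid e all = All.map valid (All.map⁻ (subst (All (InAD n)) (squares-domino n e) all))
  go : ∀ d → All (InAD n) (squares d) → ∃ λ e → InLayers n e × d ≡ domino n e
  go (horizontal s) all@(inAD ∷ _) with InAD⇒Valid n s inAD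
  go (horizontal s) all | W i j , _ , refl with ends-valid (WB⁺ i j) all
  ... | validW _ j<n ∷ validB i<n _ ∷ [] = WB⁺ i j , inWB⁺ i<n j<n , refl
  go (horizontal s) all | B i j , _ , refl with ends-valid (BW i j) all
  ... | validB i<n _ ∷ validW _ j<n ∷ [] = BW i j , inBW i<n j<n , refl
  go (vertical s) all@(inAD ∷ _) with InAD⇒Valid n s inAD
  go (vertical s) all | W i j , _ , refl with ends-valid (WB i j) all
  ... | validW _ j<n ∷ validB i<n _ ∷ [] = WB i j , inWB i<n j<n , refl
  go (vertical s) all | B i (suc j) , _ , refl with ends-valid (B⁺W i j) all
  ... | validB i<n _ ∷ validW _ j<n ∷ [] = B⁺W i j , inB⁺W i<n j<n , refl
  -- The square above B i 0 has `anti` coordinate -1 and is outside the diamond.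
  go (vertical s) (_ ∷ inAD ∷ []) | B i zero , _ , refl with InAD⇒Valid n _ inAD
  ... | q , _ , eq = ⊥-elim (+≢-1 (trans (sym (anti-square n q)) (trans (cong (anti n) (sym eq)) (lem (+ i) (+ n)))))
    where
    +≢-1 : ∀ {k} → + k ≢ -1ℤ
    +≢-1 ()
    lem : ∀ i n → (i ℤ.+ 0ℤ ℤ.- n) ℤ.- (i ℤ.- 0ℤ ℤ.+ 1ℤ) ℤ.+ n ≡ -1ℤ
    lem = ℤ-Solver.solve-∀

-- Both lists are free of repetitions and have the same members.
dominoes-↭ : ∀ m → dominoesAD (suc m) ↭ map (domino (suc m)) (layers m 0 (suc m))
dominoes-↭ m = ∼bag⇒↭ (unique∧set⇒bag (dominoesAD-unique n)
  (Unique.map⁺ (domino-injective n) (layers-unique m 0 n))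
  (mk⇔ forward (∈layers⇒∈dominoes m)))
  where
  n = suc m
  forward : ∀ {d} → d ∈ dominoesAD n → d ∈ map (domino n) (layers m 0 n)
  forward d∈ with ∈dominoes⇒InLayers n d∈
  ... | e , in-e , refl = ∈-map⁺ (domino n) (InLayers⇒∈ m in-e)

#AD≡2^triangle : ∀ m → #AD (suc m) ≡ 2 ℕ.^ triangle (suc m)
#AD≡2^triangle m = begin
  #AD n
    -- With zero initial coverage the counted condition reduces to `IsTiling n`.
    ≡⟨ AD.count-sublists (dominoesAD n) (λ _ → 0) ⟩
  AD.tilings (dominoesAD n) (λ _ → 0)
    ≡⟨ AD.tilings-↭ (dominoes-↭ m) (λ _ → 0) ⟩
  AD.tilings (map (domino n) (layers m 0 n)) (λ _ → 0)
    ≡⟨ tilings-map (domino n) (square n) (square-injective n) (squares-domino n)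
         (λ q∈ → InAD⇒∈ n (Valid⇒InAD n (∈⇒Valid q∈))) squares⊆ (layers m 0 n) (λ _ → refl) ⟩
  tilings m (layers m 0 n) (λ _ → 0)
    ≡⟨ tilings-all m ⟩
  transfers n full (replicate n false)
    ≡⟨ transfers-full n ⟩
  2 ℕ.^ triangle n ∎
  where
  open ≡-Reasoning
  n = suc m
  module AD = ExactCover _≟□_ squares (squaresAD n)
  squares⊆ : ∀ {s} → s ∈ squaresAD n → s ∈ map (square n) (cells n)
  squares⊆ {s} s∈ with InAD⇒Valid n s (∈⇒InAD n s∈)
  ... | q , valid , refl = ∈-map⁺ (square n) (Valid⇒∈ valid)

corollary5p3 : (n : ℕ) → 1 ≤ n → + #AD n ≡ det (block (S n) (I n) (-ᴹ I n) (S n ᵀ))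
corollary5p3 (suc m) _ = trans (cong +_ (#AD≡2^triangle m)) (sym (det-block (suc m)))
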